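{- For all integers $d\ge 0$, $$\sup_{x\in[0,\infty)}\left|\frac{1}{S_d(x)}-e^{ -x}\right|\le 2^{ -\Omega(d)}.$$ Hence, for any $\delta>0$, there is a rational function of degree $O(\log(1/\delta))$ that is a $\delta$-approximation to $e^{ -x}$ over $[0,\infty)$.
   Context: $S_d(x)=\sum_{k=0}^d \frac{x^k}{k!}$. The notation $2^{ -\Omega(d)}$ means $2^{ -cd}$ for a universal constant $c>0$; the constant in $O(\cdot)$ is also universal. The degree of a rational function $p(x)/q(x)$ ($p,q$ polynomials) is the maximum of the degrees of $p$ and $q$. A function $g$ is a $\delta$-approximation to a function $f$ over an interval $I$ if $\sup_{x\in I}|f(x)-g(x)|\le\delta$. -}

module Defs where

open import Data.Nat as ℕ using (ℕ; zero; suc; _!)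
import Data.Nat.Properties as ℕP
open import Data.Integer as ℤ using (ℤ)
import Data.Integer.Properties as ℤP
open import Data.Rational as ℚ using (ℚ; 0ℚ; 1ℚ; ½) hiding (module ℚ)
import Data.Rational.Properties as ℚP
open import Data.Product using (Σ; ∃; _×_; _,_; proj₁; proj₂)
open import Data.Sum using (_⊎_; inj₁; inj₂; [_,_]′)
open import Data.Empty using (⊥-elim)
open import Function using (_∘_; case_of_)
open import Relation.Nullary using (yes; no)
open import Relation.Binary.PropositionalEquality

module Sequences where

  open import Data.Rational using (_+_; _*_; _-_; -_; ∣_∣; _≤_; _<_; _⊔_; _/_)
  open import Data.Rational.Solver using (module +-*-Solver)
  open +-*-Solver using (solve; _:=_; _:+_; _:*_; _:-_; :-_; con)

  Eventually : (ℕ → Set) → Set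
  Eventually P = ∃ λ N → ∀ n → N ℕ.≤ n → P n

  IsCauchy : (ℕ → ℚ) → Set
  IsCauchy a = ∀ ε → 0ℚ < ε →
    ∃ λ N → ∀ m n → N ℕ.≤ m → N ℕ.≤ n → ∣ a m - a n ∣ ≤ ε

  _≼_ _≺_ : (ℕ → ℚ) → (ℕ → ℚ) → Set
  a ≼ b = ∀ ε → 0ℚ < ε → Eventually λ n → a n ≤ b n + ε
  a ≺ b = ∃ λ ε → 0ℚ < ε × Eventually λ n → a n + ε ≤ b n

  recip : ℚ → ℚ
  recip p with p ℚ.≟ 0ℚ
  ... | yes _  = 0ℚ
  ... | no p≢0 = (ℚ.1/ p) {{ℚ.≢-nonZero p≢0}}

  abstract
    both : ∀ {P Q : ℕ → Set} → Eventually P → Eventually Q →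
           Eventually λ n → P n × Q n
    both (M , p) (N , q) = M ℕ.⊔ N , λ n h →
      p n (ℕP.≤-trans (ℕP.m≤m⊔n M N) h) , q n (ℕP.≤-trans (ℕP.m≤n⊔m M N) h)

    *-pos : ∀ {p q} → 0ℚ < p → 0ℚ < q → 0ℚ < p * q
    *-pos {p} {q} hp hq =
      ℚP.positive⁻¹ (p * q) {{ℚP.pos*pos⇒pos p {{ℚ.positive hp}} q {{ℚ.positive hq}}}}

    *-nonNeg : ∀ {p q} → 0ℚ ≤ p → 0ℚ ≤ q → 0ℚ ≤ p * q
    *-nonNeg {p} {q} hp hq = ℚP.nonNegative⁻¹ (p * q)
      {{ℚP.nonNeg*nonNeg⇒nonNeg p {{ℚ.nonNegative hp}} q {{ℚ.nonNegative hq}}}}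

    *-monoˡ : ∀ {p q} r → 0ℚ ≤ r → p ≤ q → r * p ≤ r * q
    *-monoˡ r hr = ℚP.*-monoˡ-≤-nonNeg r {{ℚ.nonNegative hr}}

    *-monoʳ : ∀ {p q} r → 0ℚ ≤ r → p ≤ q → p * r ≤ q * r
    *-monoʳ r hr = ℚP.*-monoʳ-≤-nonNeg r {{ℚ.nonNegative hr}}

    *-cancel : ∀ {p q} r → 0ℚ < r → r * p ≤ r * q → p ≤ q
    *-cancel r hr = ℚP.*-cancelˡ-≤-pos r {{ℚ.positive hr}}

    *-mono : ∀ {p q r s} → 0ℚ ≤ p → 0ℚ ≤ s → p ≤ q → r ≤ s → p * r ≤ q * s
    *-mono {p} {s = s} hp hs pq rs = ℚP.≤-trans (*-monoˡ p hp rs) (*-monoʳ s hs pq)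

    0<½ : 0ℚ < ½
    0<½ = ℚP.positive⁻¹ ½

    0<1 : 0ℚ < 1ℚ
    0<1 = ℚP.positive⁻¹ 1ℚ

    half : ∀ {ε} → 0ℚ < ε → 0ℚ < ε * ½
    half h = *-pos h 0<½

    half+half : ∀ ε → ε * ½ + ε * ½ ≡ ε
    half+half ε = trans (sym (ℚP.*-distribˡ-+ ε ½ ½)) (ℚP.*-identityʳ ε)

    ≤+nonNeg : ∀ {p q} → 0ℚ ≤ q → p ≤ p + q
    ≤+nonNeg {p} {q} h = subst (_≤ p + q) (ℚP.+-identityʳ p) (ℚP.+-monoʳ-≤ p h)

    nonNeg+≤ : ∀ {p q} → 0ℚ ≤ q → p ≤ q + p
    nonNeg+≤ {p} {q} h = subst (_≤ q + p) (ℚP.+-identityˡ p) (ℚP.+-monoˡ-≤ p h)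

    diff-nonNeg : ∀ {p q} → p ≤ q → 0ℚ ≤ q - p
    diff-nonNeg {p} {q} h = subst (_≤ q - p) (ℚP.+-inverseʳ p) (ℚP.+-monoˡ-≤ (- p) h)

    ≤-from-diff : ∀ {p q} → 0ℚ ≤ q - p → p ≤ q
    ≤-from-diff {p} {q} h = subst (p ≤_)
      (solve 2 (λ p q → p :+ (q :- p) := q) refl p q) (≤+nonNeg h)

    p≤∣p∣ : ∀ p → p ≤ ∣ p ∣
    p≤∣p∣ p with ℚP.≤-total 0ℚ p
    ... | inj₁ h = ℚP.≤-reflexive (sym (ℚP.0≤p⇒∣p∣≡p h))
    ... | inj₂ h = ℚP.≤-trans h (ℚP.0≤∣p∣ p)

    ∣-∣-swap : ∀ p q → ∣ p - q ∣ ≡ ∣ q - p ∣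
    ∣-∣-swap p q = trans (cong ∣_∣ (solve 2 (λ p q → p :- q := :- (q :- p)) refl p q))
                         (ℚP.∣-p∣≡∣p∣ (q - p))

    dist⇒≤ : ∀ {p q e} → ∣ p - q ∣ ≤ e → p ≤ q + e
    dist⇒≤ {p} {q} {e} h = subst (_≤ q + e)
      (solve 2 (λ p q → q :+ (p :- q) := p) refl p q)
      (ℚP.+-monoʳ-≤ q (ℚP.≤-trans (p≤∣p∣ (p - q)) h))

    dist⇒≥ : ∀ {p q e} → ∣ p - q ∣ ≤ e → q ≤ p + e
    dist⇒≥ {p} {q} {e} h = dist⇒≤ (subst (_≤ e) (∣-∣-swap p q) h)

    ≤⇒dist : ∀ {p q e} → p ≤ q + e → q ≤ p + e → ∣ p - q ∣ ≤ e
    ≤⇒dist {p} {q} {e} h k with ℚP.∣p∣≡p∨∣p∣≡-p (p - q)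
    ... | inj₁ eq = subst (_≤ e) (sym eq) (subst (p - q ≤_)
          (solve 2 (λ q e → q :+ e :- q := e) refl q e) (ℚP.+-monoˡ-≤ (- q) h))
    ... | inj₂ eq = subst (_≤ e) (trans (solve 2 (λ p q → q :- p := :- (p :- q)) refl p q) (sym eq))
          (subst (q - p ≤_)
          (solve 2 (λ q e → q :+ e :- q := e) refl p e) (ℚP.+-monoˡ-≤ (- p) k))

    triangle : ∀ p q r → ∣ p - r ∣ ≤ ∣ p - q ∣ + ∣ q - r ∣
    triangle p q r = subst (λ t → ∣ t ∣ ≤ ∣ p - q ∣ + ∣ q - r ∣)
      (solve 3 (λ p q r → (p :- q) :+ (q :- r) := p :- r) refl p q r)
      (ℚP.∣p+q∣≤∣p∣+∣q∣ (p - q) (q - r))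

    recip-inverse : ∀ p → p ≢ 0ℚ → p * recip p ≡ 1ℚ
    recip-inverse p p≢0 with p ℚ.≟ 0ℚ
    ... | yes eq = ⊥-elim (p≢0 eq)
    ... | no h   = ℚP.*-inverseʳ p {{ℚ.≢-nonZero h}}

    pos≢0 : ∀ {p} → 0ℚ < p → p ≢ 0ℚ
    pos≢0 h eq = ℚP.<-irrefl (sym eq) h

    recip-pos : ∀ {p} → 0ℚ < p → 0ℚ < recip p
    recip-pos {p} h with p ℚ.≟ 0ℚ
    ... | yes eq = ⊥-elim (pos≢0 h eq)
    ... | no p≢0 = ℚP.positive⁻¹ _ {{ℚP.1/pos⇒pos p {{ℚ.positive h}}}}

    ≤-nat : ∀ p → ∃ λ k → p ≤ ℤ.+ k / 1
    ≤-nat p@(ℚ.mkℚ n d c) = ℤ.∣ n ∣ , ℚP.toℚᵘ-cancel-≤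
      (ℚᵘP.≤-trans bound (ℚᵘP.≤-reflexive (ℚᵘP.≃-sym (ℚP.toℚᵘ-fromℚᵘ (ℚᵘ.mkℚᵘ (ℤ.+ ℤ.∣ n ∣) 0)))))
      where
      import Data.Rational.Unnormalised as ℚᵘ
      import Data.Rational.Unnormalised.Properties as ℚᵘP
      bound : ℚ.toℚᵘ p ℚᵘ.≤ ℚᵘ.mkℚᵘ (ℤ.+ ℤ.∣ n ∣) 0
      bound = ℚᵘ.*≤* (ℤP.≤-trans
        (subst (ℤ._≤ ℤ.+ ℤ.∣ n ∣) (sym (ℤP.*-identityʳ n)) (n≤∣n∣ n))
        (subst₂ ℤ._≤_ (ℤP.*-identityʳ (ℤ.+ ℤ.∣ n ∣)) refl
          (ℤP.*-monoˡ-≤-nonNeg (ℤ.+ ℤ.∣ n ∣) {ℤ.+ 1} {ℤ.+ suc d} (ℤ.+≤+ (ℕ.s≤s ℕ.z≤n)))))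
        where
        n≤∣n∣ : ∀ i → i ℤ.≤ ℤ.+ ℤ.∣ i ∣
        n≤∣n∣ (ℤ.+ k)    = ℤP.≤-refl
        n≤∣n∣ ℤ.-[1+ k ] = ℤ.-≤+

    fromℕ-suc : ∀ k → ℤ.+ suc k / 1 ≡ 1ℚ + ℤ.+ k / 1
    fromℕ-suc k = ℚP.toℚᵘ-injective (ℚᵘP.≃-trans (ℚP.toℚᵘ-fromℚᵘ (ℚᵘ.mkℚᵘ (ℤ.+ suc k) 0))
      (ℚᵘP.≃-trans (ℚᵘ.*≡* (cong (ℤ._* ℤ.1ℤ) (sym (cong (ℤ._+_ ℤ.1ℤ) (ℤP.*-identityʳ (ℤ.+ k))))))
      (ℚᵘP.≃-trans (ℚᵘP.+-congʳ ℚᵘ.1ℚᵘ (ℚᵘP.≃-sym (ℚP.toℚᵘ-fromℚᵘ (ℚᵘ.mkℚᵘ (ℤ.+ k) 0))))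
        (ℚᵘP.≃-sym (ℚP.toℚᵘ-homo-+ 1ℚ (ℤ.+ k / 1))))))
      where
      import Data.Rational.Unnormalised as ℚᵘ
      import Data.Rational.Unnormalised.Properties as ℚᵘP

    fromℕ-* : ∀ m n → (ℤ.+ (m ℕ.* n)) / 1 ≡ (ℤ.+ m / 1) * (ℤ.+ n / 1)
    fromℕ-* zero n = sym (ℚP.*-zeroˡ (ℤ.+ n / 1))
    fromℕ-* (suc m) n = trans (fromℕ-+ n (m ℕ.* n)) (trans (cong (ℤ.+ n / 1 +_) (fromℕ-* m n))
      (trans (solve 2 (λ a b → b :+ a :* b := (con 1ℚ :+ a) :* b) refl (ℤ.+ m / 1) (ℤ.+ n / 1))
        (cong (_* (ℤ.+ n / 1)) (sym (fromℕ-suc m)))))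
      where
      fromℕ-+ : ∀ m n → (ℤ.+ (m ℕ.+ n)) / 1 ≡ (ℤ.+ m / 1) + (ℤ.+ n / 1)
      fromℕ-+ zero n = sym (ℚP.+-identityˡ (ℤ.+ n / 1))
      fromℕ-+ (suc m) n = trans (fromℕ-suc (m ℕ.+ n)) (trans (cong (1ℚ +_) (fromℕ-+ m n))
        (trans (sym (ℚP.+-assoc 1ℚ (ℤ.+ m / 1) (ℤ.+ n / 1)))
          (cong (_+ (ℤ.+ n / 1)) (sym (fromℕ-suc m)))))

    fromℕ-mono : ∀ {m n} → m ℕ.≤ n → ℤ.+ m / 1 ≤ ℤ.+ n / 1
    fromℕ-mono {n = n} ℕ.z≤n = ℚP.nonNegative⁻¹ (ℤ.+ n / 1) {{ℚP.normalize-nonNeg n 1}}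
    fromℕ-mono (ℕ.s≤s {m} {n} h) = subst₂ _≤_ (sym (fromℕ-suc m)) (sym (fromℕ-suc n))
      (ℚP.+-monoʳ-≤ 1ℚ (fromℕ-mono h))

    /-fromℕ : ∀ a n .{{_ : ℕ.NonZero n}} → (ℤ.+ a / n) * (ℤ.+ n / 1) ≡ ℤ.+ a / 1
    /-fromℕ a n@(suc k) = ℚP.toℚᵘ-injective (ℚᵘP.≃-trans (ℚP.toℚᵘ-homo-* (ℤ.+ a / n) (ℤ.+ n / 1))
      (ℚᵘP.≃-trans (ℚᵘP.*-cong (ℚP.toℚᵘ-fromℚᵘ (ℚᵘ.mkℚᵘ (ℤ.+ a) k)) (ℚP.toℚᵘ-fromℚᵘ (ℚᵘ.mkℚᵘ (ℤ.+ n) 0)))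
      (ℚᵘP.≃-trans (ℚᵘ.*≡* (trans (ℤP.*-identityʳ _) (cong (ℤ.+ a ℤ.*_) (sym (ℤP.*-identityʳ (ℤ.+ n))))))
      (ℚᵘP.≃-sym (ℚP.toℚᵘ-fromℚᵘ (ℚᵘ.mkℚᵘ (ℤ.+ a) 0))))))
      where
      import Data.Rational.Unnormalised as ℚᵘ
      import Data.Rational.Unnormalised.Properties as ℚᵘP

    archimedean : ∀ p {q} → 0ℚ < q → ∃ λ k → p ≤ (ℤ.+ k / 1) * q
    archimedean p {q} hq with ≤-nat (p * recip q)
    ... | k , h = k , subst (_≤ (ℤ.+ k / 1) * q) eq (*-monoʳ q (ℚP.<⇒≤ hq) h)
      where
      eq : p * recip q * q ≡ p
      eq = trans (solve 3 (λ p q r → p :* r :* q := p :* (q :* r)) refl p q (recip q))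
        (trans (cong (p *_) (recip-inverse q (pos≢0 hq))) (ℚP.*-identityʳ p))

    1/suc : ℕ → ℚ
    1/suc n = recip (1ℚ + ℤ.+ n / 1)

    1+n-pos : ∀ n → 0ℚ < 1ℚ + ℤ.+ n / 1
    1+n-pos n = ℚP.<-≤-trans 0<1 (≤+nonNeg (fromℕ-mono {0} {n} ℕ.z≤n))

    1/suc-pos : ∀ n → 0ℚ < 1/suc n
    1/suc-pos n = recip-pos (1+n-pos n)

    recip≤ : ∀ {x k ε} → 0ℚ < x → 0ℚ ≤ ε → 1ℚ ≤ k * ε → k ≤ x → recip x ≤ ε
    recip≤ {x} {k} {ε} hx hε h kx = *-cancel x hx (begin
        x * recip x ≡⟨ recip-inverse x (pos≢0 hx) ⟩
        1ℚ          ≤⟨ h ⟩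
        k * ε       ≤⟨ *-monoʳ ε hε kx ⟩
        x * ε       ∎)
      where open ℚP.≤-Reasoning

    1/suc-small : ∀ ε → 0ℚ < ε → Eventually λ n → 1/suc n ≤ ε
    1/suc-small ε hε = proj₁ arch , λ n hn →
      recip≤ {1ℚ + ℤ.+ n / 1} {ℤ.+ proj₁ arch / 1} (1+n-pos n) (ℚP.<⇒≤ hε) (proj₂ arch)
        (ℚP.≤-trans (fromℕ-mono {proj₁ arch} {n} hn) (nonNeg+≤ {ℤ.+ n / 1} {1ℚ} (ℚP.<⇒≤ 0<1)))
      where
      arch : ∃ λ k → 1ℚ ≤ (ℤ.+ k / 1) * ε
      arch = archimedean 1ℚ hε

    bounded : ∀ {a} → IsCauchy a → ∃ λ B → 0ℚ < B × (∀ n → ∣ a n ∣ ≤ B)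
    bounded {a} ca with ca 1ℚ 0<1
    ... | N , h = B , ℚP.<-≤-trans 0<1 (ℚP.≤-trans (≤+nonNeg (ℚP.0≤∣p∣ (a N))) (ℚP.p≤q⊔p (initial N) _)) , all
      where
      initial : ℕ → ℚ
      initial zero    = 0ℚ
      initial (suc n) = initial n ⊔ ∣ a n ∣
      B : ℚ
      B = initial N ⊔ (1ℚ + ∣ a N ∣)
      initial-bound : ∀ M n → n ℕ.< M → ∣ a n ∣ ≤ initial M
      initial-bound (suc M) n (ℕ.s≤s n≤M) with ℕP.m≤n⇒m<n∨m≡n n≤M
      ... | inj₁ lt   = ℚP.≤-trans (initial-bound M n lt) (ℚP.p≤p⊔q (initial M) _)
      ... | inj₂ refl = ℚP.p≤q⊔p (initial M) _
      all : ∀ n → ∣ a n ∣ ≤ B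
      all n with ℕP.<-≤-connex n N
      ... | inj₁ lt = ℚP.≤-trans (initial-bound N n lt) (ℚP.p≤p⊔q (initial N) _)
      ... | inj₂ le = ℚP.≤-trans
        (ℚP.≤-trans (ℚP.≤-reflexive (cong ∣_∣ (solve 2 (λ x y → x := (x :- y) :+ y) refl (a n) (a N))))
          (ℚP.≤-trans (ℚP.∣p+q∣≤∣p∣+∣q∣ (a n - a N) (a N))
            (ℚP.+-monoˡ-≤ ∣ a N ∣ (h n N le ℕP.≤-refl))))
        (ℚP.p≤q⊔p (initial N) _)

    const-cauchy : ∀ q → IsCauchy (λ _ → q)
    const-cauchy q ε hε = 0 , λ m n _ _ →
      subst (_≤ ε) (sym (cong ∣_∣ (ℚP.+-inverseʳ q))) (ℚP.<⇒≤ hε)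

    neg-cauchy : ∀ {a} → IsCauchy a → IsCauchy (λ n → - a n)
    neg-cauchy {a} ca ε hε with ca ε hε
    ... | N , h = N , λ m n hm hn → subst (_≤ ε)
      (trans (∣-∣-swap (a m) (a n)) (cong ∣_∣ (solve 2 (λ x y → y :- x := :- x :- :- y) refl (a m) (a n))))
      (h m n hm hn)

    lipschitz₂-cauchy : ∀ (_∙_ : ℚ → ℚ → ℚ) →
      (∀ p q r s {d e} → ∣ p - r ∣ ≤ d → ∣ q - s ∣ ≤ e → ∣ (p ∙ q) - (r ∙ s) ∣ ≤ d + e) →
      ∀ {a b} → IsCauchy a → IsCauchy b → IsCauchy (λ n → a n ∙ b n)
    lipschitz₂-cauchy _∙_ lip {a} {b} ca cb ε hε
      with ca (ε * ½) (half hε) | cb (ε * ½) (half hε)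
    ... | M , p | N , q = M ℕ.⊔ N , λ m n hm hn → subst (∣ (a m ∙ b m) - (a n ∙ b n) ∣ ≤_) (half+half ε)
      (lip (a m) (b m) (a n) (b n)
        (p m n (ℕP.≤-trans (ℕP.m≤m⊔n M N) hm) (ℕP.≤-trans (ℕP.m≤m⊔n M N) hn))
        (q m n (ℕP.≤-trans (ℕP.m≤n⊔m M N) hm) (ℕP.≤-trans (ℕP.m≤n⊔m M N) hn)))

    +-cauchy : ∀ {a b} → IsCauchy a → IsCauchy b → IsCauchy (λ n → a n + b n)
    +-cauchy {a} {b} = lipschitz₂-cauchy _+_ (λ p q r s hd he → ℚP.≤-trans
      (ℚP.≤-reflexive (cong ∣_∣ (solve 4 (λ p q r s → (p :+ q) :- (r :+ s) := (p :- r) :+ (q :- s)) refl p q r s)))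
      (ℚP.≤-trans (ℚP.∣p+q∣≤∣p∣+∣q∣ (p - r) (q - s)) (ℚP.+-mono-≤ hd he))) {a} {b}

    ⊔-cauchy : ∀ {a b} → IsCauchy a → IsCauchy b → IsCauchy (λ n → a n ⊔ b n)
    ⊔-cauchy {a} {b} = lipschitz₂-cauchy _⊔_ (λ p q r s hd he → ≤⇒dist
      (one p q r s (dist⇒≤ {p} hd) (dist⇒≤ {q} he) (nonNeg {p - r} hd) (nonNeg {q - s} he))
      (one r s p q (dist⇒≥ {p} hd) (dist⇒≥ {q} he) (nonNeg {p - r} hd) (nonNeg {q - s} he))) {a} {b}
      where
      nonNeg : ∀ {p e} → ∣ p ∣ ≤ e → 0ℚ ≤ e
      nonNeg {p} h = ℚP.≤-trans (ℚP.0≤∣p∣ p) h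
      one : ∀ p q r s {d e} → p ≤ r + d → q ≤ s + e → 0ℚ ≤ d → 0ℚ ≤ e → p ⊔ q ≤ (r ⊔ s) + (d + e)
      one p q r s h k hd he = ℚP.⊔-lub
        (ℚP.≤-trans h (ℚP.+-mono-≤ (ℚP.p≤p⊔q r s) (≤+nonNeg he)))
        (ℚP.≤-trans k (ℚP.+-mono-≤ (ℚP.p≤q⊔p r s) (nonNeg+≤ hd)))

    ∣∣-cauchy : ∀ {a} → IsCauchy a → IsCauchy (λ n → ∣ a n ∣)
    ∣∣-cauchy {a} ca ε hε with ca ε hε
    ... | N , h = N , λ m n hm hn → ℚP.≤-trans (≤⇒dist
        (ℚP.≤-trans (ℚP.≤-reflexive (cong ∣_∣ (solve 2 (λ x y → x := y :+ (x :- y)) refl (a m) (a n))))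
          (ℚP.∣p+q∣≤∣p∣+∣q∣ (a n) (a m - a n)))
        (ℚP.≤-trans (ℚP.≤-reflexive (cong ∣_∣ (solve 2 (λ x y → y := x :- (x :- y)) refl (a m) (a n))))
          (ℚP.∣p-q∣≤∣p∣+∣q∣ (a m) (a m - a n))))
      (h m n hm hn)

    *-cauchy : ∀ {a b} → IsCauchy a → IsCauchy b → IsCauchy (λ n → a n * b n)
    *-cauchy {a} {b} ca cb with bounded ca | bounded cb
    ... | A , hA , boundA | B , hB , boundB = λ ε hε →
      let ε₁ = ε * ½ * recip B
          ε₂ = ε * ½ * recip A
          M , p = ca ε₁ (*-pos (half hε) (recip-pos hB))
          N , q = cb ε₂ (*-pos (half hε) (recip-pos hA))
      in M ℕ.⊔ N , λ m n hm hn → begin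
        ∣ a m * b m - a n * b n ∣
          ≡⟨ cong ∣_∣ (solve 4 (λ p q r s → p :* q :- r :* s := (p :- r) :* q :+ (q :- s) :* r)
               refl (a m) (b m) (a n) (b n)) ⟩
        ∣ (a m - a n) * b m + (b m - b n) * a n ∣
          ≤⟨ ℚP.∣p+q∣≤∣p∣+∣q∣ ((a m - a n) * b m) ((b m - b n) * a n) ⟩
        ∣ (a m - a n) * b m ∣ + ∣ (b m - b n) * a n ∣
          ≡⟨ cong₂ _+_ (ℚP.∣p*q∣≡∣p∣*∣q∣ (a m - a n) (b m)) (ℚP.∣p*q∣≡∣p∣*∣q∣ (b m - b n) (a n)) ⟩
        ∣ a m - a n ∣ * ∣ b m ∣ + ∣ b m - b n ∣ * ∣ a n ∣
          ≤⟨ ℚP.+-mono-≤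
               (*-mono (ℚP.0≤∣p∣ (a m - a n)) (ℚP.<⇒≤ hB)
                 (p m n (ℕP.≤-trans (ℕP.m≤m⊔n M N) hm) (ℕP.≤-trans (ℕP.m≤m⊔n M N) hn)) (boundB m))
               (*-mono (ℚP.0≤∣p∣ (b m - b n)) (ℚP.<⇒≤ hA)
                 (q m n (ℕP.≤-trans (ℕP.m≤n⊔m M N) hm) (ℕP.≤-trans (ℕP.m≤n⊔m M N) hn)) (boundA n)) ⟩
        ε₁ * B + ε₂ * A
          ≡⟨ cong₂ _+_ (absorb (ε * ½) B hB) (absorb (ε * ½) A hA) ⟩
        ε * ½ + ε * ½
          ≡⟨ half+half ε ⟩
        ε ∎
      where
      open ℚP.≤-Reasoning
      absorb : ∀ x y → 0ℚ < y → x * recip y * y ≡ x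
      absorb x y hy = trans (solve 3 (λ x y z → x :* z :* y := x :* (y :* z)) refl x y (recip y))
        (trans (cong (x *_) (recip-inverse y (pos≢0 hy))) (ℚP.*-identityʳ x))

    recip-cauchy : ∀ {a ε} → 0ℚ < ε → Eventually (λ n → ε ≤ ∣ a n ∣) →
                   IsCauchy a → IsCauchy (λ n → recip (a n))
    recip-cauchy {a} {ε} hε (N , away) ca η hη with ca (ε * ε * η) (*-pos (*-pos hε hε) hη)
    ... | M , h = M ℕ.⊔ N , λ m n hm hn → *-cancel (ε * ε) (*-pos hε hε) (begin
        ε * ε * ∣ recip (a m) - recip (a n) ∣
          ≤⟨ *-monoʳ _ (ℚP.0≤∣p∣ (recip (a m) - recip (a n)))
              (*-mono (ℚP.<⇒≤ hε) (ℚP.0≤∣p∣ (a n))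
                (away m (ℕP.≤-trans (ℕP.m≤n⊔m M N) hm)) (away n (ℕP.≤-trans (ℕP.m≤n⊔m M N) hn))) ⟩
        ∣ a m ∣ * ∣ a n ∣ * ∣ recip (a m) - recip (a n) ∣
          ≡⟨ cong (_* ∣ recip (a m) - recip (a n) ∣) (sym (ℚP.∣p*q∣≡∣p∣*∣q∣ (a m) (a n))) ⟩
        ∣ a m * a n ∣ * ∣ recip (a m) - recip (a n) ∣
          ≡⟨ sym (ℚP.∣p*q∣≡∣p∣*∣q∣ (a m * a n) (recip (a m) - recip (a n))) ⟩
        ∣ a m * a n * (recip (a m) - recip (a n)) ∣
          ≡⟨ cong ∣_∣ (solve 4 (λ x y r s → x :* y :* (r :- s) := (x :* r) :* y :- (y :* s) :* x)
               refl (a m) (a n) (recip (a m)) (recip (a n))) ⟩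
        ∣ (a m * recip (a m)) * a n - (a n * recip (a n)) * a m ∣
          ≡⟨ cong₂ (λ u v → ∣ u * a n - v * a m ∣)
               (recip-inverse (a m) (≢0 m (ℕP.≤-trans (ℕP.m≤n⊔m M N) hm)))
               (recip-inverse (a n) (≢0 n (ℕP.≤-trans (ℕP.m≤n⊔m M N) hn))) ⟩
        ∣ 1ℚ * a n - 1ℚ * a m ∣
          ≡⟨ cong₂ (λ u v → ∣ u - v ∣) (ℚP.*-identityˡ (a n)) (ℚP.*-identityˡ (a m)) ⟩
        ∣ a n - a m ∣
          ≤⟨ h n m (ℕP.≤-trans (ℕP.m≤m⊔n M N) hn) (ℕP.≤-trans (ℕP.m≤m⊔n M N) hm) ⟩
        ε * ε * η ∎)
      where
      open ℚP.≤-Reasoning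
      ≢0 : ∀ n → N ℕ.≤ n → a n ≢ 0ℚ
      ≢0 n h eq = ℚP.<-irrefl refl (ℚP.<-≤-trans hε (ℚP.≤-trans (away n h) (ℚP.≤-reflexive (cong ∣_∣ eq))))

    inverse-of-bound : ∀ {p B} → 0ℚ < p → p ≤ B → recip B ≤ recip p
    inverse-of-bound {p} {B} hp pB = begin
      recip B                   ≡⟨ sym (ℚP.*-identityʳ (recip B)) ⟩
      recip B * 1ℚ              ≡⟨ cong (recip B *_) (sym (recip-inverse p (pos≢0 hp))) ⟩
      recip B * (p * recip p)   ≤⟨ *-monoˡ _ (ℚP.<⇒≤ (recip-pos hB))
                                     (*-monoʳ _ (ℚP.<⇒≤ (recip-pos hp)) pB) ⟩
      recip B * (B * recip p)   ≡⟨ solve 3 (λ r b x → r :* (b :* x) := (b :* r) :* x) refl (recip B) B (recip p) ⟩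
      B * recip B * recip p     ≡⟨ cong (_* recip p) (recip-inverse B (pos≢0 hB)) ⟩
      1ℚ * recip p              ≡⟨ ℚP.*-identityˡ (recip p) ⟩
      recip p                   ∎
      where
      open ℚP.≤-Reasoning
      hB : 0ℚ < B
      hB = ℚP.<-≤-trans hp pB

    0≺recip : ∀ {a} → IsCauchy a → (λ _ → 0ℚ) ≺ a → (λ _ → 0ℚ) ≺ (λ n → recip (a n))
    0≺recip {a} ca (ε , hε , N , h) with bounded ca
    ... | B , hB , bound = recip B , recip-pos hB , N , λ n hn →
      subst (_≤ recip (a n)) (sym (ℚP.+-identityˡ (recip B)))
        (inverse-of-bound (ℚP.<-≤-trans hε (subst (_≤ a n) (ℚP.+-identityˡ ε) (h n hn)))
          (ℚP.≤-trans (p≤∣p∣ (a n)) (bound n)))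

    ≺⇒apart : ∀ {a} → a ≺ (λ _ → 0ℚ) ⊎ (λ _ → 0ℚ) ≺ a →
              ∃ λ ε → 0ℚ < ε × Eventually λ n → ε ≤ ∣ a n ∣
    ≺⇒apart {a} (inj₁ (ε , hε , N , h)) = ε , hε , N , λ n hn →
      subst (ε ≤_) (ℚP.∣-p∣≡∣p∣ (a n)) (ℚP.≤-trans (≤-from-diff
        (subst (0ℚ ≤_) (solve 2 (λ x e → con 0ℚ :- (x :+ e) := (:- x) :- e) refl (a n) ε)
          (diff-nonNeg (h n hn)))) (p≤∣p∣ (- a n)))
    ≺⇒apart {a} (inj₂ (ε , hε , N , h)) = ε , hε , N , λ n hn →
      ℚP.≤-trans (subst (_≤ a n) (ℚP.+-identityˡ ε) (h n hn)) (p≤∣p∣ (a n))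

    0≼* : ∀ {a b} → IsCauchy a → IsCauchy b →
          (λ _ → 0ℚ) ≼ a → (λ _ → 0ℚ) ≼ b → (λ _ → 0ℚ) ≼ (λ n → a n * b n)
    0≼* {a} {b} ca cb 0a 0b ε hε with bounded ca | bounded cb
    ... | A , hA , boundA | B , hB , boundB
      with both (0a (ε * recip B) (*-pos hε (recip-pos hB))) (0b (ε * recip A) (*-pos hε (recip-pos hA)))
    ... | N , h = N , λ n hn → sign n (proj₁ (h n hn)) (proj₂ (h n hn))
      where
      cancel : ∀ y → 0ℚ < y → ε * recip y * y ≡ ε
      cancel y hy = trans (solve 3 (λ x y z → x :* z :* y := x :* (y :* z)) refl ε y (recip y))
        (trans (cong (ε *_) (recip-inverse y (pos≢0 hy))) (ℚP.*-identityʳ ε))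
      neg-bound : ∀ {x d} → 0ℚ ≤ x + d → - x ≤ d
      neg-bound {x} {d} h = ≤-from-diff (subst (0ℚ ≤_) (solve 2 (λ x d → x :+ d := d :- :- x) refl x d) h)
      add-nonNeg : ∀ {x y e} → x * y ≤ e → 0ℚ ≤ (- x) * y + e
      add-nonNeg {x} {y} {e} h = subst (0ℚ ≤_) (solve 3 (λ x y e → e :- x :* y := (:- x) :* y :+ e) refl x y e)
        (diff-nonNeg h)
      -- The factor of negative sign is small and the other one is bounded.
      mixed : ∀ x y {d Y} → 0ℚ < Y → ∣ y ∣ ≤ Y → x ≤ 0ℚ → 0ℚ ≤ y → 0ℚ ≤ x + d → d * Y ≡ ε → 0ℚ ≤ x * y + ε
      mixed x y {d} {Y} hY bY x≤0 0≤y hx eq = subst (λ t → 0ℚ ≤ t * y + ε) (solve 1 (λ x → :- :- x := x) refl x)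
        (add-nonNeg { - x} {y} (subst ((- x) * y ≤_) eq
          (*-mono (ℚP.neg-antimono-≤ x≤0) (ℚP.<⇒≤ hY) (neg-bound hx) (ℚP.≤-trans (p≤∣p∣ y) bY))))
      sign : ∀ n → 0ℚ ≤ a n + ε * recip B → 0ℚ ≤ b n + ε * recip A → 0ℚ ≤ a n * b n + ε
      sign n ha hb with ℚP.≤-total 0ℚ (a n) | ℚP.≤-total 0ℚ (b n)
      ... | inj₁ p | inj₁ q = ℚP.≤-trans (*-nonNeg p q) (≤+nonNeg (ℚP.<⇒≤ hε))
      ... | inj₂ p | inj₂ q = ℚP.≤-trans (subst (0ℚ ≤_)
              (solve 2 (λ x y → (:- x) :* (:- y) := x :* y) refl (a n) (b n))
              (*-nonNeg (ℚP.neg-antimono-≤ p) (ℚP.neg-antimono-≤ q))) (≤+nonNeg (ℚP.<⇒≤ hε))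
      ... | inj₂ p | inj₁ q = mixed (a n) (b n) hB (boundB n) p q ha (cancel B hB)
      ... | inj₁ p | inj₂ q = subst (λ t → 0ℚ ≤ t + ε) (ℚP.*-comm (b n) (a n))
              (mixed (b n) (a n) hA (boundA n) q p hb (cancel A hA))

open Sequences using (Eventually; IsCauchy; _≼_; _≺_)

-- The existential in IsCauchy is a Σ-type, so a real carries a modulus of
-- convergence.
record ℝ : Set where
  constructor real
  field
    seq    : ℕ → ℚ
    cauchy : IsCauchy seq

open ℝ public

infix  4 _≤_ _<_ _#_ _⟶_
infixl 6 _+_ _-_ _⊔_
infixl 7 _*_
infix  8 -_
infixr 8 _^_

-- Equality of reals is the equivalence relation x ≤ y × y ≤ x.
_≤_ _<_ _#_ : ℝ → ℝ → Set
x ≤ y = seq x ≼ seq y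
x < y = seq x ≺ seq y
x # y = x < y ⊎ y < x

fromℚ : ℚ → ℝ
fromℚ q = real (λ _ → q) (Sequences.const-cauchy q)

fromℕ : ℕ → ℝ
fromℕ n = fromℚ (ℤ.+ n ℚ./ 1)

_+_ _*_ _⊔_ : ℝ → ℝ → ℝ
x + y = real (λ n → seq x n ℚ.+ seq y n) (Sequences.+-cauchy {seq x} {seq y} (cauchy x) (cauchy y))
x * y = real (λ n → seq x n ℚ.* seq y n) (Sequences.*-cauchy {seq x} {seq y} (cauchy x) (cauchy y))
x ⊔ y = real (λ n → seq x n ℚ.⊔ seq y n) (Sequences.⊔-cauchy {seq x} {seq y} (cauchy x) (cauchy y))

-_ ∣_∣ : ℝ → ℝ
- x   = real (λ n → ℚ.- seq x n) (Sequences.neg-cauchy {seq x} (cauchy x))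
∣ x ∣ = real (λ n → ℚ.∣ seq x n ∣) (Sequences.∣∣-cauchy {seq x} (cauchy x))

_-_ : ℝ → ℝ → ℝ
x - y = x + - y

inv : (x : ℝ) → x # fromℕ 0 → ℝ
inv x x#0 with Sequences.≺⇒apart {seq x} x#0
... | ε , hε , away =
  real (λ n → Sequences.recip (seq x n)) (Sequences.recip-cauchy {seq x} hε away (cauchy x))

_^_ : ℝ → ℕ → ℝ
x ^ zero  = fromℕ 1
x ^ suc n = x * x ^ n

Σ≤ : ℕ → (ℕ → ℝ) → ℝ
Σ≤ zero    f = f zero
Σ≤ (suc n) f = Σ≤ n f + f (suc n)

IsCauchyℝ : (ℕ → ℝ) → Set
IsCauchyℝ f = ∀ ε → 0ℚ ℚ.< ε →
  ∃ λ N → ∀ m n → N ℕ.≤ m → N ℕ.≤ n → ∣ f m - f n ∣ ≤ fromℚ ε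

_⟶_ : (ℕ → ℝ) → ℝ → Set
f ⟶ x = ∀ ε → 0ℚ ℚ.< ε → Eventually λ n → ∣ f n - x ∣ ≤ fromℚ ε

module Completeness (f : ℕ → ℝ) (fc : IsCauchyℝ f) where

  open Sequences
  open ℚP.≤-Reasoning

  private
    dist : ℚ → ℚ → ℚ
    dist p q = ℚ.∣ p ℚ.- q ∣

    modulus : ∀ n → ∃ λ N → ∀ i j → N ℕ.≤ i → N ℕ.≤ j →
              dist (seq (f n) i) (seq (f n) j) ℚ.≤ 1/suc n
    modulus n = cauchy (f n) (1/suc n) (1/suc-pos n)

    -- A rational within 1/(n+1) of f n.
    diagonal : ℕ → ℚ
    diagonal n = seq (f n) (proj₁ (modulus n))

    abstract
      quarter : ∀ {ε} → 0ℚ ℚ.< ε → 0ℚ ℚ.< ε ℚ.* ½ ℚ.* ½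
      quarter h = half (half h)

      quarters : ∀ ε → let q = ε ℚ.* ½ ℚ.* ½ in (q ℚ.+ q) ℚ.+ (q ℚ.+ q) ≡ ε
      quarters ε = trans (cong₂ ℚ._+_ (half+half (ε ℚ.* ½)) (half+half (ε ℚ.* ½))) (half+half ε)

      path : ∀ p q r s t {e} → dist p q ℚ.≤ e → dist q r ℚ.≤ e ℚ.+ e → dist r s ℚ.≤ e →
             s ≡ t → dist p t ℚ.≤ (e ℚ.+ e) ℚ.+ (e ℚ.+ e)
      path p q r s t {e} h₁ h₂ h₃ refl = begin
        dist p s                                ≤⟨ triangle p q s ⟩
        dist p q ℚ.+ dist q s                   ≤⟨ ℚP.+-mono-≤ h₁ (triangle q r s) ⟩
        e ℚ.+ (dist q r ℚ.+ dist r s)           ≤⟨ ℚP.+-monoʳ-≤ e (ℚP.+-mono-≤ h₂ h₃) ⟩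
        e ℚ.+ ((e ℚ.+ e) ℚ.+ e)                 ≡⟨ trans (sym (ℚP.+-assoc e (e ℚ.+ e) e))
                                                    (trans (cong (ℚ._+ e) (sym (ℚP.+-assoc e e e)))
                                                      (ℚP.+-assoc (e ℚ.+ e) e e)) ⟩
        (e ℚ.+ e) ℚ.+ (e ℚ.+ e)                 ∎

      swap : ∀ p q {e} → dist p q ℚ.≤ e → dist q p ℚ.≤ e
      swap p q {e} = subst (ℚ._≤ e) (∣-∣-swap p q)

      late : ∀ a b c → a ℕ.≤ a ℕ.⊔ (b ℕ.⊔ c) × b ℕ.≤ a ℕ.⊔ (b ℕ.⊔ c) × c ℕ.≤ a ℕ.⊔ (b ℕ.⊔ c)
      late a b c = ℕP.m≤m⊔n a _ , ℕP.≤-trans (ℕP.m≤m⊔n b c) (ℕP.m≤n⊔m a _)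
                 , ℕP.≤-trans (ℕP.m≤n⊔m b c) (ℕP.m≤n⊔m a _)

      near : ∀ ε → 0ℚ ℚ.< ε → let q = ε ℚ.* ½ ℚ.* ½ in
        ∃ λ N → ∀ m n → N ℕ.≤ m → N ℕ.≤ n →
          (1/suc m ℚ.≤ q) × Eventually λ k → dist (seq (f m) k) (seq (f n) k) ℚ.≤ q ℚ.+ q
      near ε hε with fc (ε ℚ.* ½ ℚ.* ½) (quarter hε) | 1/suc-small (ε ℚ.* ½ ℚ.* ½) (quarter hε)
      ... | M , h | N , s = M ℕ.⊔ N , λ m n hm hn →
        s m (ℕP.≤-trans (ℕP.m≤n⊔m M N) hm) ,
        h m n (ℕP.≤-trans (ℕP.m≤m⊔n M N) hm) (ℕP.≤-trans (ℕP.m≤m⊔n M N) hn) (ε ℚ.* ½ ℚ.* ½) (quarter hε)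

      diagonal-cauchy : IsCauchy diagonal
      diagonal-cauchy ε hε with near ε hε
      ... | N , h = N , λ m n hm hn →
        let sm , K , close = h m n hm hn
            sn , _ = h n m hn hm
            Mm = proj₁ (modulus m) ; Mn = proj₁ (modulus n)
            k = K ℕ.⊔ (Mm ℕ.⊔ Mn)
            kK , km , kn = late K Mm Mn
        in subst (dist (diagonal m) (diagonal n) ℚ.≤_) (quarters ε)
          (path (diagonal m) (seq (f m) k) (seq (f n) k) (diagonal n) (diagonal n)
            (ℚP.≤-trans (proj₂ (modulus m) Mm k ℕP.≤-refl km) sm)
            (close k kK)
            (ℚP.≤-trans (proj₂ (modulus n) k Mn kn ℕP.≤-refl) sn) refl)

  lim : ℝ
  lim = real diagonal diagonal-cauchy

  abstract
    lim-converges : f ⟶ lim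
    lim-converges ε hε with near ε hε
    ... | N , h = N , λ n hn η hη →
      let M , settled = cauchy (f n) (ε ℚ.* ½ ℚ.* ½) (quarter hε)
      in M ℕ.⊔ N , λ i hi →
        let iM = ℕP.≤-trans (ℕP.m≤m⊔n M N) hi
            iN = ℕP.≤-trans (ℕP.m≤n⊔m M N) hi
            si , K , close = h i n iN hn
            Mi = proj₁ (modulus i)
            k = K ℕ.⊔ (Mi ℕ.⊔ M)
            kK , ki , kM = late K Mi M
        in ℚP.≤-trans (subst (dist (seq (f n) i) (diagonal i) ℚ.≤_) (quarters ε)
          (path (seq (f n) i) (seq (f n) k) (seq (f i) k) (diagonal i) (diagonal i)
            (settled i k iM kM)
            (swap (seq (f i) k) (seq (f n) k) (close k kK))
            (ℚP.≤-trans (proj₂ (modulus i) k Mi ki ℕP.≤-refl) si) refl))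
          (≤+nonNeg (ℚP.<⇒≤ hη))

open Completeness using (lim; lim-converges) public

module RatioTest (f : ℕ → ℝ) (h : ℚ) (0<h : 0ℚ ℚ.< h) (K I : ℕ)
  (ratio : ∀ k i → K ℕ.≤ k → I ℕ.≤ i →
    ℚ.∣ seq (f (suc k)) i ∣ ℚ.≤ (1ℚ ℚ.- h) ℚ.* ℚ.∣ seq (f k) i ∣) where

  open Sequences
  open import Data.Rational.Solver using (module +-*-Solver)
  open +-*-Solver using (solve; _:=_; _:+_; _:*_; _:-_; :-_; con)
  open ℚP.≤-Reasoning

  private
    s u : ℕ → ℕ → ℚ
    s n i = seq (Σ≤ n f) i
    u n i = ℚ.∣ seq (f n) i ∣

    abstract
      0≤h : 0ℚ ℚ.≤ h
      0≤h = ℚP.<⇒≤ 0<h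

      telescope : ∀ m i l → K ℕ.≤ m → I ℕ.≤ i →
        h ℚ.* ℚ.∣ s (l ℕ.+ m) i ℚ.- s m i ∣ ℚ.+ u (suc (l ℕ.+ m)) i ℚ.≤ u (suc m) i
      telescope m i zero hm hi = ℚP.≤-reflexive (begin-equality
        h ℚ.* ℚ.∣ s m i ℚ.- s m i ∣ ℚ.+ u (suc m) i
          ≡⟨ cong (λ t → h ℚ.* ℚ.∣ t ∣ ℚ.+ u (suc m) i) (ℚP.+-inverseʳ (s m i)) ⟩
        h ℚ.* 0ℚ ℚ.+ u (suc m) i   ≡⟨ cong (ℚ._+ u (suc m) i) (ℚP.*-zeroʳ h) ⟩
        0ℚ ℚ.+ u (suc m) i         ≡⟨ ℚP.+-identityˡ (u (suc m) i) ⟩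
        u (suc m) i                ∎)
      telescope m i (suc l) hm hi = begin
        h ℚ.* ℚ.∣ (p ℚ.+ q) ℚ.- r ∣ ℚ.+ u (suc (suc (l ℕ.+ m))) i
          ≤⟨ ℚP.+-mono-≤ (*-monoˡ h 0≤h (ℚP.≤-trans
               (ℚP.≤-reflexive (cong ℚ.∣_∣ (solve 3 (λ p q r → (p :+ q) :- r := (p :- r) :+ q) refl p q r)))
               (ℚP.∣p+q∣≤∣p∣+∣q∣ (p ℚ.- r) q)))
             (ratio (suc (l ℕ.+ m)) i (ℕP.≤-trans hm (ℕP.≤-trans (ℕP.m≤n+m m l) (ℕP.n≤1+n _))) hi) ⟩
        h ℚ.* (d ℚ.+ v) ℚ.+ (1ℚ ℚ.- h) ℚ.* v
          ≡⟨ solve 3 (λ h d v → h :* (d :+ v) :+ (con 1ℚ :- h) :* v := h :* d :+ v) refl h d v ⟩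
        h ℚ.* d ℚ.+ v
          ≤⟨ telescope m i l hm hi ⟩
        u (suc m) i ∎
        where
        p q r d v : ℚ
        p = s (l ℕ.+ m) i
        q = seq (f (suc (l ℕ.+ m))) i
        r = s m i
        d = ℚ.∣ p ℚ.- r ∣
        v = ℚ.∣ q ∣

      decay-step : ∀ c v w → 0ℚ ℚ.≤ c → 0ℚ ℚ.≤ v → w ℚ.≤ (1ℚ ℚ.- h) ℚ.* v →
        w ℚ.* (1ℚ ℚ.+ (1ℚ ℚ.+ c) ℚ.* h) ℚ.≤ v ℚ.* (1ℚ ℚ.+ c ℚ.* h)
      decay-step c v w 0≤c 0≤v hw = ℚP.≤-trans
        (*-monoʳ (1ℚ ℚ.+ (1ℚ ℚ.+ c) ℚ.* h)
          (ℚP.≤-trans (ℚP.<⇒≤ 0<1) (≤+nonNeg (*-nonNeg 0≤1+c 0≤h))) hw)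
        (≤-from-diff (subst (0ℚ ℚ.≤_)
          (solve 3 (λ c h v → v :* ((con 1ℚ :+ c) :* (h :* h)) :=
             v :* (con 1ℚ :+ c :* h) :- (con 1ℚ :- h) :* v :* (con 1ℚ :+ (con 1ℚ :+ c) :* h)) refl c h v)
          (*-nonNeg 0≤v (*-nonNeg 0≤1+c (*-nonNeg 0≤h 0≤h)))))
        where
        0≤1+c : 0ℚ ℚ.≤ 1ℚ ℚ.+ c
        0≤1+c = ℚP.≤-trans (ℚP.<⇒≤ 0<1) (≤+nonNeg 0≤c)

      decay : ∀ i j → I ℕ.≤ i → u (j ℕ.+ K) i ℚ.* (1ℚ ℚ.+ (ℤ.+ j ℚ./ 1) ℚ.* h) ℚ.≤ u K i
      decay i zero    hi = ℚP.≤-reflexive (begin-equality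
        u K i ℚ.* (1ℚ ℚ.+ 0ℚ ℚ.* h) ≡⟨ cong (λ t → u K i ℚ.* (1ℚ ℚ.+ t)) (ℚP.*-zeroˡ h) ⟩
        u K i ℚ.* (1ℚ ℚ.+ 0ℚ)       ≡⟨ cong (u K i ℚ.*_) (ℚP.+-identityʳ 1ℚ) ⟩
        u K i ℚ.* 1ℚ                ≡⟨ ℚP.*-identityʳ (u K i) ⟩
        u K i                       ∎)
      decay i (suc j) hi = ℚP.≤-trans
        (subst (λ t → u (suc (j ℕ.+ K)) i ℚ.* (1ℚ ℚ.+ t ℚ.* h) ℚ.≤ u (j ℕ.+ K) i ℚ.* (1ℚ ℚ.+ (ℤ.+ j ℚ./ 1) ℚ.* h))
          (sym (fromℕ-suc j))
          (decay-step (ℤ.+ j ℚ./ 1) (u (j ℕ.+ K) i) (u (suc (j ℕ.+ K)) i) (fromℕ-mono {0} {j} ℕ.z≤n)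
            (ℚP.0≤∣p∣ (seq (f (j ℕ.+ K)) i)) (ratio (j ℕ.+ K) i (ℕP.m≤n+m K j) hi)))
        (decay i j hi)

      decay-bound : ∀ x y c e → 0ℚ ℚ.≤ e → 0ℚ ℚ.< 1ℚ ℚ.+ c →
        x ℚ.* (1ℚ ℚ.+ c) ℚ.≤ y → y ℚ.≤ c ℚ.* e → x ℚ.≤ e
      decay-bound x y c e 0≤e pos h₁ h₂ = *-cancel (1ℚ ℚ.+ c) pos (begin
        (1ℚ ℚ.+ c) ℚ.* x ≡⟨ ℚP.*-comm (1ℚ ℚ.+ c) x ⟩
        x ℚ.* (1ℚ ℚ.+ c) ≤⟨ ℚP.≤-trans h₁ h₂ ⟩
        c ℚ.* e          ≤⟨ *-monoʳ {c} {1ℚ ℚ.+ c} e 0≤e (nonNeg+≤ (ℚP.<⇒≤ 0<1)) ⟩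
        (1ℚ ℚ.+ c) ℚ.* e ∎)

      small : ∀ e → 0ℚ ℚ.< e → ∃ λ N → K ℕ.≤ N × (∀ k i → N ℕ.≤ k → I ℕ.≤ i → u k i ℚ.≤ e)
      small e 0<e = proj₁ arch ℕ.+ K , ℕP.m≤n+m K (proj₁ arch) , bound
        where
        B : ∃ λ B → 0ℚ ℚ.< B × (∀ i → u K i ℚ.≤ B)
        B = bounded {seq (f K)} (cauchy (f K))
        arch : ∃ λ j → proj₁ B ℚ.≤ (ℤ.+ j ℚ./ 1) ℚ.* (h ℚ.* e)
        arch = archimedean (proj₁ B) (*-pos 0<h 0<e)
        bound : ∀ k i → proj₁ arch ℕ.+ K ℕ.≤ k → I ℕ.≤ i → u k i ℚ.≤ e
        bound k i hk hi = subst (λ t → u t i ℚ.≤ e) (ℕP.m∸n+n≡m (ℕP.≤-trans (ℕP.m≤n+m K (proj₁ arch)) hk))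
          (decay-bound (u (j ℕ.+ K) i) (u K i) ((ℤ.+ j ℚ./ 1) ℚ.* h) e (ℚP.<⇒≤ 0<e)
            (ℚP.<-≤-trans 0<1 (≤+nonNeg (*-nonNeg (fromℕ-mono {0} {j} ℕ.z≤n) 0≤h)))
            (decay i j hi)
            (ℚP.≤-trans (proj₂ (proj₂ B) i) (ℚP.≤-trans (proj₂ arch)
              (ℚP.≤-trans (*-monoʳ {ℤ.+ proj₁ arch ℚ./ 1} {ℤ.+ j ℚ./ 1} (h ℚ.* e) (*-nonNeg 0≤h (ℚP.<⇒≤ 0<e)) (fromℕ-mono {proj₁ arch} {j} le))
                (ℚP.≤-reflexive (sym (ℚP.*-assoc (ℤ.+ j ℚ./ 1) h e)))))))
          where
          j : ℕ
          j = k ℕ.∸ K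
          le : proj₁ arch ℕ.≤ j
          le = subst (ℕ._≤ j) (ℕP.m+n∸n≡m (proj₁ arch) K) (ℕP.∸-monoˡ-≤ K hk)

      close : ∀ e m n i → 0ℚ ℚ.< e → K ℕ.≤ m → I ℕ.≤ i → m ℕ.≤ n →
              u (suc m) i ℚ.≤ h ℚ.* e → ℚ.∣ s n i ℚ.- s m i ∣ ℚ.≤ e
      close e m n i 0<e hm hi m≤n bound = *-cancel h 0<h (begin
        h ℚ.* ℚ.∣ s n i ℚ.- s m i ∣
          ≡⟨ cong (λ t → h ℚ.* ℚ.∣ s t i ℚ.- s m i ∣) (sym (ℕP.m∸n+n≡m m≤n)) ⟩
        h ℚ.* ℚ.∣ s (n ℕ.∸ m ℕ.+ m) i ℚ.- s m i ∣
          ≤⟨ ≤+nonNeg (ℚP.0≤∣p∣ (seq (f (suc (n ℕ.∸ m ℕ.+ m))) i)) ⟩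
        h ℚ.* ℚ.∣ s (n ℕ.∸ m ℕ.+ m) i ℚ.- s m i ∣ ℚ.+ u (suc (n ℕ.∸ m ℕ.+ m)) i
          ≤⟨ telescope m i (n ℕ.∸ m) hm hi ⟩
        u (suc m) i
          ≤⟨ bound ⟩
        h ℚ.* e ∎)

  abstract
    series-cauchy : IsCauchyℝ (λ n → Σ≤ n f)
    series-cauchy ε hε = N , λ m n hm hn η hη → I , λ i hi →
      ℚP.≤-trans (dist-bound m n i hm hn hi) (≤+nonNeg (ℚP.<⇒≤ hη))
      where
      tail : ∃ λ N → K ℕ.≤ N × (∀ k i → N ℕ.≤ k → I ℕ.≤ i → u k i ℚ.≤ h ℚ.* ε)
      tail = small (h ℚ.* ε) (*-pos 0<h hε)
      N : ℕ
      N = proj₁ tail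
      late : ∀ {m} → N ℕ.≤ m → K ℕ.≤ m
      late = ℕP.≤-trans (proj₁ (proj₂ tail))
      dist-bound : ∀ m n i → N ℕ.≤ m → N ℕ.≤ n → I ℕ.≤ i → ℚ.∣ s m i ℚ.- s n i ∣ ℚ.≤ ε
      dist-bound m n i hm hn hi = [
          (λ m≤n → subst (ℚ._≤ ε) (∣-∣-swap (s n i) (s m i)) (close ε m n i hε (late hm) hi m≤n
            (proj₂ (proj₂ tail) (suc m) i (ℕP.≤-trans hm (ℕP.n≤1+n m)) hi))) ,
          (λ n≤m → close ε n m i hε (late hn) hi n≤m
            (proj₂ (proj₂ tail) (suc n) i (ℕP.≤-trans hn (ℕP.n≤1+n n)) hi)) ]′ (ℕP.≤-total m n)

1/_! : ℕ → ℚ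
1/ k ! = (ℤ.+ 1 ℚ./ (k !)) {{k ℕP.!≢0}}

S : ℕ → ℝ → ℝ
S d x = Σ≤ d λ k → x ^ k * fromℚ (1/ k !)

module _ where

  open Sequences
  open import Data.Rational.Solver using (module +-*-Solver)
  open +-*-Solver using (solve; _:=_; _:+_; _:*_; _:-_; :-_; con)
  open ℚP.≤-Reasoning

  abstract
    /-pos : ∀ a n .{{_ : ℕ.NonZero a}} .{{_ : ℕ.NonZero n}} → 0ℚ ℚ.< ℤ.+ a ℚ./ n
    /-pos a n = ℚP.positive⁻¹ (ℤ.+ a ℚ./ n) {{ℚP.normalize-pos a n}}

    1/!-pos : ∀ k → 0ℚ ℚ.< 1/ k !
    1/!-pos k = /-pos 1 (k !) {{_}} {{k ℕP.!≢0}}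

    1/!-suc : ∀ k → 1/ k ! ≡ (1/ suc k !) ℚ.* (ℤ.+ suc k ℚ./ 1)
    1/!-suc k = unique (1/ k !) (1/ suc k !) (ℤ.+ suc k ℚ./ 1) (ℤ.+ (k !) ℚ./ 1) (ℤ.+ (suc k !) ℚ./ 1)
      (/-pos (k !) 1 {{k ℕP.!≢0}})
      (fromℕ-* (suc k) (k !)) (/-fromℕ 1 (k !) {{k ℕP.!≢0}}) (/-fromℕ 1 (suc k !) {{suc k ℕP.!≢0}})
      where
      unique : ∀ c c′ n f f′ → 0ℚ ℚ.< f → f′ ≡ n ℚ.* f → c ℚ.* f ≡ 1ℚ → c′ ℚ.* f′ ≡ 1ℚ → c ≡ c′ ℚ.* n
      unique c c′ n f f′ hf eq cf cf′ = ℚP.≤-antisym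
        (*-cancel f hf (ℚP.≤-reflexive same)) (*-cancel f hf (ℚP.≤-reflexive (sym same)))
        where
        same : f ℚ.* c ≡ f ℚ.* (c′ ℚ.* n)
        same = begin-equality
          f ℚ.* c          ≡⟨ ℚP.*-comm f c ⟩
          c ℚ.* f          ≡⟨ trans cf (sym cf′) ⟩
          c′ ℚ.* f′        ≡⟨ cong (c′ ℚ.*_) eq ⟩
          c′ ℚ.* (n ℚ.* f) ≡⟨ solve 3 (λ c n f → c :* (n :* f) := f :* (c :* n)) refl c′ n f ⟩
          f ℚ.* (c′ ℚ.* n) ∎

    ratio-bound : ∀ y p c n → ℚ.∣ y ∣ ℚ.≤ n ℚ.* ½ → 0ℚ ℚ.≤ c →
      ℚ.∣ (y ℚ.* p) ℚ.* c ∣ ℚ.≤ (1ℚ ℚ.- ½) ℚ.* ℚ.∣ p ℚ.* (c ℚ.* n) ∣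
    ratio-bound y p c n hy hc = begin
      ℚ.∣ (y ℚ.* p) ℚ.* c ∣
        ≡⟨ cong ℚ.∣_∣ (ℚP.*-assoc y p c) ⟩
      ℚ.∣ y ℚ.* (p ℚ.* c) ∣
        ≡⟨ ℚP.∣p*q∣≡∣p∣*∣q∣ y (p ℚ.* c) ⟩
      ℚ.∣ y ∣ ℚ.* ℚ.∣ p ℚ.* c ∣
        ≤⟨ *-monoʳ ℚ.∣ p ℚ.* c ∣ (ℚP.0≤∣p∣ (p ℚ.* c)) hy ⟩
      n ℚ.* ½ ℚ.* ℚ.∣ p ℚ.* c ∣
        ≡⟨ solve 3 (λ n h a → n :* h :* a := h :* (a :* n)) refl n ½ ℚ.∣ p ℚ.* c ∣ ⟩
      ½ ℚ.* (ℚ.∣ p ℚ.* c ∣ ℚ.* n)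
        ≡⟨ cong (λ t → ½ ℚ.* (ℚ.∣ p ℚ.* c ∣ ℚ.* t)) (sym (ℚP.0≤p⇒∣p∣≡p 0≤n)) ⟩
      ½ ℚ.* (ℚ.∣ p ℚ.* c ∣ ℚ.* ℚ.∣ n ∣)
        ≡⟨ cong (½ ℚ.*_) (sym (ℚP.∣p*q∣≡∣p∣*∣q∣ (p ℚ.* c) n)) ⟩
      ½ ℚ.* ℚ.∣ p ℚ.* c ℚ.* n ∣
        ≡⟨ cong (λ t → ½ ℚ.* ℚ.∣ t ∣) (ℚP.*-assoc p c n) ⟩
      ½ ℚ.* ℚ.∣ p ℚ.* (c ℚ.* n) ∣ ∎
      where
      0≤n : 0ℚ ℚ.≤ n
      0≤n = *-cancel ½ 0<½ (subst₂ ℚ._≤_ (sym (ℚP.*-zeroʳ ½)) (ℚP.*-comm n ½)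
        (ℚP.≤-trans (ℚP.0≤∣p∣ y) hy))

    exp-ratio : ∀ x → ∃ λ K → ∀ k i → K ℕ.≤ k → 0 ℕ.≤ i →
      ℚ.∣ seq (x ^ suc k * fromℚ (1/ suc k !)) i ∣ ℚ.≤ (1ℚ ℚ.- ½) ℚ.* ℚ.∣ seq (x ^ k * fromℚ (1/ k !)) i ∣
    exp-ratio x = K , λ k i hk _ →
      subst (λ t → ℚ.∣ (seq x i ℚ.* seq (x ^ k) i) ℚ.* (1/ suc k !) ∣ ℚ.≤ (1ℚ ℚ.- ½) ℚ.* ℚ.∣ seq (x ^ k) i ℚ.* t ∣)
        (sym (1/!-suc k))
        (ratio-bound (seq x i) (seq (x ^ k) i) (1/ suc k !) (ℤ.+ suc k ℚ./ 1)
          (ℚP.≤-trans (proj₂ (proj₂ B) i) (ℚP.≤-trans (proj₂ arch)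
            (*-monoʳ {ℤ.+ K ℚ./ 1} {ℤ.+ suc k ℚ./ 1} ½ (ℚP.<⇒≤ 0<½)
              (fromℕ-mono {K} {suc k} (ℕP.≤-trans hk (ℕP.n≤1+n k))))))
          (ℚP.<⇒≤ (1/!-pos (suc k))))
      where
      B : ∃ λ B → 0ℚ ℚ.< B × (∀ i → ℚ.∣ seq x i ∣ ℚ.≤ B)
      B = bounded {seq x} (cauchy x)
      arch : ∃ λ K → proj₁ B ℚ.≤ (ℤ.+ K ℚ./ 1) ℚ.* ½
      arch = archimedean (proj₁ B) 0<½
      K : ℕ
      K = proj₁ arch

    S-cauchy : ∀ x → IsCauchyℝ (λ n → S n x)
    S-cauchy x = RatioTest.series-cauchy (λ k → x ^ k * fromℚ (1/ k !)) ½ 0<½ (proj₁ (exp-ratio x)) 0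
      (proj₂ (exp-ratio x))

    ^-nonNeg : ∀ x k → fromℕ 0 ≤ x → fromℕ 0 ≤ x ^ k
    ^-nonNeg x zero    h ε hε = 0 , λ _ _ → ℚP.≤-trans (ℚP.<⇒≤ 0<1) (≤+nonNeg (ℚP.<⇒≤ hε))
    ^-nonNeg x (suc k) h = 0≼* {seq x} {seq (x ^ k)} (cauchy x) (cauchy (x ^ k)) h (^-nonNeg x k h)

    term-nonNeg : ∀ x k → fromℕ 0 ≤ x → fromℕ 0 ≤ x ^ k * fromℚ (1/ k !)
    term-nonNeg x k h = 0≼* {seq (x ^ k)} {λ _ → 1/ k !} (cauchy (x ^ k)) (const-cauchy (1/ k !)) (^-nonNeg x k h)
      λ ε hε → 0 , λ _ _ → ℚP.≤-trans (ℚP.<⇒≤ (1/!-pos k)) (≤+nonNeg (ℚP.<⇒≤ hε))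

    1≤S : ∀ d x → fromℕ 0 ≤ x → fromℕ 1 ≤ S d x
    1≤S zero    x h ε hε = 0 , λ _ _ → ≤+nonNeg {1ℚ} (ℚP.<⇒≤ hε)
    1≤S (suc d) x h ε hε =
      let N , p = both {λ n → 1ℚ ℚ.≤ seq (S d x) n ℚ.+ ε ℚ.* ½}
                       {λ n → 0ℚ ℚ.≤ seq (x ^ suc d * fromℚ (1/ suc d !)) n ℚ.+ ε ℚ.* ½}
                       (1≤S d x h (ε ℚ.* ½) (half hε)) (term-nonNeg x (suc d) h (ε ℚ.* ½) (half hε))
      in N , λ n hn → add (seq (S d x) n) (seq (x ^ suc d * fromℚ (1/ suc d !)) n) (proj₁ (p n hn)) (proj₂ (p n hn))
      where
      add : ∀ p q → 1ℚ ℚ.≤ p ℚ.+ ε ℚ.* ½ → 0ℚ ℚ.≤ q ℚ.+ ε ℚ.* ½ → 1ℚ ℚ.≤ (p ℚ.+ q) ℚ.+ ε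
      add p q h₁ h₂ = begin
        1ℚ                                    ≡⟨ sym (ℚP.+-identityʳ 1ℚ) ⟩
        1ℚ ℚ.+ 0ℚ                             ≤⟨ ℚP.+-mono-≤ h₁ h₂ ⟩
        (p ℚ.+ ε ℚ.* ½) ℚ.+ (q ℚ.+ ε ℚ.* ½)   ≡⟨ solve 3 (λ p q e → (p :+ e) :+ (q :+ e) := (p :+ q) :+ (e :+ e))
                                                   refl p q (ε ℚ.* ½) ⟩
        (p ℚ.+ q) ℚ.+ (ε ℚ.* ½ ℚ.+ ε ℚ.* ½)   ≡⟨ cong (p ℚ.+ q ℚ.+_) (half+half ε) ⟩
        (p ℚ.+ q) ℚ.+ ε                       ∎

    0<S : ∀ d x → fromℕ 0 ≤ x → fromℕ 0 < S d x
    0<S d x h =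
      let N , p = 1≤S d x h ½ 0<½
      in ½ , 0<½ , N , λ n hn → shift (seq (S d x) n) (p n hn)
      where
      shift : ∀ p → 1ℚ ℚ.≤ p ℚ.+ ½ → 0ℚ ℚ.+ ½ ℚ.≤ p
      shift p h = subst (0ℚ ℚ.+ ½ ℚ.≤_) (trans (ℚP.+-assoc p ½ (ℚ.- ½))
        (trans (cong (p ℚ.+_) (ℚP.+-inverseʳ ½)) (ℚP.+-identityʳ p))) (ℚP.+-monoˡ-≤ (ℚ.- ½) h)

exp : ℝ → ℝ
exp x = lim (λ n → S n x) (S-cauchy x)

1+pos#0 : ∀ y → fromℕ 0 < y → y + fromℕ 1 # fromℕ 0
1+pos#0 y (ε , hε , N , h) = inj₂ (ε , hε , N , λ n hn →
  ℚP.≤-trans (h n hn) (Sequences.≤+nonNeg (ℚP.<⇒≤ Sequences.0<1)))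

logArg : (y : ℝ) → fromℕ 0 < y → ℝ
logArg y y>0 = (y - fromℕ 1) * inv (y + fromℕ 1) (1+pos#0 y y>0)

logTerm : ℝ → ℕ → ℝ
logTerm z k = z ^ suc (2 ℕ.* k) * fromℚ (ℤ.+ 2 ℚ./ suc (2 ℕ.* k))

module _ where

  open Sequences
  open import Data.Rational.Solver using (module +-*-Solver)
  open +-*-Solver using (solve; _:=_; _:+_; _:*_; _:-_; :-_; con)
  open ℚP.≤-Reasoning

  abstract
    logArg-square : ∀ y r e B b → 0ℚ ℚ.< e → e ℚ.≤ y → y ℚ.≤ B →
      (y ℚ.+ 1ℚ) ℚ.* r ≡ 1ℚ → (B ℚ.+ 1ℚ) ℚ.* b ≡ 1ℚ →
      let z = (y ℚ.- 1ℚ) ℚ.* r in z ℚ.* z ℚ.≤ 1ℚ ℚ.- e ℚ.* (b ℚ.* b)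
    logArg-square y r e B b 0<e e≤y y≤B yr Bb = ≤-from-diff (subst (0ℚ ℚ.≤_) identity
      (*-nonNeg (square-nonNeg r) (diff-nonNeg bound)))
      where
      w h 3y : ℚ
      w = y ℚ.+ 1ℚ
      h = e ℚ.* (b ℚ.* b)
      3y = y ℚ.+ y ℚ.+ y
      square-nonNeg : ∀ p → 0ℚ ℚ.≤ p ℚ.* p
      square-nonNeg p = subst (0ℚ ℚ.≤_)
        ([ (λ eq → cong₂ ℚ._*_ eq eq)
         , (λ eq → trans (cong₂ ℚ._*_ eq eq) (solve 1 (λ p → :- p :* :- p := p :* p) refl p)) ]′
         (ℚP.∣p∣≡p∨∣p∣≡-p p)) (*-nonNeg (ℚP.0≤∣p∣ p) (ℚP.0≤∣p∣ p))
      0≤y : 0ℚ ℚ.≤ y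
      0≤y = ℚP.≤-trans (ℚP.<⇒≤ 0<e) e≤y
      0≤w : 0ℚ ℚ.≤ w
      0≤w = ℚP.≤-trans 0≤y (≤+nonNeg (ℚP.<⇒≤ 0<1))
      w≤ : w ℚ.≤ B ℚ.+ 1ℚ
      w≤ = ℚP.+-monoˡ-≤ 1ℚ y≤B
      bound : h ℚ.* (w ℚ.* w) ℚ.≤ y ℚ.+ 3y
      bound = begin
        e ℚ.* (b ℚ.* b) ℚ.* (w ℚ.* w)
          ≤⟨ *-monoˡ (e ℚ.* (b ℚ.* b)) (*-nonNeg (ℚP.<⇒≤ 0<e) (square-nonNeg b))
               (*-mono 0≤w (ℚP.≤-trans 0≤w w≤) w≤ w≤) ⟩
        e ℚ.* (b ℚ.* b) ℚ.* ((B ℚ.+ 1ℚ) ℚ.* (B ℚ.+ 1ℚ))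
          ≡⟨ solve 3 (λ e b c → e :* (b :* b) :* (c :* c) := e :* ((c :* b) :* (c :* b))) refl e b (B ℚ.+ 1ℚ) ⟩
        e ℚ.* (((B ℚ.+ 1ℚ) ℚ.* b) ℚ.* ((B ℚ.+ 1ℚ) ℚ.* b))
          ≡⟨ cong₂ (λ s t → e ℚ.* (s ℚ.* t)) Bb Bb ⟩
        e ℚ.* (1ℚ ℚ.* 1ℚ)
          ≡⟨ trans (cong (e ℚ.*_) (ℚP.*-identityʳ 1ℚ)) (ℚP.*-identityʳ e) ⟩
        e
          ≤⟨ ℚP.≤-trans e≤y (≤+nonNeg (ℚP.≤-trans 0≤y
               (ℚP.≤-trans (≤+nonNeg 0≤y) (≤+nonNeg 0≤y)))) ⟩
        y ℚ.+ 3y ∎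
      identity : r ℚ.* r ℚ.* (y ℚ.+ 3y ℚ.- h ℚ.* (w ℚ.* w)) ≡
                 1ℚ ℚ.- h ℚ.- (y ℚ.- 1ℚ) ℚ.* r ℚ.* ((y ℚ.- 1ℚ) ℚ.* r)
      identity = begin-equality
        r ℚ.* r ℚ.* (y ℚ.+ 3y ℚ.- h ℚ.* (w ℚ.* w))
          ≡⟨ solve 3 (λ y r h → r :* r :* (y :+ (y :+ y :+ y) :- h :* ((y :+ con 1ℚ) :* (y :+ con 1ℚ))) :=
               (con 1ℚ :- h) :* (((y :+ con 1ℚ) :* r) :* ((y :+ con 1ℚ) :* r))
                 :- (y :- con 1ℚ) :* r :* ((y :- con 1ℚ) :* r)) refl y r h ⟩
        (1ℚ ℚ.- h) ℚ.* ((w ℚ.* r) ℚ.* (w ℚ.* r)) ℚ.- (y ℚ.- 1ℚ) ℚ.* r ℚ.* ((y ℚ.- 1ℚ) ℚ.* r)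
          ≡⟨ cong₂ (λ s t → (1ℚ ℚ.- h) ℚ.* (s ℚ.* t) ℚ.- (y ℚ.- 1ℚ) ℚ.* r ℚ.* ((y ℚ.- 1ℚ) ℚ.* r)) yr yr ⟩
        (1ℚ ℚ.- h) ℚ.* (1ℚ ℚ.* 1ℚ) ℚ.- (y ℚ.- 1ℚ) ℚ.* r ℚ.* ((y ℚ.- 1ℚ) ℚ.* r)
          ≡⟨ cong (ℚ._- (y ℚ.- 1ℚ) ℚ.* r ℚ.* ((y ℚ.- 1ℚ) ℚ.* r))
               (trans (cong ((1ℚ ℚ.- h) ℚ.*_) (ℚP.*-identityʳ 1ℚ)) (ℚP.*-identityʳ (1ℚ ℚ.- h))) ⟩
        1ℚ ℚ.- h ℚ.- (y ℚ.- 1ℚ) ℚ.* r ℚ.* ((y ℚ.- 1ℚ) ℚ.* r) ∎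

    logArg-bound : ∀ y (y>0 : fromℕ 0 < y) → ∃ λ h → 0ℚ ℚ.< h ×
      Eventually λ n → seq (logArg y y>0) n ℚ.* seq (logArg y y>0) n ℚ.≤ 1ℚ ℚ.- h
    logArg-bound y (e , 0<e , N , y≥e) = e ℚ.* (b ℚ.* b) , *-pos 0<e (*-pos 0<b 0<b) , N , λ n hn →
      let e≤y = subst (ℚ._≤ seq y n) (ℚP.+-identityˡ e) (y≥e n hn) in
      logArg-square (seq y n) (recip (seq y n ℚ.+ 1ℚ)) e (proj₁ B) b 0<e e≤y
        (ℚP.≤-trans (p≤∣p∣ (seq y n)) (proj₂ (proj₂ B) n))
        (recip-inverse (seq y n ℚ.+ 1ℚ) (pos≢0 (1+pos (seq y n) (ℚP.<-≤-trans 0<e e≤y))))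
        (recip-inverse (proj₁ B ℚ.+ 1ℚ) (pos≢0 (1+pos (proj₁ B) (proj₁ (proj₂ B)))))
      where
      1+pos : ∀ p → 0ℚ ℚ.< p → 0ℚ ℚ.< p ℚ.+ 1ℚ
      1+pos p h = ℚP.<-≤-trans h (≤+nonNeg (ℚP.<⇒≤ 0<1))
      B : ∃ λ B → 0ℚ ℚ.< B × (∀ i → ℚ.∣ seq y i ∣ ℚ.≤ B)
      B = bounded {seq y} (cauchy y)
      b : ℚ
      b = recip (proj₁ B ℚ.+ 1ℚ)
      0<b : 0ℚ ℚ.< b
      0<b = recip-pos (1+pos (proj₁ B) (proj₁ (proj₂ B)))

    2/odd-decreasing : ∀ k → ℤ.+ 2 ℚ./ suc (2 ℕ.* suc k) ℚ.≤ ℤ.+ 2 ℚ./ suc (2 ℕ.* k)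
    2/odd-decreasing k = decreasing (ℤ.+ 2 ℚ./ suc (2 ℕ.* suc k)) (ℤ.+ 2 ℚ./ suc (2 ℕ.* k))
      (ℤ.+ suc (2 ℕ.* suc k) ℚ./ 1) (ℤ.+ suc (2 ℕ.* k) ℚ./ 1)
      (ℚP.<⇒≤ (/-pos 2 (suc (2 ℕ.* suc k)))) (/-pos (suc (2 ℕ.* k)) 1)
      (fromℕ-mono {suc (2 ℕ.* k)} {suc (2 ℕ.* suc k)} (ℕ.s≤s (ℕP.*-monoʳ-≤ 2 (ℕP.n≤1+n k))))
      (trans (/-fromℕ 2 (suc (2 ℕ.* suc k))) (sym (/-fromℕ 2 (suc (2 ℕ.* k)))))
      where
      decreasing : ∀ c d m n → 0ℚ ℚ.≤ c → 0ℚ ℚ.< n → n ℚ.≤ m → c ℚ.* m ≡ d ℚ.* n → c ℚ.≤ d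
      decreasing c d m n 0≤c 0<n n≤m eq = *-cancel n 0<n (begin
        n ℚ.* c ≡⟨ ℚP.*-comm n c ⟩
        c ℚ.* n ≤⟨ *-monoˡ c 0≤c n≤m ⟩
        c ℚ.* m ≡⟨ eq ⟩
        d ℚ.* n ≡⟨ ℚP.*-comm d n ⟩
        n ℚ.* d ∎)

    log-ratio : ∀ z h k i → seq z i ℚ.* seq z i ℚ.≤ 1ℚ ℚ.- h →
      ℚ.∣ seq (logTerm z (suc k)) i ∣ ℚ.≤ (1ℚ ℚ.- h) ℚ.* ℚ.∣ seq (logTerm z k) i ∣
    log-ratio z h k i bound = subst
      (λ t → ℚ.∣ t ℚ.* (ℤ.+ 2 ℚ./ suc (2 ℕ.* suc k)) ∣ ℚ.≤ (1ℚ ℚ.- h) ℚ.* ℚ.∣ seq (logTerm z k) i ∣)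
      (cong (λ t → seq (z ^ suc t) i) (sym (ℕP.*-suc 2 k)))
      (go (seq z i) (seq (z ^ suc (2 ℕ.* k)) i) (ℤ.+ 2 ℚ./ suc (2 ℕ.* suc k)) (ℤ.+ 2 ℚ./ suc (2 ℕ.* k))
        bound (ℚP.<⇒≤ (/-pos 2 (suc (2 ℕ.* suc k)))) (2/odd-decreasing k))
      where
      go : ∀ y p c d → y ℚ.* y ℚ.≤ 1ℚ ℚ.- h → 0ℚ ℚ.≤ c → c ℚ.≤ d →
        ℚ.∣ (y ℚ.* (y ℚ.* p)) ℚ.* c ∣ ℚ.≤ (1ℚ ℚ.- h) ℚ.* ℚ.∣ p ℚ.* d ∣
      go y p c d hy 0≤c c≤d = begin
        ℚ.∣ (y ℚ.* (y ℚ.* p)) ℚ.* c ∣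
          ≡⟨ cong ℚ.∣_∣ (solve 3 (λ y p c → (y :* (y :* p)) :* c := y :* (y :* (p :* c))) refl y p c) ⟩
        ℚ.∣ y ℚ.* (y ℚ.* (p ℚ.* c)) ∣
          ≡⟨ trans (ℚP.∣p*q∣≡∣p∣*∣q∣ y (y ℚ.* (p ℚ.* c)))
               (cong (ℚ.∣ y ∣ ℚ.*_) (ℚP.∣p*q∣≡∣p∣*∣q∣ y (p ℚ.* c))) ⟩
        ℚ.∣ y ∣ ℚ.* (ℚ.∣ y ∣ ℚ.* ℚ.∣ p ℚ.* c ∣)
          ≡⟨ sym (ℚP.*-assoc ℚ.∣ y ∣ ℚ.∣ y ∣ ℚ.∣ p ℚ.* c ∣) ⟩
        ℚ.∣ y ∣ ℚ.* ℚ.∣ y ∣ ℚ.* ℚ.∣ p ℚ.* c ∣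
          ≡⟨ cong (ℚ._* ℚ.∣ p ℚ.* c ∣) ∣y∣² ⟩
        y ℚ.* y ℚ.* ℚ.∣ p ℚ.* c ∣
          ≤⟨ *-mono 0≤y² (ℚP.0≤∣p∣ (p ℚ.* d)) hy factor ⟩
        (1ℚ ℚ.- h) ℚ.* ℚ.∣ p ℚ.* d ∣ ∎
        where
        ∣y∣² : ℚ.∣ y ∣ ℚ.* ℚ.∣ y ∣ ≡ y ℚ.* y
        ∣y∣² = [ (λ eq → cong₂ ℚ._*_ eq eq)
               , (λ eq → trans (cong₂ ℚ._*_ eq eq) (solve 1 (λ p → :- p :* :- p := p :* p) refl y)) ]′
               (ℚP.∣p∣≡p∨∣p∣≡-p y)
        0≤y² : 0ℚ ℚ.≤ y ℚ.* y
        0≤y² = subst (0ℚ ℚ.≤_) ∣y∣² (*-nonNeg (ℚP.0≤∣p∣ y) (ℚP.0≤∣p∣ y))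
        factor : ℚ.∣ p ℚ.* c ∣ ℚ.≤ ℚ.∣ p ℚ.* d ∣
        factor = subst₂ ℚ._≤_ (sym (ℚP.∣p*q∣≡∣p∣*∣q∣ p c)) (sym (ℚP.∣p*q∣≡∣p∣*∣q∣ p d))
          (*-monoˡ ℚ.∣ p ∣ (ℚP.0≤∣p∣ p) (subst₂ ℚ._≤_ (sym (ℚP.0≤p⇒∣p∣≡p 0≤c))
            (sym (ℚP.0≤p⇒∣p∣≡p (ℚP.≤-trans 0≤c c≤d))) c≤d))

    log-cauchy : ∀ y (y>0 : fromℕ 0 < y) → IsCauchyℝ (λ n → Σ≤ n (logTerm (logArg y y>0)))
    log-cauchy y y>0 =
      let h , 0<h , I , bound = logArg-bound y y>0
      in RatioTest.series-cauchy (logTerm (logArg y y>0)) h 0<h 0 I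
           (λ k i _ hi → log-ratio (logArg y y>0) h k i (bound i hi))

-- log y = 2 artanh z = 2 (z + z³/3 + z⁵/5 + …), where z = (y - 1) / (y + 1).
log : (y : ℝ) → fromℕ 0 < y → ℝ
log y y>0 = lim (λ n → Σ≤ n (logTerm (logArg y y>0))) (log-cauchy y y>0)

0<2 : fromℕ 0 < fromℕ 2
0<2 = 1ℚ , Sequences.0<1 , 0 , λ _ _ → ℚP.≤ᵇ⇒≤ _

2^_ : ℝ → ℝ
2^ t = exp (t * log (fromℕ 2) 0<2)

1/_[_] : (x : ℝ) → fromℕ 0 < x → ℝ
1/ x [ x>0 ] = inv x (inj₂ x>0)

1/-pos : ∀ x (x>0 : fromℕ 0 < x) → fromℕ 0 < 1/ x [ x>0 ]
1/-pos x x>0 = Sequences.0≺recip {seq x} (cauchy x) x>0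

Subset : Set₁
Subset = ℝ → Set

[0,∞[ : Subset
[0,∞[ x = fromℕ 0 ≤ x

-- The supremum of f over I, as an extended real, is at most b exactly when
-- b is an upper bound.
sup≤ : (I : Subset) → (∀ x → I x → ℝ) → ℝ → Set
sup≤ I f b = ∀ x (x∈I : I x) → f x x∈I ≤ b

-- g is a δ-approximation to f over I.
IsApproximation : ℝ → (I : Subset) → (f g : ∀ x → I x → ℝ) → Set
IsApproximation δ I f g = sup≤ I (λ x x∈I → ∣ f x x∈I - g x x∈I ∣) δ

-- Coefficients beyond the degree are ignored; the degree of 0 is 0.
record Polynomial : Set where
  field
    degree  : ℕ
    coeff   : ℕ → ℝ
    leading : degree ≡ 0 ⊎ coeff degree # fromℕ 0

  eval : ℝ → ℝ
  eval x = Σ≤ degree λ k → coeff k * x ^ k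

record RationalFunction (I : Subset) : Set where
  field
    num den : Polynomial
    den#0   : ∀ x → I x → Polynomial.eval den x # fromℕ 0

  degree : ℕ
  degree = Polynomial.degree num ℕ.⊔ Polynomial.degree den

  eval : ∀ x → I x → ℝ
  eval x x∈I = Polynomial.eval num x * inv (Polynomial.eval den x) (den#0 x x∈I)

-- For x ≥ 0 the m-th coefficient of S_d(x) e^x, as an exponential generating function, is ∑_{k ≤ d} C(m,k),
-- which is at least 2^d when m ≥ d. Hence 2^d (e^x - S_d(x)) ≤ S_d(x) e^x, and dividing by S_d(x) e^x gives
-- 0 ≤ 1/S_d(x) - e^{-x} ≤ 2^{-d} without any case distinction on x. On partial sums, e^x e^{-x} = 1 becomes
-- |S_n(x) S_n(-x) - 1| ≤ S_n(x)² - S_m(x)² for n = 2m, because the product agrees with 1 up to degree n.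
-- The constant c = ½ follows from log 2 ≤ 1 and e^{d/2} ≤ 2^d.
--
-- For the second part 1/S_d serves with 2^{-d} ≤ δ ≤ 8 · 2^{-d}, and the series 2 artanh z of log(1/δ), where
-- z = (1/δ - 1)/(1/δ + 1), is bounded below by (d - 6)/4: by Bernoulli's inequality the powers of z in its first
-- 2^{d-6} terms are at least ½, which leaves half of the partial sum of ∑ 2/(2k+1).

module Submission where

open import Data.Nat as ℕ using (ℕ; zero; suc; _!)
import Data.Nat.Properties as ℕP
open import Data.Integer as ℤ using (ℤ)
open import Data.Rational as ℚ using (ℚ; 0ℚ; 1ℚ; ½)
import Data.Rational.Properties as ℚP
open import Data.Product using (Σ; ∃; _×_; _,_; proj₁; proj₂)
open import Data.Sum using (_⊎_; inj₁; inj₂; [_,_]′)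
open import Function using (_∘_)
open import Relation.Binary.PropositionalEquality
import Defs
open Defs using (1/_!)

-- A real is a Cauchy sequence of rationals, so each inequality is proved for rationals and partial
-- sums and then read off at late indices. Three obstacles shape this. First, S_n(-x) only nearly
-- inverts S_n(x); the defect e of the product is carried along, and since inequalities are compared
-- after multiplication by S_n(x) ≥ 1, it is never magnified. Second, a real x in `[0,∞[` has
-- entries that are merely at least -ε eventually, whereas the coefficient estimates ask for x ≥ 0
-- exactly; they are applied to the positive part `x ⊔ 0`, which is the same real.

module RationalEstimates where

  open Defs.Sequences
  open import Data.Rational using (_+_; _*_; _-_; -_; ∣_∣; _≤_; _<_; _/_)
  open import Data.Rational.Solver using (module +-*-Solver)
  open +-*-Solver using (solve; _:=_; _:+_; _:*_; _:-_; :-_; con)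
  open ℚP.≤-Reasoning

  -- Powers and finite sums of rationals

  infixr 8 _^_

  _^_ : ℚ → ℕ → ℚ
  q ^ zero  = 1ℚ
  q ^ suc n = q * q ^ n

  sum : ℕ → (ℕ → ℚ) → ℚ
  sum zero    f = f zero
  sum (suc n) f = sum n f + f (suc n)

  2ℚ : ℚ
  2ℚ = 1ℚ + 1ℚ

  0≤1 : 0ℚ ≤ 1ℚ
  0≤1 = ℚP.<⇒≤ 0<1

  +-nonNeg : ∀ {p q} → 0ℚ ≤ p → 0ℚ ≤ q → 0ℚ ≤ p + q
  +-nonNeg hp hq = ℚP.≤-trans hp (≤+nonNeg hq)

  *-cancel-≡ : ∀ {r p q} → 0ℚ < r → r * p ≡ r * q → p ≡ q
  *-cancel-≡ {r} hr eq = ℚP.≤-antisym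
    (*-cancel r hr (ℚP.≤-reflexive eq)) (*-cancel r hr (ℚP.≤-reflexive (sym eq)))

  ≤-by : ∀ {p q e} → 0ℚ ≤ e → e ≡ q - p → p ≤ q
  ≤-by h eq = ≤-from-diff (subst (0ℚ ≤_) eq h)

  ^-nonNeg : ∀ {x} → 0ℚ ≤ x → ∀ k → 0ℚ ≤ x ^ k
  ^-nonNeg hx zero    = 0≤1
  ^-nonNeg hx (suc k) = *-nonNeg hx (^-nonNeg hx k)

  ^-mono : ∀ {x y} → 0ℚ ≤ x → x ≤ y → ∀ k → x ^ k ≤ y ^ k
  ^-mono hx h zero    = ℚP.≤-refl
  ^-mono {x} {y} hx h (suc k) =
    *-mono hx (^-nonNeg (ℚP.≤-trans hx h) k) h (^-mono hx h k)

  ½^*2^ : ∀ d → ½ ^ d * 2ℚ ^ d ≡ 1ℚ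
  ½^*2^ zero    = refl
  ½^*2^ (suc d) = begin-equality
    ½ * ½ ^ d * (2ℚ * 2ℚ ^ d)
      ≡⟨ solve 2 (λ a b → con ½ :* a :* ((con 1ℚ :+ con 1ℚ) :* b) := a :* b) refl (½ ^ d) (2ℚ ^ d) ⟩
    ½ ^ d * 2ℚ ^ d ≡⟨ ½^*2^ d ⟩
    1ℚ ∎

  sum-cong : ∀ n {f g} → (∀ k → k ℕ.≤ n → f k ≡ g k) → sum n f ≡ sum n g
  sum-cong zero    h = h 0 ℕ.z≤n
  sum-cong (suc n) h = cong₂ _+_ (sum-cong n (λ k k≤n → h k (ℕP.m≤n⇒m≤1+n k≤n))) (h (suc n) ℕP.≤-refl)

  sum-mono : ∀ n {f g} → (∀ k → k ℕ.≤ n → f k ≤ g k) → sum n f ≤ sum n g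
  sum-mono zero    h = h 0 ℕ.z≤n
  sum-mono (suc n) h =
    ℚP.+-mono-≤ (sum-mono n (λ k k≤n → h k (ℕP.m≤n⇒m≤1+n k≤n))) (h (suc n) ℕP.≤-refl)

  sum-nonNeg : ∀ n {f} → (∀ k → 0ℚ ≤ f k) → 0ℚ ≤ sum n f
  sum-nonNeg zero    h = h 0
  sum-nonNeg (suc n) h = +-nonNeg (sum-nonNeg n h) (h (suc n))

  sum-extend : ∀ e n {f} → (∀ k → 0ℚ ≤ f k) → sum n f ≤ sum (e ℕ.+ n) f
  sum-extend zero    n h = ℚP.≤-refl
  sum-extend (suc e) n h = ℚP.≤-trans (sum-extend e n h) (≤+nonNeg (h _))

  sum-head : ∀ n f → sum (suc n) f ≡ f 0 + sum n (f ∘ suc)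
  sum-head zero    f = refl
  sum-head (suc n) f = trans (cong (_+ f (suc (suc n))) (sum-head n f)) (ℚP.+-assoc (f 0) _ _)

  -- Cauchy products

  conv : (ℕ → ℚ) → (ℕ → ℚ) → ℕ → ℚ
  conv f g zero    = f 0 * g 0
  conv f g (suc m) = f 0 * g (suc m) + conv (f ∘ suc) g m

  conv-last : ∀ f g m → conv f g (suc m) ≡ conv f (g ∘ suc) m + f (suc m) * g 0
  conv-last f g zero    = refl
  conv-last f g (suc m) = trans (cong (f 0 * g (suc (suc m)) +_) (conv-last (f ∘ suc) g m))
    (sym (ℚP.+-assoc (f 0 * g (suc (suc m))) _ _))

  -- The sum of f i * g j over i + j ≤ n, arranged by rows so that it can be compared with a
  -- rectangle row by row; `tri-sum` rearranges it by antidiagonals.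
  tri : (ℕ → ℚ) → (ℕ → ℚ) → ℕ → ℚ
  tri f g zero    = f 0 * g 0
  tri f g (suc n) = f 0 * sum (suc n) g + tri (f ∘ suc) g n

  tri-suc : ∀ f g n → tri f g (suc n) ≡ tri f g n + conv f g (suc n)
  tri-suc f g zero = solve 4 (λ a b c d → a :* (b :+ c) :+ d :* b := a :* b :+ (a :* c :+ d :* b))
    refl (f 0) (g 0) (g 1) (f 1)
  tri-suc f g (suc n) = trans (cong (f 0 * sum (suc (suc n)) g +_) (tri-suc (f ∘ suc) g n))
    (solve 5 (λ a b c t v → a :* (b :+ c) :+ (t :+ v) := (a :* b :+ t) :+ (a :* c :+ v))
      refl (f 0) (sum (suc n) g) (g (suc (suc n))) (tri (f ∘ suc) g n) (conv (f ∘ suc) g (suc n)))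

  tri-sum : ∀ f g n → tri f g n ≡ sum n (conv f g)
  tri-sum f g zero    = refl
  tri-sum f g (suc n) = trans (tri-suc f g n) (cong (_+ conv f g (suc n)) (tri-sum f g n))

  tri-nonNeg : ∀ {f g} → (∀ k → 0ℚ ≤ f k) → (∀ k → 0ℚ ≤ g k) → ∀ n → 0ℚ ≤ tri f g n
  tri-nonNeg hf hg zero    = *-nonNeg (hf 0) (hg 0)
  tri-nonNeg hf hg (suc n) =
    +-nonNeg (*-nonNeg (hf 0) (sum-nonNeg (suc n) hg)) (tri-nonNeg (hf ∘ suc) hg n)

  -- The rectangle i ≤ a, j ≤ b lies inside the triangle i + j ≤ a + b, and all terms are
  -- nonnegative.
  rectangle≤tri : ∀ {f g} → (∀ k → 0ℚ ≤ f k) → (∀ k → 0ℚ ≤ g k) →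
    ∀ a b → sum a f * sum b g ≤ tri f g (a ℕ.+ b)
  rectangle≤tri hf hg zero    zero    = ℚP.≤-refl
  rectangle≤tri hf hg zero    (suc b) = ≤+nonNeg (tri-nonNeg (hf ∘ suc) hg b)
  rectangle≤tri {f} {g} hf hg (suc a) b = begin
    sum (suc a) f * sum b g
      ≡⟨ cong (_* sum b g) (sum-head a f) ⟩
    (f 0 + sum a (f ∘ suc)) * sum b g
      ≡⟨ ℚP.*-distribʳ-+ (sum b g) (f 0) (sum a (f ∘ suc)) ⟩
    f 0 * sum b g + sum a (f ∘ suc) * sum b g
      ≤⟨ ℚP.+-mono-≤ (*-monoˡ (f 0) (hf 0) (sum-extend (suc a) b hg)) (rectangle≤tri (hf ∘ suc) hg a b) ⟩
    f 0 * sum (suc a ℕ.+ b) g + tri (f ∘ suc) g (a ℕ.+ b) ∎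

  module _ {g G : ℕ → ℚ} (hg : ∀ k → ∣ g k ∣ ≤ G k) where

    sum-tail-dominated : ∀ e n → ∣ sum (e ℕ.+ n) g - sum n g ∣ ≤ sum (e ℕ.+ n) G - sum n G
    sum-tail-dominated zero n = ℚP.≤-reflexive (trans (cong ∣_∣ (ℚP.+-inverseʳ (sum n g)))
      (sym (ℚP.+-inverseʳ (sum n G))))
    sum-tail-dominated (suc e) n = begin
      ∣ sum (e ℕ.+ n) g + x - sum n g ∣
        ≡⟨ cong ∣_∣ (solve 3 (λ a b c → a :+ b :- c := (a :- c) :+ b) refl (sum (e ℕ.+ n) g) x (sum n g)) ⟩
      ∣ (sum (e ℕ.+ n) g - sum n g) + x ∣
        ≤⟨ ℚP.∣p+q∣≤∣p∣+∣q∣ (sum (e ℕ.+ n) g - sum n g) x ⟩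
      ∣ sum (e ℕ.+ n) g - sum n g ∣ + ∣ x ∣
        ≤⟨ ℚP.+-mono-≤ (sum-tail-dominated e n) (hg (suc (e ℕ.+ n))) ⟩
      (sum (e ℕ.+ n) G - sum n G) + X
        ≡⟨ solve 3 (λ a b c → (a :- c) :+ b := a :+ b :- c) refl (sum (e ℕ.+ n) G) X (sum n G) ⟩
      sum (e ℕ.+ n) G + X - sum n G ∎
      where
      x X : ℚ
      x = g (suc (e ℕ.+ n))
      X = G (suc (e ℕ.+ n))

    -- The terms of the rectangle [0,n] × [0,e+n] outside the triangle i + j ≤ n.
    overhang-dominated : ∀ {f F} → (∀ k → ∣ f k ∣ ≤ F k) → ∀ n e →
      ∣ sum n f * sum (e ℕ.+ n) g - tri f g n ∣ ≤ sum n F * sum (e ℕ.+ n) G - tri F G n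
    overhang-dominated {f} {F} hf zero e = begin
      ∣ f 0 * sum (e ℕ.+ 0) g - f 0 * g 0 ∣
        ≡⟨ cong ∣_∣ (solve 3 (λ a b c → a :* b :- a :* c := a :* (b :- c)) refl (f 0) (sum (e ℕ.+ 0) g) (g 0)) ⟩
      ∣ f 0 * (sum (e ℕ.+ 0) g - g 0) ∣
        ≡⟨ ℚP.∣p*q∣≡∣p∣*∣q∣ (f 0) (sum (e ℕ.+ 0) g - g 0) ⟩
      ∣ f 0 ∣ * ∣ sum (e ℕ.+ 0) g - g 0 ∣
        ≤⟨ *-mono (ℚP.0≤∣p∣ (f 0)) (ℚP.≤-trans (ℚP.0≤∣p∣ (sum (e ℕ.+ 0) g - g 0)) (sum-tail-dominated e 0))
             (hf 0) (sum-tail-dominated e 0) ⟩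
      F 0 * (sum (e ℕ.+ 0) G - G 0)
        ≡⟨ solve 3 (λ a b c → a :* (b :- c) := a :* b :- a :* c) refl (F 0) (sum (e ℕ.+ 0) G) (G 0) ⟩
      F 0 * sum (e ℕ.+ 0) G - F 0 * G 0 ∎
    overhang-dominated {f} {F} hf (suc n) e = begin
      ∣ sum (suc n) f * U - (f 0 * V + t) ∣
        ≡⟨ cong (λ s → ∣ s * U - (f 0 * V + t) ∣) (sum-head n f) ⟩
      ∣ (f 0 + sum n (f ∘ suc)) * U - (f 0 * V + t) ∣
        ≡⟨ cong ∣_∣ (solve 5 (λ a s u v t → (a :+ s) :* u :- (a :* v :+ t) := a :* (u :- v) :+ (s :* u :- t))
             refl (f 0) (sum n (f ∘ suc)) U V t) ⟩
      ∣ f 0 * (U - V) + (sum n (f ∘ suc) * U - t) ∣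
        ≤⟨ ℚP.∣p+q∣≤∣p∣+∣q∣ (f 0 * (U - V)) (sum n (f ∘ suc) * U - t) ⟩
      ∣ f 0 * (U - V) ∣ + ∣ sum n (f ∘ suc) * U - t ∣
        ≡⟨ cong (_+ ∣ sum n (f ∘ suc) * U - t ∣) (ℚP.∣p*q∣≡∣p∣*∣q∣ (f 0) (U - V)) ⟩
      ∣ f 0 ∣ * ∣ U - V ∣ + ∣ sum n (f ∘ suc) * U - t ∣
        ≤⟨ ℚP.+-mono-≤
             (*-mono (ℚP.0≤∣p∣ (f 0)) (ℚP.≤-trans (ℚP.0≤∣p∣ (U - V)) (sum-tail-dominated e (suc n)))
               (hf 0) (sum-tail-dominated e (suc n)))
             -- Removing row 0 lowers n but keeps the number of columns, so the excess width e grows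
             -- by one; this is why e is free.
             (subst (λ k → ∣ sum n (f ∘ suc) * sum k g - t ∣ ≤ sum n (F ∘ suc) * sum k G - T)
               (sym (ℕP.+-suc e n)) (overhang-dominated (hf ∘ suc) n (suc e))) ⟩
      F 0 * (U′ - V′) + (sum n (F ∘ suc) * U′ - T)
        ≡⟨ solve 5 (λ a s u v t → a :* (u :- v) :+ (s :* u :- t) := (a :+ s) :* u :- (a :* v :+ t))
             refl (F 0) (sum n (F ∘ suc)) U′ V′ T ⟩
      (F 0 + sum n (F ∘ suc)) * U′ - (F 0 * V′ + T)
        ≡⟨ cong (λ s → s * U′ - (F 0 * V′ + T)) (sym (sum-head n F)) ⟩
      sum (suc n) F * U′ - (F 0 * V′ + T) ∎
      where
      U V U′ V′ t T : ℚ
      U  = sum (e ℕ.+ suc n) g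
      V  = sum (suc n) g
      U′ = sum (e ℕ.+ suc n) G
      V′ = sum (suc n) G
      t  = tri (f ∘ suc) g n
      T  = tri (F ∘ suc) G n

  -- Exponential generating functions

  egf : (ℕ → ℚ) → ℕ → ℚ
  egf a k = a k * (1/ k !)

  -- The Leibniz rule: shifting the sequence differentiates its exponential generating function.
  bin : (ℕ → ℚ) → (ℕ → ℚ) → ℕ → ℚ
  bin a b zero    = a 0 * b 0
  bin a b (suc m) = bin (a ∘ suc) b m + bin a (b ∘ suc) m

  ι : ℕ → ℚ
  ι k = ℤ.+ k / 1

  ι-+ : ∀ m n → ι m + ι n ≡ ι (m ℕ.+ n)
  ι-+ zero    n = ℚP.+-identityˡ (ι n)
  ι-+ (suc m) n = begin-equality
    ι (suc m) + ι n   ≡⟨ cong (_+ ι n) (fromℕ-suc m) ⟩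
    1ℚ + ι m + ι n    ≡⟨ ℚP.+-assoc 1ℚ (ι m) (ι n) ⟩
    1ℚ + (ι m + ι n)  ≡⟨ cong (1ℚ +_) (ι-+ m n) ⟩
    1ℚ + ι (m ℕ.+ n)  ≡⟨ sym (fromℕ-suc (m ℕ.+ n)) ⟩
    ι (suc m ℕ.+ n)   ∎

  ι-nonNeg : ∀ n → 0ℚ ≤ ι n
  ι-nonNeg n = fromℕ-mono {0} {n} ℕ.z≤n

  ι-pos : ∀ n → 0ℚ < ι (suc n)
  ι-pos n = Defs./-pos (suc n) 1

  conv-cong : ∀ m {f f′ g g′} → (∀ k → f k ≡ f′ k) → (∀ k → g k ≡ g′ k) → conv f g m ≡ conv f′ g′ m
  conv-cong zero    hf hg = cong₂ _*_ (hf 0) (hg 0)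
  conv-cong (suc m) hf hg = cong₂ _+_ (cong₂ _*_ (hf 0) (hg (suc m))) (conv-cong m (hf ∘ suc) hg)

  -- The weight i + j is constant along the antidiagonal i + j = m. A general u replaces `ι` on the
  -- left because the induction shifts f, and with it the weight, to `u ∘ suc`.
  conv-weights : ∀ u → (∀ i j → u i + ι j ≡ u (i ℕ.+ j)) → ∀ f g m →
    conv (λ i → u i * f i) g m + conv f (λ j → ι j * g j) m ≡ u m * conv f g m
  conv-weights u hu f g zero =
    solve 3 (λ u a b → u :* a :* b :+ a :* (con 0ℚ :* b) := u :* (a :* b)) refl (u 0) (f 0) (g 0)
  conv-weights u hu f g (suc m) = begin-equality
    (u 0 * f 0 * y + c₁) + (f 0 * (ι (suc m) * y) + c₂)
      ≡⟨ solve 6 (λ u a y n c d → (u :* a :* y :+ c) :+ (a :* (n :* y) :+ d) := (u :+ n) :* (a :* y) :+ (c :+ d))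
           refl (u 0) (f 0) y (ι (suc m)) c₁ c₂ ⟩
    (u 0 + ι (suc m)) * (f 0 * y) + (c₁ + c₂)
      ≡⟨ cong₂ (λ s t → s * (f 0 * y) + t) (hu 0 (suc m)) (conv-weights (u ∘ suc) (hu ∘ suc) (f ∘ suc) g m) ⟩
    u (suc m) * (f 0 * y) + u (suc m) * conv (f ∘ suc) g m
      ≡⟨ sym (ℚP.*-distribˡ-+ (u (suc m)) (f 0 * y) (conv (f ∘ suc) g m)) ⟩
    u (suc m) * (f 0 * y + conv (f ∘ suc) g m) ∎
    where
    y c₁ c₂ : ℚ
    y  = g (suc m)
    c₁ = conv (λ i → u (suc i) * f (suc i)) g m
    c₂ = conv (f ∘ suc) (λ j → ι j * g j) m

  egf-shift : ∀ a k → ι (suc k) * egf a (suc k) ≡ egf (a ∘ suc) k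
  egf-shift a k = begin-equality
    ι (suc k) * (a (suc k) * (1/ suc k !))
      ≡⟨ solve 3 (λ n a c → n :* (a :* c) := a :* (c :* n)) refl (ι (suc k)) (a (suc k)) (1/ suc k !) ⟩
    a (suc k) * ((1/ suc k !) * ι (suc k))
      ≡⟨ cong (a (suc k) *_) (sym (Defs.1/!-suc k)) ⟩
    a (suc k) * (1/ k !) ∎

  -- The coefficient of degree m in (fg)′ = f′g + fg′: weighting by the index differentiates a power
  -- series.
  conv-egf-suc : ∀ a b m →
    ι (suc m) * conv (egf a) (egf b) (suc m) ≡ conv (egf (a ∘ suc)) (egf b) m + conv (egf a) (egf (b ∘ suc)) m
  conv-egf-suc a b m = begin-equality
    ι (suc m) * conv (egf a) (egf b) (suc m)
      ≡⟨ sym (conv-weights ι ι-+ (egf a) (egf b) (suc m)) ⟩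
    conv (λ i → ι i * egf a i) (egf b) (suc m) + conv (egf a) (λ j → ι j * egf b j) (suc m)
      ≡⟨ cong₂ _+_ left right ⟩
    conv (egf (a ∘ suc)) (egf b) m + conv (egf a) (egf (b ∘ suc)) m ∎
    where
    left : conv (λ i → ι i * egf a i) (egf b) (suc m) ≡ conv (egf (a ∘ suc)) (egf b) m
    left = trans (cong₂ _+_ (solve 2 (λ a b → con 0ℚ :* a :* b := con 0ℚ) refl (egf a 0) (egf b (suc m)))
                   (conv-cong m (egf-shift a) (λ _ → refl)))
      (ℚP.+-identityˡ _)
    right : conv (egf a) (λ j → ι j * egf b j) (suc m) ≡ conv (egf a) (egf (b ∘ suc)) m
    right = trans (conv-last (egf a) (λ j → ι j * egf b j) m)
      (trans (cong₂ _+_ (conv-cong m (λ _ → refl) (egf-shift b))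
               (solve 2 (λ a b → a :* (con 0ℚ :* b) := con 0ℚ) refl (egf a (suc m)) (egf b 0)))
        (ℚP.+-identityʳ _))

  conv-egf : ∀ a b m → conv (egf a) (egf b) m ≡ egf (bin a b) m
  conv-egf a b zero = solve 2 (λ a b → (a :* con 1ℚ) :* (b :* con 1ℚ) := a :* b :* con 1ℚ) refl (a 0) (b 0)
  conv-egf a b (suc m) = *-cancel-≡ (ι-pos m) (begin-equality
    ι (suc m) * conv (egf a) (egf b) (suc m)
      ≡⟨ conv-egf-suc a b m ⟩
    conv (egf (a ∘ suc)) (egf b) m + conv (egf a) (egf (b ∘ suc)) m
      ≡⟨ cong₂ _+_ (conv-egf (a ∘ suc) b m) (conv-egf a (b ∘ suc) m) ⟩
    bin (a ∘ suc) b m * (1/ m !) + bin a (b ∘ suc) m * (1/ m !)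
      ≡⟨ sym (ℚP.*-distribʳ-+ (1/ m !) (bin (a ∘ suc) b m) (bin a (b ∘ suc) m)) ⟩
    egf (λ k → bin a b (suc k)) m
      ≡⟨ sym (egf-shift (bin a b) m) ⟩
    ι (suc m) * egf (bin a b) (suc m) ∎)

  bin-scaleˡ : ∀ c a b m → bin (λ k → c * a k) b m ≡ c * bin a b m
  bin-scaleˡ c a b zero    = ℚP.*-assoc c (a 0) (b 0)
  bin-scaleˡ c a b (suc m) = trans (cong₂ _+_ (bin-scaleˡ c (a ∘ suc) b m) (bin-scaleˡ c a (b ∘ suc) m))
    (sym (ℚP.*-distribˡ-+ c (bin (a ∘ suc) b m) (bin a (b ∘ suc) m)))

  bin-scaleʳ : ∀ c a b m → bin a (λ k → c * b k) m ≡ c * bin a b m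
  bin-scaleʳ c a b zero    = solve 3 (λ c a b → a :* (c :* b) := c :* (a :* b)) refl c (a 0) (b 0)
  bin-scaleʳ c a b (suc m) = trans (cong₂ _+_ (bin-scaleʳ c (a ∘ suc) b m) (bin-scaleʳ c a (b ∘ suc) m))
    (sym (ℚP.*-distribˡ-+ c (bin (a ∘ suc) b m) (bin a (b ∘ suc) m)))

  bin-nonNeg : ∀ {a b} → (∀ k → 0ℚ ≤ a k) → (∀ k → 0ℚ ≤ b k) → ∀ m → 0ℚ ≤ bin a b m
  bin-nonNeg ha hb zero    = *-nonNeg (ha 0) (hb 0)
  bin-nonNeg ha hb (suc m) = +-nonNeg (bin-nonNeg (ha ∘ suc) hb m) (bin-nonNeg ha (hb ∘ suc) m)

  binomial : ∀ x y m → bin (x ^_) (y ^_) m ≡ (x + y) ^ m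
  binomial x y zero    = refl
  binomial x y (suc m) = begin-equality
    bin (λ k → x * x ^ k) (y ^_) m + bin (x ^_) (λ k → y * y ^ k) m
      ≡⟨ cong₂ _+_ (bin-scaleˡ x (x ^_) (y ^_) m) (bin-scaleʳ y (x ^_) (y ^_) m) ⟩
    x * bin (x ^_) (y ^_) m + y * bin (x ^_) (y ^_) m
      ≡⟨ sym (ℚP.*-distribʳ-+ (bin (x ^_) (y ^_) m) x y) ⟩
    (x + y) * bin (x ^_) (y ^_) m
      ≡⟨ cong ((x + y) *_) (binomial x y m) ⟩
    (x + y) * (x + y) ^ m ∎

  -- Partial sums of the exponential series

  P : ℚ → ℕ → ℚ
  P x = egf (x ^_)

  s : ℕ → ℚ → ℚ
  s n x = sum n (P x)

  1/!-nonNeg : ∀ k → 0ℚ ≤ 1/ k !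
  1/!-nonNeg k = ℚP.<⇒≤ (Defs.1/!-pos k)

  P-nonNeg : ∀ {x} → 0ℚ ≤ x → ∀ k → 0ℚ ≤ P x k
  P-nonNeg hx k = *-nonNeg (^-nonNeg hx k) (1/!-nonNeg k)

  -- Cut along antidiagonals, the functional equation e^x e^y = e^{x+y} is exact at every finite
  -- stage, by the binomial theorem in each degree.
  tri-P : ∀ x y n → tri (P x) (P y) n ≡ s n (x + y)
  tri-P x y n = trans (tri-sum (P x) (P y) n)
    (sum-cong n λ k _ → trans (conv-egf (x ^_) (y ^_) k) (cong (_* (1/ k !)) (binomial x y k)))

  s-zero : ∀ n → s n 0ℚ ≡ 1ℚ
  s-zero zero    = refl
  s-zero (suc n) = trans (cong₂ _+_ (s-zero n)
    (solve 2 (λ a c → con 0ℚ :* a :* c := con 0ℚ) refl (0ℚ ^ n) (1/ suc n !))) (ℚP.+-identityʳ 1ℚ)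

  s-mono : ∀ n {x y} → 0ℚ ≤ x → x ≤ y → s n x ≤ s n y
  s-mono n hx h = sum-mono n λ k _ → *-monoʳ (1/ k !) (1/!-nonNeg k) (^-mono hx h k)

  1≤s : ∀ n {x} → 0ℚ ≤ x → 1ℚ ≤ s n x
  1≤s n {x} hx = subst (_≤ s n x) (s-zero n) (s-mono n ℚP.≤-refl hx)

  ∣P∣ : ∀ x k → ∣ P (- x) k ∣ ≡ ∣ P x k ∣
  ∣P∣ x k = trans (ℚP.∣p*q∣≡∣p∣*∣q∣ ((- x) ^ k) (1/ k !))
    (trans (cong (_* ∣ 1/ k ! ∣) (∣^∣ k)) (sym (ℚP.∣p*q∣≡∣p∣*∣q∣ (x ^ k) (1/ k !))))
    where
    ∣^∣ : ∀ k → ∣ (- x) ^ k ∣ ≡ ∣ x ^ k ∣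
    ∣^∣ zero    = refl
    ∣^∣ (suc k) = trans (ℚP.∣p*q∣≡∣p∣*∣q∣ (- x) ((- x) ^ k))
      (trans (cong₂ _*_ (ℚP.∣-p∣≡∣p∣ x) (∣^∣ k)) (sym (ℚP.∣p*q∣≡∣p∣*∣q∣ x (x ^ k))))

  module _ {x : ℚ} (hx : 0ℚ ≤ x) where

    P-dominated : ∀ k → ∣ P x k ∣ ≤ P x k
    P-dominated k = ℚP.≤-reflexive (ℚP.0≤p⇒∣p∣≡p (P-nonNeg hx k))

    -- The terms at -x and x have equal absolute values, so what S_n(x) S_n(-x) has outside the
    -- triangle i + j ≤ n is bounded by the same region of S_n(x)²; removing from that square only
    -- i, j ≤ m gives a larger region.
    s-square-gap : ∀ m → ∣ s (m ℕ.+ m) x * s (m ℕ.+ m) (- x) - 1ℚ ∣ ≤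
      s (m ℕ.+ m) x * s (m ℕ.+ m) x - s m x * s m x
    s-square-gap m = begin
      ∣ s n x * s n (- x) - 1ℚ ∣
        ≡⟨ cong (λ t → ∣ s n x * s n (- x) - t ∣)
             (sym (trans (tri-P x (- x) n) (trans (cong (s n) (ℚP.+-inverseʳ x)) (s-zero n)))) ⟩
      ∣ s n x * s n (- x) - tri (P x) (P (- x)) n ∣
        ≤⟨ overhang-dominated (λ k → ℚP.≤-trans (ℚP.≤-reflexive (∣P∣ x k)) (P-dominated k)) P-dominated n 0 ⟩
      s n x * s n x - tri (P x) (P x) n
        ≤⟨ ℚP.+-monoʳ-≤ (s n x * s n x) (ℚP.neg-antimono-≤ (rectangle≤tri (P-nonNeg hx) (P-nonNeg hx) m m)) ⟩
      s n x * s n x - s m x * s m x ∎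
      where
      n : ℕ
      n = m ℕ.+ m

    -- With each nonnegative series as its own majorant, `overhang-dominated` bounds an absolute
    -- value by the overhang itself, which is therefore nonnegative: the triangle is at most the
    -- square.
    s-+ : ∀ n {y} → 0ℚ ≤ y → s n (x + y) ≤ s n x * s n y
    s-+ n {y} hy = ≤-from-diff (ℚP.≤-trans (ℚP.0≤∣p∣ (s n x * s n y - tri (P x) (P y) n))
      (ℚP.≤-trans
        (overhang-dominated {P y} {P y} (λ k → ℚP.≤-reflexive (ℚP.0≤p⇒∣p∣≡p (P-nonNeg hy k)))
          {P x} {P x} P-dominated n 0)
        (ℚP.≤-reflexive (cong (λ t → s n x * s n y - t) (tri-P x y n)))))

    -- The sequence x^k cut off after k = d, whose generating function is S_d(x). In this recursive
    -- form the shift of `trunc (suc d)` is by definition x times `trunc d`, as the Leibniz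
    -- recursion of `bin` requires.
    trunc : ℕ → ℕ → ℚ
    trunc d       zero    = 1ℚ
    trunc zero    (suc k) = 0ℚ
    trunc (suc d) (suc k) = x * trunc d k

    trunc-nonNeg : ∀ d k → 0ℚ ≤ trunc d k
    trunc-nonNeg d       zero    = 0≤1
    trunc-nonNeg zero    (suc k) = ℚP.≤-refl
    trunc-nonNeg (suc d) (suc k) = *-nonNeg hx (trunc-nonNeg d k)

    trunc-below : ∀ {d k} → k ℕ.≤ d → trunc d k ≡ x ^ k
    trunc-below ℕ.z≤n     = refl
    trunc-below (ℕ.s≤s h) = cong (x *_) (trunc-below h)

    trunc-above : ∀ {d k} → d ℕ.< k → trunc d k ≡ 0ℚ
    trunc-above {zero}  (ℕ.s≤s h) = refl
    trunc-above {suc d} (ℕ.s≤s h) = trans (cong (x *_) (trunc-above h)) (ℚP.*-zeroʳ x)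

    sum-trunc : ∀ e d → sum (e ℕ.+ d) (egf (trunc d)) ≡ s d x
    sum-trunc zero    d = sum-cong d λ k h → cong (_* (1/ k !)) (trunc-below h)
    sum-trunc (suc e) d = trans (cong₂ _+_ (sum-trunc e d)
      (trans (cong (_* (1/ suc (e ℕ.+ d) !)) (trunc-above {d} (ℕ.s≤s (ℕP.m≤n+m d e))))
        (ℚP.*-zeroˡ (1/ suc (e ℕ.+ d) !)))) (ℚP.+-identityʳ (s d x))

    -- ∑_{k ≤ d} C(m,k) ≥ 2^d for m ≥ d, by Pascal's rule; the induction needs the cut-off d′ ≥ d free.
    2^≤bin-trunc : ∀ {d d′ m} → d ℕ.≤ d′ → d ℕ.≤ m → 2ℚ ^ d * x ^ m ≤ bin (trunc d′) (x ^_) m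
    2^≤bin-trunc {m = zero}      ℕ.z≤n ℕ.z≤n = ℚP.≤-refl
    2^≤bin-trunc {d′ = d′} {suc m} ℕ.z≤n ℕ.z≤n = begin
      1ℚ * (x * x ^ m)
        ≡⟨ solve 2 (λ x y → con 1ℚ :* (x :* y) := x :* (con 1ℚ :* y)) refl x (x ^ m) ⟩
      x * (1ℚ * x ^ m)
        ≤⟨ *-monoˡ x hx (2^≤bin-trunc {d′ = d′} {m} ℕ.z≤n ℕ.z≤n) ⟩
      x * bin (trunc d′) (x ^_) m
        ≡⟨ sym (bin-scaleʳ x (trunc d′) (x ^_) m) ⟩
      bin (trunc d′) (λ k → x * x ^ k) m
        ≤⟨ nonNeg+≤ (bin-nonNeg (trunc-nonNeg d′ ∘ suc) (^-nonNeg hx) m) ⟩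
      bin (trunc d′) (x ^_) (suc m) ∎
    2^≤bin-trunc {suc d} {suc d′} {suc m} (ℕ.s≤s h) (ℕ.s≤s k) = begin
      2ℚ * 2ℚ ^ d * (x * x ^ m)
        ≡⟨ solve 3 (λ x y t → (con 1ℚ :+ con 1ℚ) :* t :* (x :* y) := x :* (t :* y) :+ x :* (t :* y))
             refl x (x ^ m) (2ℚ ^ d) ⟩
      x * (2ℚ ^ d * x ^ m) + x * (2ℚ ^ d * x ^ m)
        ≤⟨ ℚP.+-mono-≤ (*-monoˡ x hx (2^≤bin-trunc h k)) (*-monoˡ x hx (2^≤bin-trunc (ℕP.m≤n⇒m≤1+n h) k)) ⟩
      x * bin (trunc d′) (x ^_) m + x * bin (trunc (suc d′)) (x ^_) m
        ≡⟨ sym (cong₂ _+_ (bin-scaleˡ x (trunc d′) (x ^_) m) (bin-scaleʳ x (trunc (suc d′)) (x ^_) m)) ⟩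
      bin (trunc (suc d′)) (x ^_) (suc m) ∎

    -- Termwise: degrees above d obey `2^≤bin-trunc`, and on the right the degrees up to d only add
    -- nonnegative terms.
    2^*tail≤ : ∀ e d → 2ℚ ^ d * (s (e ℕ.+ d) x - s d x) ≤ sum (e ℕ.+ d) (egf (bin (trunc d) (x ^_)))
    2^*tail≤ zero d = begin
      2ℚ ^ d * (s d x - s d x) ≡⟨ solve 2 (λ t y → t :* (y :- y) := con 0ℚ) refl (2ℚ ^ d) (s d x) ⟩
      0ℚ ≤⟨ sum-nonNeg d (λ k → *-nonNeg (bin-nonNeg (trunc-nonNeg d) (^-nonNeg hx) k) (1/!-nonNeg k)) ⟩
      sum d (egf (bin (trunc d) (x ^_))) ∎
    2^*tail≤ (suc e) d = begin
      2ℚ ^ d * (s m x + x ^ suc m * c - s d x)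
        ≡⟨ solve 5 (λ t y p c z → t :* (y :+ p :* c :- z) := t :* (y :- z) :+ t :* p :* c)
             refl (2ℚ ^ d) (s m x) (x ^ suc m) c (s d x) ⟩
      2ℚ ^ d * (s m x - s d x) + 2ℚ ^ d * x ^ suc m * c
        ≤⟨ ℚP.+-mono-≤ (2^*tail≤ e d) (*-monoʳ c (1/!-nonNeg (suc m))
             (2^≤bin-trunc {d} {d} {suc m} ℕP.≤-refl (ℕP.m≤n+m d (suc e)))) ⟩
      sum (suc m) (egf (bin (trunc d) (x ^_))) ∎
      where
      m : ℕ
      m = e ℕ.+ d
      c : ℚ
      c = 1/ suc m !

    2^*tail≤s*s : ∀ e d → 2ℚ ^ d * (s (e ℕ.+ d) x - s d x) ≤ s d x * s (e ℕ.+ d) x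
    2^*tail≤s*s e d = begin
      2ℚ ^ d * (s n x - s d x)
        ≤⟨ 2^*tail≤ e d ⟩
      sum n (egf (bin (trunc d) (x ^_)))
        ≡⟨ sym (trans (tri-sum f (P x) n) (sum-cong n λ k _ → conv-egf (trunc d) (x ^_) k)) ⟩
      tri f (P x) n
        ≤⟨ ≤-from-diff (ℚP.≤-trans (ℚP.0≤∣p∣ (sum n f * s n x - tri f (P x) n))
             (overhang-dominated {P x} {P x} P-dominated {f} {f} (λ k → ℚP.≤-reflexive (ℚP.0≤p⇒∣p∣≡p (f-nonNeg k))) n 0)) ⟩
      sum n f * s n x
        ≡⟨ cong (_* s n x) (sum-trunc e d) ⟩
      s d x * s n x ∎
      where
      n : ℕ
      n = e ℕ.+ d
      f : ℕ → ℚ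
      f = egf (trunc d)
      f-nonNeg : ∀ k → 0ℚ ≤ f k
      f-nonNeg k = *-nonNeg (trunc-nonNeg d k) (1/!-nonNeg k)

  -- Here s, A and B stand for S_d(x), S_n(x) and S_n(-x), and e bounds the error in A B = 1.
  module _ {s A B e : ℚ} (1≤s : 1ℚ ≤ s) (s≤A : s ≤ A) (AB : ∣ A * B - 1ℚ ∣ ≤ e) where

    private
      0<s : 0ℚ < s
      0<s = ℚP.<-≤-trans 0<1 1≤s
      0<A : 0ℚ < A
      0<A = ℚP.<-≤-trans 0<s s≤A
      0≤e : 0ℚ ≤ e
      0≤e = ℚP.≤-trans (ℚP.0≤∣p∣ (A * B - 1ℚ)) AB
      sr : s * recip s ≡ 1ℚ
      sr = recip-inverse s (pos≢0 0<s)
      0≤r : 0ℚ ≤ recip s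
      0≤r = ℚP.<⇒≤ (recip-pos 0<s)
      e≤Ae : e ≤ A * e
      e≤Ae = subst (_≤ A * e) (ℚP.*-identityˡ e) (*-monoʳ e 0≤e (ℚP.≤-trans 1≤s s≤A))

    inverse-upper : B ≤ recip s + e
    inverse-upper = *-cancel A 0<A (begin
      A * B             ≤⟨ dist⇒≤ {A * B} {1ℚ} AB ⟩
      1ℚ + e            ≤⟨ ℚP.+-mono-≤ (subst (_≤ A * recip s) sr (*-monoʳ (recip s) 0≤r s≤A)) e≤Ae ⟩
      A * recip s + A * e ≡⟨ sym (ℚP.*-distribˡ-+ A (recip s) e) ⟩
      A * (recip s + e) ∎)

    inverse-lower : ∀ {h t} → 0ℚ ≤ h → h * t ≡ 1ℚ → t * (A - s) ≤ s * A → recip s ≤ B + h + e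
    inverse-lower {h} {t} 0≤h ht tail = *-cancel A 0<A (begin
      A * r
        ≡⟨ solve 3 (λ a s r → a :* r := s :* r :+ con 1ℚ :* (r :* (a :- s))) refl A s r ⟩
      s * r + 1ℚ * (r * (A - s))
        ≡⟨ cong₂ (λ u v → u + v * (r * (A - s))) sr (sym ht) ⟩
      1ℚ + h * t * (r * (A - s))
        ≡⟨ cong (1ℚ +_) (solve 4 (λ h t r z → h :* t :* (r :* z) := (h :* r) :* (t :* z)) refl h t r (A - s)) ⟩
      1ℚ + (h * r) * (t * (A - s))
        ≤⟨ ℚP.+-mono-≤ (dist⇒≥ {A * B} {1ℚ} AB) (*-monoˡ (h * r) (*-nonNeg 0≤h 0≤r) tail) ⟩
      A * B + e + (h * r) * (s * A)
        ≡⟨ cong (A * B + e +_) (solve 4 (λ h r s a → (h :* r) :* (s :* a) := (s :* r) :* (a :* h)) refl h r s A) ⟩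
      A * B + e + (s * r) * (A * h)
        ≡⟨ cong (λ u → A * B + e + u) (trans (cong (_* (A * h)) sr) (ℚP.*-identityˡ (A * h))) ⟩
      A * B + e + A * h
        ≤⟨ ℚP.+-monoˡ-≤ (A * h) (ℚP.+-monoʳ-≤ (A * B) e≤Ae) ⟩
      A * B + A * e + A * h
        ≡⟨ solve 4 (λ a b e h → a :* b :+ a :* e :+ a :* h := a :* (b :+ h :+ e)) refl A B e h ⟩
      A * (B + h + e) ∎)
      where
      r : ℚ
      r = recip s

  ½^≤ : ∀ {A B e} d → 1ℚ ≤ A → A ≤ 2ℚ ^ d → ∣ A * B - 1ℚ ∣ ≤ e → ½ ^ d ≤ B + e
  ½^≤ {A} {B} {e} d 1≤A A≤ AB = *-cancel A (ℚP.<-≤-trans 0<1 1≤A) (begin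
    A * ½ ^ d      ≤⟨ *-monoʳ (½ ^ d) (^-nonNeg (ℚP.<⇒≤ 0<½) d) A≤ ⟩
    2ℚ ^ d * ½ ^ d ≡⟨ trans (ℚP.*-comm (2ℚ ^ d) (½ ^ d)) (½^*2^ d) ⟩
    1ℚ             ≤⟨ dist⇒≥ {A * B} {1ℚ} AB ⟩
    A * B + e      ≤⟨ ℚP.+-monoʳ-≤ (A * B) (subst (_≤ A * e) (ℚP.*-identityˡ e)
                        (*-monoʳ e (ℚP.≤-trans (ℚP.0≤∣p∣ (A * B - 1ℚ)) AB) 1≤A)) ⟩
    A * B + A * e  ≡⟨ sym (ℚP.*-distribˡ-+ A B e) ⟩
    A * (B + e)    ∎)

  -- Since 1/k! ≤ 1, the geometric series of ratio ½ is a majorant; its partial sums stay below 2.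
  s-half : ∀ n → s n ½ ≤ 2ℚ
  s-half n = begin
    s n ½         ≤⟨ sum-mono n (λ k _ → subst (P ½ k ≤_) (ℚP.*-identityʳ (½ ^ k))
                       (*-monoˡ (½ ^ k) (^-nonNeg (ℚP.<⇒≤ 0<½) k) (1/!≤1 k))) ⟩
    sum n (½ ^_)  ≤⟨ ≤+nonNeg (^-nonNeg (ℚP.<⇒≤ 0<½) n) ⟩
    sum n (½ ^_) + ½ ^ n ≡⟨ geometric n ⟩
    2ℚ            ∎
    where
    1/!≤1 : ∀ k → 1/ k ! ≤ 1ℚ
    1/!≤1 zero    = ℚP.≤-refl
    1/!≤1 (suc k) = begin
      1/ suc k !              ≡⟨ sym (ℚP.*-identityʳ (1/ suc k !)) ⟩
      (1/ suc k !) * 1ℚ       ≤⟨ *-monoˡ (1/ suc k !) (1/!-nonNeg (suc k)) (fromℕ-mono {1} {suc k} (ℕ.s≤s ℕ.z≤n)) ⟩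
      (1/ suc k !) * ι (suc k) ≡⟨ sym (Defs.1/!-suc k) ⟩
      1/ k !                  ≤⟨ 1/!≤1 k ⟩
      1ℚ                      ∎
    geometric : ∀ n → sum n (½ ^_) + ½ ^ n ≡ 2ℚ
    geometric zero    = refl
    geometric (suc n) = trans
      (solve 2 (λ a h → a :+ con ½ :* h :+ con ½ :* h := a :+ h) refl (sum n (½ ^_)) (½ ^ n)) (geometric n)

  s-halves : ∀ n d → s n (ι d * ½) ≤ 2ℚ ^ d
  s-halves n zero    = ℚP.≤-reflexive (s-zero n)
  s-halves n (suc d) = begin
    s n (ι (suc d) * ½)
      ≡⟨ cong (s n) (trans (cong (_* ½) (fromℕ-suc d)) (trans (ℚP.*-distribʳ-+ ½ 1ℚ (ι d))
           (cong (_+ ι d * ½) (ℚP.*-identityˡ ½)))) ⟩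
    s n (½ + ι d * ½)
      ≤⟨ s-+ 0≤½ n 0≤d/2 ⟩
    s n ½ * s n (ι d * ½)
      ≤⟨ *-mono (ℚP.≤-trans 0≤1 (1≤s n 0≤½)) (^-nonNeg {2ℚ} (+-nonNeg 0≤1 0≤1) d) (s-half n) (s-halves n d) ⟩
    2ℚ * 2ℚ ^ d ∎
    where
    0≤½ : 0ℚ ≤ ½
    0≤½ = ℚP.<⇒≤ 0<½
    0≤d/2 : 0ℚ ≤ ι d * ½
    0≤d/2 = *-nonNeg (ι-nonNeg d) 0≤½

  -- Partial sums of the logarithm

  oddRecip : ℕ → ℚ
  oddRecip k = ℤ.+ 2 / suc (2 ℕ.* k)

  logTermℚ : ℚ → ℕ → ℚ
  logTermℚ z k = z ^ suc (2 ℕ.* k) * oddRecip k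

  ℓ : ℕ → ℚ → ℚ
  ℓ n z = sum n (logTermℚ z)

  oddRecip-nonNeg : ∀ k → 0ℚ ≤ oddRecip k
  oddRecip-nonNeg k = ℚP.<⇒≤ (Defs./-pos 2 (suc (2 ℕ.* k)))

  oddRecip-odd : ∀ k → oddRecip k * ι (suc (2 ℕ.* k)) ≡ 2ℚ
  oddRecip-odd k = /-fromℕ 2 (suc (2 ℕ.* k))

  logTermℚ-nonNeg : ∀ {z} → 0ℚ ≤ z → ∀ k → 0ℚ ≤ logTermℚ z k
  logTermℚ-nonNeg hz k = *-nonNeg (^-nonNeg hz (suc (2 ℕ.* k))) (oddRecip-nonNeg k)

  ^-antitone : ∀ {z} → 0ℚ ≤ z → z ≤ 1ℚ → ∀ {m n} → m ℕ.≤ n → z ^ n ≤ z ^ m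
  ^-antitone hz h {n = zero}  ℕ.z≤n = ℚP.≤-refl
  ^-antitone {z} hz h {n = suc n} ℕ.z≤n = *-mono {z} {1ℚ} {z ^ n} {1ℚ} hz 0≤1 h (^-antitone hz h {n = n} ℕ.z≤n)
  ^-antitone {z} hz h (ℕ.s≤s k) = *-monoˡ z hz (^-antitone hz h k)

  -- The argument z = (2 - 1)/(2 + 1) of the series for log 2.
  ⅓ : ℚ
  ⅓ = ℤ.+ 1 / 3

  0≤⅓ : 0ℚ ≤ ⅓
  0≤⅓ = ℚP.≤ᵇ⇒≤ _

  ℓ⅓-upper : ∀ n → ℓ n ⅓ + ⅓ ^ suc n ≤ 1ℚ
  ℓ⅓-upper zero    = ℚP.≤-refl
  ℓ⅓-upper (suc n) = begin
    ℓ n ⅓ + logTermℚ ⅓ (suc n) + ⅓ * ⅓ ^ suc n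
      ≤⟨ ℚP.+-monoˡ-≤ (⅓ * ⅓ ^ suc n) (ℚP.+-monoʳ-≤ (ℓ n ⅓) (*-mono {⅓ * ⅓ ^ (2 ℕ.* suc n)} {⅓ * ⅓ ^ suc n} {oddRecip (suc n)} {2ℚ}
           (^-nonNeg 0≤⅓ (suc (2 ℕ.* suc n))) (+-nonNeg 0≤1 0≤1)
           (*-monoˡ ⅓ 0≤⅓ (^-antitone 0≤⅓ (ℚP.≤ᵇ⇒≤ _) (ℕP.m≤m+n (suc n) (suc n ℕ.+ 0))))
           oddRecip≤2)) ⟩
    ℓ n ⅓ + ⅓ * ⅓ ^ suc n * 2ℚ + ⅓ * ⅓ ^ suc n
      ≡⟨ solve 2 (λ l p → l :+ con ⅓ :* p :* (con 1ℚ :+ con 1ℚ) :+ con ⅓ :* p := l :+ p) refl (ℓ n ⅓) (⅓ ^ suc n) ⟩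
    ℓ n ⅓ + ⅓ ^ suc n
      ≤⟨ ℓ⅓-upper n ⟩
    1ℚ ∎
    where
    oddRecip≤2 : oddRecip (suc n) ≤ 2ℚ
    oddRecip≤2 = subst₂ _≤_ (ℚP.*-identityʳ (oddRecip (suc n))) (oddRecip-odd (suc n))
      (*-monoˡ (oddRecip (suc n)) (oddRecip-nonNeg (suc n))
        (fromℕ-mono {1} {suc (2 ℕ.* suc n)} (ℕ.s≤s ℕ.z≤n)))

  bernoulli : ∀ {w} → 0ℚ ≤ w → w ≤ 1ℚ → ∀ n → 1ℚ - ι n * w ≤ (1ℚ - w) ^ n
  bernoulli {w} 0≤w w≤1 zero    = ℚP.≤-reflexive (solve 1 (λ w → con 1ℚ :- con 0ℚ :* w := con 1ℚ) refl w)
  bernoulli {w} 0≤w w≤1 (suc n) = begin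
    1ℚ - ι (suc n) * w
      ≤⟨ ≤-by (*-nonNeg (ι-nonNeg n) (*-nonNeg 0≤w 0≤w)) (trans
           (solve 2 (λ n w → n :* (w :* w) := (con 1ℚ :- w) :* (con 1ℚ :- n :* w) :- (con 1ℚ :- (con 1ℚ :+ n) :* w))
             refl (ι n) w)
           (cong (λ t → (1ℚ - w) * (1ℚ - ι n * w) - (1ℚ - t * w)) (sym (fromℕ-suc n)))) ⟩
    (1ℚ - w) * (1ℚ - ι n * w)
      ≤⟨ *-monoˡ (1ℚ - w) (diff-nonNeg w≤1) (bernoulli 0≤w w≤1 n) ⟩
    (1ℚ - w) * (1ℚ - w) ^ n ∎

  sum-block : ∀ {f c} l K → (∀ k → k ℕ.≤ l ℕ.+ K → c ≤ f k) → sum K f + ι l * c ≤ sum (l ℕ.+ K) f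
  sum-block {f} {c} zero K h =
    ℚP.≤-reflexive (solve 2 (λ a c → a :+ con 0ℚ :* c := a) refl (sum K f) c)
  sum-block {f} {c} (suc l) K h = begin
    sum K f + ι (suc l) * c
      ≡⟨ cong (λ t → sum K f + t * c) (fromℕ-suc l) ⟩
    sum K f + (1ℚ + ι l) * c
      ≡⟨ solve 3 (λ a l c → a :+ (con 1ℚ :+ l) :* c := (a :+ l :* c) :+ c) refl (sum K f) (ι l) c ⟩
    (sum K f + ι l * c) + c
      ≤⟨ ℚP.+-mono-≤ (sum-block l K (λ k k≤ → h k (ℕP.m≤n⇒m≤1+n k≤))) (h (suc l ℕ.+ K) ℕP.≤-refl) ⟩
    sum (l ℕ.+ K) f + f (suc l ℕ.+ K) ∎

  -- The last index of the first 2^j terms. Passing from K to suc K + K appends suc K further terms,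
  -- one dyadic block.
  2^j-1 : ℕ → ℕ
  2^j-1 zero    = 0
  2^j-1 (suc j) = suc (2^j-1 j) ℕ.+ 2^j-1 j

  ι-2^j-1 : ∀ j → ι (suc (2^j-1 j)) ≡ 2ℚ ^ j
  ι-2^j-1 zero    = refl
  ι-2^j-1 (suc j) = begin-equality
    ι (suc (suc K ℕ.+ K))    ≡⟨ cong ι (sym (ℕP.+-suc (suc K) K)) ⟩
    ι (suc K ℕ.+ suc K)      ≡⟨ sym (ι-+ (suc K) (suc K)) ⟩
    ι (suc K) + ι (suc K)    ≡⟨ cong₂ _+_ (ι-2^j-1 j) (ι-2^j-1 j) ⟩
    2ℚ ^ j + 2ℚ ^ j          ≡⟨ solve 1 (λ t → t :+ t := (con 1ℚ :+ con 1ℚ) :* t) refl (2ℚ ^ j) ⟩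
    2ℚ * 2ℚ ^ j              ∎
    where
    K : ℕ
    K = 2^j-1 j

  ι-odd≤ : ∀ {k K} → k ℕ.≤ K → ι (suc (2 ℕ.* k)) ≤ 2ℚ * ι (suc K)
  ι-odd≤ {k} {K} h = ℚP.≤-trans
    (fromℕ-mono {suc (2 ℕ.* k)} {2 ℕ.* suc K}
      (ℕP.≤-trans (ℕP.n≤1+n (suc (2 ℕ.* k))) (subst (ℕ._≤ 2 ℕ.* suc K) (ℕP.*-suc 2 k) (ℕP.*-monoʳ-≤ 2 (ℕ.s≤s h)))))
    (ℚP.≤-reflexive (fromℕ-* 2 (suc K)))

  -- Oresme's estimate: each dyadic block of ∑ 2/(2k+1) contributes at least ½.
  oresme : ∀ j → ι j * ½ ≤ sum (2^j-1 j) oddRecip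
  oresme zero    = ℚP.≤ᵇ⇒≤ _
  oresme (suc j) = begin
    ι (suc j) * ½
      ≡⟨ trans (cong (_* ½) (fromℕ-suc j))
           (solve 1 (λ j → (con 1ℚ :+ j) :* con ½ := j :* con ½ :+ con ½) refl (ι j)) ⟩
    ι j * ½ + ½
      ≤⟨ ℚP.+-mono-≤ (oresme j) (ℚP.≤-reflexive (sym (begin-equality
           ι (suc K) * (½ * r)
             ≡⟨ solve 2 (λ n r → n :* (con ½ :* r) := con ½ :* (n :* r)) refl (ι (suc K)) r ⟩
           ½ * (ι (suc K) * r)
             ≡⟨ cong (½ *_) inverse ⟩
           ½ ∎))) ⟩
    sum K oddRecip + ι (suc K) * (½ * r)
      ≤⟨ sum-block (suc K) K block ⟩
    sum (2^j-1 (suc j)) oddRecip ∎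
    where
    K : ℕ
    K = 2^j-1 j
    r : ℚ
    r = recip (ι (suc K))
    inverse : ι (suc K) * r ≡ 1ℚ
    inverse = recip-inverse (ι (suc K)) (pos≢0 (ι-pos K))
    -- For k ≤ 2K + 1 one has 2k + 1 ≤ 4(K + 1), so each of the K + 1 new terms is at least ½/(K +
    -- 1).
    block : ∀ k → k ℕ.≤ suc K ℕ.+ K → ½ * r ≤ oddRecip k
    block k h = *-cancel (ι (suc (2 ℕ.* k))) (ι-pos (2 ℕ.* k)) (begin
      ι (suc (2 ℕ.* k)) * (½ * r)
        ≤⟨ *-monoʳ (½ * r) (*-nonNeg (ℚP.<⇒≤ 0<½) (ℚP.<⇒≤ (recip-pos (ι-pos K)))) (ι-odd≤ h) ⟩
      2ℚ * ι (suc (suc K ℕ.+ K)) * (½ * r)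
        ≡⟨ cong (λ t → 2ℚ * t * (½ * r)) (trans (cong ι (sym (ℕP.+-suc (suc K) K))) (sym (ι-+ (suc K) (suc K)))) ⟩
      2ℚ * (ι (suc K) + ι (suc K)) * (½ * r)
        ≡⟨ solve 2 (λ n r → (con 1ℚ :+ con 1ℚ) :* (n :+ n) :* (con ½ :* r) := (con 1ℚ :+ con 1ℚ) :* (n :* r))
             refl (ι (suc K)) r ⟩
      2ℚ * (ι (suc K) * r)
        ≡⟨ trans (cong (2ℚ *_) inverse) (ℚP.*-identityʳ 2ℚ) ⟩
      2ℚ
        ≡⟨ trans (sym (oddRecip-odd k)) (ℚP.*-comm (oddRecip k) (ι (suc (2 ℕ.* k)))) ⟩
      ι (suc (2 ℕ.* k)) * oddRecip k ∎)

  -- Lower bounds for the series of log y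

  module _ {y : ℚ} (1≤y : 1ℚ ≤ y) where

    logArgℚ : ℚ
    logArgℚ = (y - 1ℚ) * recip (y + 1ℚ)

    private
      z w : ℚ
      z = logArgℚ
      w = 1ℚ - z
      0<y+1 : 0ℚ < y + 1ℚ
      0<y+1 = ℚP.<-≤-trans 0<1 (ℚP.≤-trans 1≤y (≤+nonNeg 0≤1))
      0≤z : 0ℚ ≤ z
      0≤z = *-nonNeg (diff-nonNeg 1≤y) (ℚP.<⇒≤ (recip-pos 0<y+1))
      z*[y+1] : (y + 1ℚ) * z ≡ y - 1ℚ
      z*[y+1] = trans (solve 3 (λ a b r → a :* (b :* r) := b :* (a :* r)) refl (y + 1ℚ) (y - 1ℚ) (recip (y + 1ℚ)))
        (trans (cong ((y - 1ℚ) *_) (recip-inverse (y + 1ℚ) (pos≢0 0<y+1))) (ℚP.*-identityʳ (y - 1ℚ)))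
      -- The distance 1 - z from the argument to 1 is 2/(y + 1), which is small for large y.
      w*[y+1] : (y + 1ℚ) * w ≡ 2ℚ
      w*[y+1] = begin-equality
        (y + 1ℚ) * (1ℚ - z)
          ≡⟨ solve 2 (λ a z → a :* (con 1ℚ :- z) := a :- a :* z) refl (y + 1ℚ) z ⟩
        (y + 1ℚ) - (y + 1ℚ) * z
          ≡⟨ cong (λ t → (y + 1ℚ) - t) z*[y+1] ⟩
        (y + 1ℚ) - (y - 1ℚ)
          ≡⟨ solve 1 (λ y → (y :+ con 1ℚ) :- (y :- con 1ℚ) := con 1ℚ :+ con 1ℚ) refl y ⟩
        2ℚ ∎
      0≤w : 0ℚ ≤ w
      0≤w = *-cancel (y + 1ℚ) 0<y+1 (subst₂ _≤_ (sym (ℚP.*-zeroʳ (y + 1ℚ))) (sym w*[y+1]) (+-nonNeg 0≤1 0≤1))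

    -- The first term 2z is enough: y = 4/3 gives z = 1/7, and z increases with y.
    ℓ-const : ℤ.+ 4 / 3 ≤ y → ∀ n → ℤ.+ 2 / 7 ≤ ℓ n z
    ℓ-const 4/3≤y n = begin
      ℤ.+ 2 / 7
        ≤⟨ *-monoʳ {ℤ.+ 1 / 7} {z} 2ℚ (+-nonNeg 0≤1 0≤1) (*-cancel (y + 1ℚ) 0<y+1 (begin
             (y + 1ℚ) * (ℤ.+ 1 / 7)
               ≤⟨ ≤-by {e = (y - ℤ.+ 4 / 3) * (ℤ.+ 6 / 7)} (*-nonNeg (diff-nonNeg 4/3≤y) (ℚP.≤ᵇ⇒≤ _))
                    (solve 1 (λ y → (y :- con (ℤ.+ 4 / 3)) :* con (ℤ.+ 6 / 7) :=
                      (y :- con 1ℚ) :- (y :+ con 1ℚ) :* con (ℤ.+ 1 / 7)) refl y) ⟩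
             y - 1ℚ
               ≡⟨ sym z*[y+1] ⟩
             (y + 1ℚ) * z ∎)) ⟩
      z * 2ℚ
        ≡⟨ cong (_* 2ℚ) (sym (ℚP.*-identityʳ z)) ⟩
      ℓ 0 z
        ≤⟨ subst (λ k → ℓ 0 z ≤ ℓ k z) (ℕP.+-identityʳ n) (sum-extend n 0 (logTermℚ-nonNeg 0≤z)) ⟩
      ℓ n z ∎

    -- For k < 2^j the exponent 2k + 1 is at most 2 · 2^j, and w = 2/(y + 1). Bernoulli keeps
    -- z^(2k+1) above ½ once 4 · 2^j/(y + 1) ≤ ½, whence the 3 in 2^(3+j).
    ℓ-large : ∀ j → 2ℚ ^ (3 ℕ.+ j) ≤ y → ∀ n → 2^j-1 j ℕ.≤ n → ι j * ½ * ½ ≤ ℓ n z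
    ℓ-large j large n K≤n = begin
      ι j * ½ * ½
        ≤⟨ *-monoʳ ½ (ℚP.<⇒≤ 0<½) (oresme j) ⟩
      sum K oddRecip * ½
        ≡⟨ sum-half K ⟩
      sum K (λ k → ½ * oddRecip k)
        ≤⟨ sum-mono K (λ k k≤K → *-monoʳ (oddRecip k) (oddRecip-nonNeg k) (power k k≤K)) ⟩
      ℓ K z
        ≤⟨ subst (λ k → ℓ K z ≤ ℓ k z) (ℕP.m∸n+n≡m K≤n) (sum-extend (n ℕ.∸ K) K (logTermℚ-nonNeg 0≤z)) ⟩
      ℓ n z ∎
      where
      K : ℕ
      K = 2^j-1 j
      sum-half : ∀ n → sum n oddRecip * ½ ≡ sum n (λ k → ½ * oddRecip k)
      sum-half zero    = ℚP.*-comm (oddRecip 0) ½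
      sum-half (suc n) = trans (ℚP.*-distribʳ-+ ½ (sum n oddRecip) (oddRecip (suc n)))
        (cong₂ _+_ (sum-half n) (ℚP.*-comm (oddRecip (suc n)) ½))
      small : ∀ k → k ℕ.≤ K → ι (suc (2 ℕ.* k)) * w ≤ ½
      small k k≤K = *-cancel (y + 1ℚ) 0<y+1 (begin
        (y + 1ℚ) * (N * w)
          ≡⟨ solve 3 (λ a n w → a :* (n :* w) := n :* (a :* w)) refl (y + 1ℚ) N w ⟩
        N * ((y + 1ℚ) * w)
          ≡⟨ cong (N *_) w*[y+1] ⟩
        N * 2ℚ
          ≤⟨ *-monoʳ 2ℚ (+-nonNeg 0≤1 0≤1) (ι-odd≤ k≤K) ⟩
        2ℚ * ι (suc K) * 2ℚ
          ≡⟨ cong (λ t → 2ℚ * t * 2ℚ) (ι-2^j-1 j) ⟩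
        2ℚ * 2ℚ ^ j * 2ℚ
          ≡⟨ solve 1 (λ t → two :* t :* two := two :* (two :* (two :* t)) :* con ½) refl (2ℚ ^ j) ⟩
        2ℚ ^ (3 ℕ.+ j) * ½
          ≤⟨ *-monoʳ ½ (ℚP.<⇒≤ 0<½) (ℚP.≤-trans large (≤+nonNeg 0≤1)) ⟩
        (y + 1ℚ) * ½ ∎)
        where
        two = con 1ℚ :+ con 1ℚ
        N : ℚ
        N = ι (suc (2 ℕ.* k))
      w≤1 : w ≤ 1ℚ
      w≤1 = ≤-by 0≤z (solve 1 (λ z → z := con 1ℚ :- (con 1ℚ :- z)) refl z)
      power : ∀ k → k ℕ.≤ K → ½ ≤ z ^ suc (2 ℕ.* k)
      power k k≤K = begin
        1ℚ - ½                         ≤⟨ ℚP.+-monoʳ-≤ 1ℚ (ℚP.neg-antimono-≤ (small k k≤K)) ⟩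
        1ℚ - ι (suc (2 ℕ.* k)) * w     ≤⟨ bernoulli 0≤w w≤1 (suc (2 ℕ.* k)) ⟩
        (1ℚ - w) ^ suc (2 ℕ.* k)       ≡⟨ cong (_^ suc (2 ℕ.* k))
                                            (solve 1 (λ z → con 1ℚ :- (con 1ℚ :- z) := z) refl z) ⟩
        z ^ suc (2 ℕ.* k)              ∎

  -- Dyadic size of a positive rational

  1≤2^ : ∀ k → 1ℚ ≤ 2ℚ ^ k
  1≤2^ zero    = ℚP.≤-refl
  1≤2^ (suc k) = *-mono {1ℚ} {2ℚ} {1ℚ} {2ℚ ^ k} 0≤1 (^-nonNeg {2ℚ} (+-nonNeg 0≤1 0≤1) k) (≤+nonNeg 0≤1) (1≤2^ k)

  ι≤2^ : ∀ k → ι k ≤ 2ℚ ^ k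
  ι≤2^ zero    = 0≤1
  ι≤2^ (suc k) = begin
    ι (suc k)        ≡⟨ fromℕ-suc k ⟩
    1ℚ + ι k         ≤⟨ ℚP.+-mono-≤ (1≤2^ k) (ι≤2^ k) ⟩
    2ℚ ^ k + 2ℚ ^ k  ≡⟨ solve 1 (λ t → t :+ t := (con 1ℚ :+ con 1ℚ) :* t) refl (2ℚ ^ k) ⟩
    2ℚ * 2ℚ ^ k      ∎

  -- Doubling stops as soon as 1 is reached; a value at most 1 doubles to at most 2. The Archimedean
  -- property with k ≤ 2^k bounds the number of doublings.
  dyadic : ∀ {q} → 0ℚ < q → q ≤ 2ℚ → ∃ λ d → 1ℚ ≤ q * 2ℚ ^ d × q * 2ℚ ^ d ≤ 2ℚ
  dyadic {q} 0<q q≤2 = search (proj₁ arch) q q≤2 (begin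
      1ℚ                    ≤⟨ proj₂ arch ⟩
      ι (proj₁ arch) * q    ≡⟨ ℚP.*-comm (ι (proj₁ arch)) q ⟩
      q * ι (proj₁ arch)    ≤⟨ *-monoˡ q (ℚP.<⇒≤ 0<q) (ι≤2^ (proj₁ arch)) ⟩
      q * 2ℚ ^ proj₁ arch   ∎)
    where
    arch : ∃ λ k → 1ℚ ≤ ι k * q
    arch = archimedean 1ℚ 0<q
    double : ∀ p t → (p + p) * t ≡ p * (2ℚ * t)
    double = solve 2 (λ p t → (p :+ p) :* t := p :* ((con 1ℚ :+ con 1ℚ) :* t)) refl
    search : ∀ k p → p ≤ 2ℚ → 1ℚ ≤ p * 2ℚ ^ k → ∃ λ d → 1ℚ ≤ p * 2ℚ ^ d × p * 2ℚ ^ d ≤ 2ℚ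
    search zero    p p≤2 h = 0 , h , subst (_≤ 2ℚ) (sym (ℚP.*-identityʳ p)) p≤2
    search (suc k) p p≤2 h = [
      (λ 1≤p → 0 , subst (1ℚ ≤_) (sym (ℚP.*-identityʳ p)) 1≤p , subst (_≤ 2ℚ) (sym (ℚP.*-identityʳ p)) p≤2) ,
      (λ p≤1 → redouble (search k (p + p) (ℚP.+-mono-≤ {p} {1ℚ} {p} {1ℚ} p≤1 p≤1) (subst (1ℚ ≤_) (sym (double p (2ℚ ^ k))) h))) ]′
      (ℚP.≤-total 1ℚ p)
      where
      redouble : (∃ λ d → 1ℚ ≤ (p + p) * 2ℚ ^ d × (p + p) * 2ℚ ^ d ≤ 2ℚ) → ∃ λ d → 1ℚ ≤ p * 2ℚ ^ d × p * 2ℚ ^ d ≤ 2ℚ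
      redouble (d , lo , hi) =
        suc d , subst (1ℚ ≤_) (double p (2ℚ ^ d)) lo , subst (_≤ 2ℚ) (double p (2ℚ ^ d)) hi

module RealEstimates where

  open Defs using (ℝ; seq; cauchy; fromℚ; fromℕ; exp; log; lim; lim-converges; Σ≤; S; S-cauchy;
                   logTerm; logArg; [0,∞[; 2^_; 0<2; IsCauchyℝ)
    renaming (_+_ to _⊕_; _*_ to _⊗_; -_ to ⊖_; _⊔_ to _∨_; _^_ to _⊙_; _≤_ to _≤ᴿ_; _<_ to _<ᴿ_)
  open Defs.Sequences
  open RationalEstimates
  open import Data.Rational using (_+_; _*_; _-_; -_; ∣_∣; _≤_; _<_; _/_; _⊔_)
  open import Data.Rational.Solver using (module +-*-Solver)
  open +-*-Solver using (solve; _:=_; _:+_; _:*_; _:-_; :-_; con)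
  open ℚP.≤-Reasoning

  -- Rational estimates at late indices of the limits

  eventually-map : ∀ {P Q : ℕ → Set} → (∀ i → P i → Q i) → Eventually P → Eventually Q
  eventually-map f (N , h) = N , λ i hi → f i (h i hi)

  seq-^ : ∀ x k i → seq (x ⊙ k) i ≡ seq x i ^ k
  seq-^ x zero    i = refl
  seq-^ x (suc k) i = cong (seq x i *_) (seq-^ x k i)

  seq-Σ : ∀ n {f g i} → (∀ k → seq (f k) i ≡ g k) → seq (Σ≤ n f) i ≡ sum n g
  seq-Σ zero    h = h 0
  seq-Σ (suc n) h = cong₂ _+_ (seq-Σ n h) (h (suc n))

  seq-S : ∀ n x i → seq (S n x) i ≡ s n (seq x i)
  seq-S n x i = seq-Σ n λ k → cong (_* (1/ k !)) (seq-^ x k i)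

  lim-approx : ∀ f (fc : IsCauchyℝ f) ε → 0ℚ < ε →
    Eventually λ n → Eventually λ i → ∣ seq (f n) i - seq (lim f fc) i ∣ ≤ ε
  lim-approx f fc ε hε = eventually-map
    (λ n near → eventually-map
      (λ i → subst (∣ seq (f n) i - seq (lim f fc) i ∣ ≤_) (half+half ε)) (near (ε * ½) (half hε)))
    (lim-converges f fc (ε * ½) (half hε))

  exp-approx : ∀ x ε → 0ℚ < ε →
    Eventually λ n → Eventually λ i → ∣ s n (seq x i) - seq (exp x) i ∣ ≤ ε
  exp-approx x ε hε = eventually-map
    (λ n → eventually-map (λ i → subst (λ t → ∣ t - seq (exp x) i ∣ ≤ ε) (seq-S n x i)))
    (lim-approx (λ n → S n x) (S-cauchy x) ε hε)

  -- The gap is A² - B² = (A - B)(A + B) for partial sums A and B at z, which approach the same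
  -- limit.
  square-gap-small : ∀ z → (∀ i → 0ℚ ≤ seq z i) → ∀ ε → 0ℚ < ε → Eventually λ m → Eventually λ i →
    ∣ s (m ℕ.+ m) (seq z i) * s (m ℕ.+ m) (- seq z i) - 1ℚ ∣ ≤ ε
  square-gap-small z 0≤z ε hε = proj₁ near , λ m hm →
    let hn = ℕP.≤-trans hm (ℕP.m≤m+n m m) in
    eventually-map (λ i (coarse , fine₁ , fine₂) → ℚP.≤-trans (s-square-gap (0≤z i) m)
        (gap (s (m ℕ.+ m) (seq z i)) (s m (seq z i)) (seq (exp z) i)
          (proj₂ (proj₂ B₀) i) (ℚP.≤-trans 0≤1 (1≤s m (0≤z i))) (sum-extend m m (P-nonNeg (0≤z i)))
          coarse fine₁ fine₂))
      (both (proj₁ (proj₂ near (m ℕ.+ m) hn))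
        (both (proj₂ (proj₂ near (m ℕ.+ m) hn)) (proj₂ (proj₂ near m hm))))
    where
    B₀ : ∃ λ B → 0ℚ < B × (∀ i → ∣ seq (exp z) i ∣ ≤ B)
    B₀ = bounded {seq (exp z)} (cauchy (exp z))
    E K η : ℚ
    E = proj₁ B₀
    -- K bounds A + B once A is within 1 of the limit, and 2η = ε/K bounds A - B.
    K = (E + 1ℚ) + (E + 1ℚ)
    η = ε * recip K * ½
    0<E : 0ℚ < E
    0<E = proj₁ (proj₂ B₀)
    0<K : 0ℚ < K
    0<K = ℚP.<-≤-trans 0<E (ℚP.≤-trans (≤+nonNeg 0≤1) (≤+nonNeg (+-nonNeg (ℚP.<⇒≤ 0<E) 0≤1)))
    near : Eventually λ n → Eventually (λ i → ∣ s n (seq z i) - seq (exp z) i ∣ ≤ 1ℚ) ×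
                            Eventually (λ i → ∣ s n (seq z i) - seq (exp z) i ∣ ≤ η)
    near = both (exp-approx z 1ℚ 0<1) (exp-approx z η (half (*-pos hε (recip-pos 0<K))))
    gap : ∀ A B e → ∣ e ∣ ≤ E → 0ℚ ≤ B → B ≤ A → ∣ A - e ∣ ≤ 1ℚ → ∣ A - e ∣ ≤ η → ∣ B - e ∣ ≤ η →
      A * A - B * B ≤ ε
    gap A B e he 0≤B B≤A coarse fine₁ fine₂ = begin
      A * A - B * B
        ≡⟨ solve 2 (λ a b → a :* a :- b :* b := (a :- b) :* (a :+ b)) refl A B ⟩
      (A - B) * (A + B)
        ≤⟨ *-mono (diff-nonNeg B≤A) (ℚP.<⇒≤ 0<K) A-B≤ (ℚP.+-mono-≤ A≤ (ℚP.≤-trans B≤A A≤)) ⟩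
      ε * recip K * K
        ≡⟨ solve 3 (λ e r k → e :* r :* k := e :* (k :* r)) refl ε (recip K) K ⟩
      ε * (K * recip K)
        ≡⟨ trans (cong (ε *_) (recip-inverse K (pos≢0 0<K))) (ℚP.*-identityʳ ε) ⟩
      ε ∎
      where
      A≤ : A ≤ E + 1ℚ
      A≤ = ℚP.≤-trans (dist⇒≤ {A} {e} coarse) (ℚP.+-monoˡ-≤ 1ℚ (ℚP.≤-trans (p≤∣p∣ e) he))
      A-B≤ : A - B ≤ ε * recip K
      A-B≤ = begin
        A - B                                 ≤⟨ p≤∣p∣ (A - B) ⟩
        ∣ A - B ∣                             ≤⟨ triangle A e B ⟩
        ∣ A - e ∣ + ∣ e - B ∣                 ≤⟨ ℚP.+-mono-≤ fine₁ (subst (_≤ η) (∣-∣-swap B e) fine₂) ⟩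
        η + η                                 ≡⟨ half+half (ε * recip K) ⟩
        ε * recip K                           ∎

  -- Equality of reals and its congruences

  infix 4 _≈_

  -- Equality as a null difference of sequences, the form in which x and its positive part are
  -- exchanged inside polynomials.
  _≈_ : ℝ → ℝ → Set
  x ≈ y = ∀ ε → 0ℚ < ε → Eventually λ i → ∣ seq x i - seq y i ∣ ≤ ε

  ≈-refl : ∀ x → x ≈ x
  ≈-refl x ε hε = 0 , λ i _ →
    ℚP.≤-trans (ℚP.≤-reflexive (cong ∣_∣ (ℚP.+-inverseʳ (seq x i)))) (ℚP.<⇒≤ hε)

  ⊖-cong : ∀ {x y} → x ≈ y → ⊖ x ≈ ⊖ y
  ⊖-cong {x} {y} h ε hε = eventually-map (λ i → subst (_≤ ε)
    (trans (sym (ℚP.∣-p∣≡∣p∣ (seq x i - seq y i)))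
      (cong ∣_∣ (solve 2 (λ p q → :- (p :- q) := (:- p) :- (:- q)) refl (seq x i) (seq y i))))) (h ε hε)

  ⊕-cong : ∀ {x x′ y y′} → x ≈ x′ → y ≈ y′ → x ⊕ y ≈ x′ ⊕ y′
  ⊕-cong {x} {x′} {y} {y′} hx hy ε hε = eventually-map
    (λ i (p , q) → go (seq x i) (seq x′ i) (seq y i) (seq y′ i) p q)
    (both (hx (ε * ½) (half hε)) (hy (ε * ½) (half hε)))
    where
    go : ∀ a a′ b b′ → ∣ a - a′ ∣ ≤ ε * ½ → ∣ b - b′ ∣ ≤ ε * ½ → ∣ (a + b) - (a′ + b′) ∣ ≤ ε
    go a a′ b b′ p q = begin
      ∣ (a + b) - (a′ + b′) ∣
        ≡⟨ cong ∣_∣ (solve 4 (λ a a′ b b′ → (a :+ b) :- (a′ :+ b′) := (a :- a′) :+ (b :- b′)) refl a a′ b b′) ⟩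
      ∣ (a - a′) + (b - b′) ∣   ≤⟨ ℚP.∣p+q∣≤∣p∣+∣q∣ (a - a′) (b - b′) ⟩
      ∣ a - a′ ∣ + ∣ b - b′ ∣   ≤⟨ ℚP.+-mono-≤ p q ⟩
      ε * ½ + ε * ½             ≡⟨ half+half ε ⟩
      ε                         ∎

  ⊗-cong : ∀ {x x′ y y′} → x ≈ x′ → y ≈ y′ → x ⊗ y ≈ x′ ⊗ y′
  ⊗-cong {x} {x′} {y} {y′} hx hy ε hε = eventually-map
    (λ i (p , q) → go (seq x i) (seq x′ i) (seq y i) (seq y′ i)
      (proj₂ (proj₂ A₀) i) (proj₂ (proj₂ B₀) i) p q)
    (both (hx (ε * ½ * recip B) (*-pos (half hε) (recip-pos 0<B)))
          (hy (ε * ½ * recip A) (*-pos (half hε) (recip-pos 0<A))))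
    where
    A₀ : ∃ λ A → 0ℚ < A × (∀ i → ∣ seq x′ i ∣ ≤ A)
    A₀ = bounded {seq x′} (cauchy x′)
    B₀ : ∃ λ B → 0ℚ < B × (∀ i → ∣ seq y i ∣ ≤ B)
    B₀ = bounded {seq y} (cauchy y)
    A B : ℚ
    A = proj₁ A₀
    B = proj₁ B₀
    0<A : 0ℚ < A
    0<A = proj₁ (proj₂ A₀)
    0<B : 0ℚ < B
    0<B = proj₁ (proj₂ B₀)
    cancel : ∀ c → 0ℚ < c → ε * ½ * recip c * c ≡ ε * ½
    cancel c 0<c = trans (solve 3 (λ e r c → e :* r :* c := e :* (c :* r)) refl (ε * ½) (recip c) c)
      (trans (cong (ε * ½ *_) (recip-inverse c (pos≢0 0<c))) (ℚP.*-identityʳ (ε * ½)))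
    go : ∀ a a′ b b′ → ∣ a′ ∣ ≤ A → ∣ b ∣ ≤ B →
      ∣ a - a′ ∣ ≤ ε * ½ * recip B → ∣ b - b′ ∣ ≤ ε * ½ * recip A → ∣ a * b - a′ * b′ ∣ ≤ ε
    go a a′ b b′ hA hB p q = begin
      ∣ a * b - a′ * b′ ∣
        ≡⟨ cong ∣_∣ (solve 4 (λ a a′ b b′ → a :* b :- a′ :* b′ := (a :- a′) :* b :+ (b :- b′) :* a′) refl a a′ b b′) ⟩
      ∣ (a - a′) * b + (b - b′) * a′ ∣
        ≤⟨ ℚP.∣p+q∣≤∣p∣+∣q∣ ((a - a′) * b) ((b - b′) * a′) ⟩
      ∣ (a - a′) * b ∣ + ∣ (b - b′) * a′ ∣
        ≡⟨ cong₂ _+_ (ℚP.∣p*q∣≡∣p∣*∣q∣ (a - a′) b) (ℚP.∣p*q∣≡∣p∣*∣q∣ (b - b′) a′) ⟩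
      ∣ a - a′ ∣ * ∣ b ∣ + ∣ b - b′ ∣ * ∣ a′ ∣
        ≤⟨ ℚP.+-mono-≤ (*-mono (ℚP.0≤∣p∣ (a - a′)) (ℚP.<⇒≤ 0<B) p hB)
             (*-mono (ℚP.0≤∣p∣ (b - b′)) (ℚP.<⇒≤ 0<A) q hA) ⟩
      ε * ½ * recip B * B + ε * ½ * recip A * A
        ≡⟨ trans (cong₂ _+_ (cancel B 0<B) (cancel A 0<A)) (half+half ε) ⟩
      ε ∎

  ^-cong : ∀ {x y} → x ≈ y → ∀ k → x ⊙ k ≈ y ⊙ k
  ^-cong         h zero    = ≈-refl (fromℕ 1)
  ^-cong {x} {y} h (suc k) = ⊗-cong {x} {y} {x ⊙ k} {y ⊙ k} h (^-cong {x} {y} h k)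

  S-cong : ∀ {x y} → x ≈ y → ∀ n → S n x ≈ S n y
  S-cong {x} {y} h n = go n
    where
    c : ℕ → ℝ
    c k = fromℚ (1/ k !)
    term : ∀ k → x ⊙ k ⊗ c k ≈ y ⊙ k ⊗ c k
    term k = ⊗-cong {x ⊙ k} {y ⊙ k} {c k} {c k} (^-cong {x} {y} h k) (≈-refl (c k))
    go : ∀ n → S n x ≈ S n y
    go zero    = term 0
    go (suc n) = ⊕-cong {S n x} {S n y} {x ⊙ suc n ⊗ c (suc n)} {y ⊙ suc n ⊗ c (suc n)} (go n) (term (suc n))

  s-cong : ∀ {x y} → x ≈ y → ∀ n ε → 0ℚ < ε → Eventually λ i → ∣ s n (seq x i) - s n (seq y i) ∣ ≤ ε
  s-cong {x} {y} h n ε hε = eventually-map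
    (λ i → subst₂ (λ p q → ∣ p - q ∣ ≤ ε) (seq-S n x i) (seq-S n y i)) (S-cong {x} {y} h n ε hε)

  positivePart≈ : ∀ {x} → [0,∞[ x → x ≈ x ∨ fromℕ 0
  positivePart≈ {x} h ε hε = eventually-map
    (λ i 0≤ → ≤⇒dist {seq x i} {seq x i ⊔ 0ℚ}
      (ℚP.≤-trans (ℚP.p≤p⊔q (seq x i) 0ℚ) (≤+nonNeg (ℚP.<⇒≤ hε)))
      (ℚP.⊔-lub (≤+nonNeg {seq x i} (ℚP.<⇒≤ hε)) 0≤))
    (h ε hε)

  -- The difference is (b - a)/(ab). The bounds differ because S_d is at least 1 at the positive
  -- part, but at the entries of x itself only up to an error, taken as ½.
  recip-lipschitz : ∀ {a b e} → ½ ≤ a → 1ℚ ≤ b → ∣ a - b ∣ ≤ e → ∣ recip a - recip b ∣ ≤ e * 2ℚ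
  recip-lipschitz {a} {b} {e} ½≤a 1≤b h = begin
    ∣ ra - rb ∣
      ≡⟨ cong₂ (λ u v → ∣ u - v ∣) (sym (trans (cong (ra *_) brb) (ℚP.*-identityʳ ra)))
           (sym (trans (cong (rb *_) ara) (ℚP.*-identityʳ rb))) ⟩
    ∣ ra * (b * rb) - rb * (a * ra) ∣
      ≡⟨ cong ∣_∣ (solve 4 (λ a b r t → r :* (b :* t) :- t :* (a :* r) := (b :- a) :* (r :* t)) refl a b ra rb) ⟩
    ∣ (b - a) * (ra * rb) ∣
      ≡⟨ trans (ℚP.∣p*q∣≡∣p∣*∣q∣ (b - a) (ra * rb))
           (cong₂ _*_ (∣-∣-swap b a) (ℚP.0≤p⇒∣p∣≡p (*-nonNeg 0≤ra 0≤rb))) ⟩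
    ∣ a - b ∣ * (ra * rb)
      ≤⟨ *-mono (ℚP.0≤∣p∣ (a - b)) (+-nonNeg 0≤1 0≤1) h (*-mono {ra} {2ℚ} 0≤ra 0≤1
           (recip≤ {a} {½} {2ℚ} 0<a (+-nonNeg 0≤1 0≤1) ℚP.≤-refl ½≤a)
           (recip≤ {b} {1ℚ} {1ℚ} 0<b 0≤1 ℚP.≤-refl 1≤b)) ⟩
    e * 2ℚ ∎
    where
    ra rb : ℚ
    ra = recip a
    rb = recip b
    0<a : 0ℚ < a
    0<a = ℚP.<-≤-trans 0<½ ½≤a
    0<b : 0ℚ < b
    0<b = ℚP.<-≤-trans 0<1 1≤b
    ara : a * ra ≡ 1ℚ
    ara = recip-inverse a (pos≢0 0<a)
    brb : b * rb ≡ 1ℚ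
    brb = recip-inverse b (pos≢0 0<b)
    0≤ra : 0ℚ ≤ ra
    0≤ra = ℚP.<⇒≤ (recip-pos 0<a)
    0≤rb : 0ℚ ≤ rb
    0≤rb = ℚP.<⇒≤ (recip-pos 0<b)

  1/s-approximates-exp : ∀ d x → [0,∞[ x → ∀ ε → 0ℚ < ε → Eventually λ i →
    (recip (s d (seq x i)) ≤ seq (exp (⊖ x)) i + ½ ^ d + ε) × (seq (exp (⊖ x)) i ≤ recip (s d (seq x i)) + ε)
  1/s-approximates-exp d x 0≤x ε hε = eventually-map
    (λ i (gap , expNear , sNear , dNear , ½≤) →
      estimate (seq x i) (seq x i ⊔ 0ℚ) (seq (exp (⊖ x)) i) (ℚP.p≤q⊔p (seq x i) 0ℚ) gap expNear sNear dNear ½≤)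
    (both (proj₁ (proj₂ near m m≥N)) (both (proj₂ (proj₂ near n n≥N))
      (both (s-cong {⊖ x} {⊖ z} (⊖-cong {x} {z} x≈z) n η (half (half hε)))
        -- The factor ½ offsets the Lipschitz constant 2 of the reciprocal.
        (both (s-cong {x} {z} x≈z d (η * ½) (half (half (half hε)))) ½≤S))))
    where
    η : ℚ
    -- A quarter for each of four errors: the product defect, S_n(-x) against exp (-x), S_n(-x)
    -- against its value at the positive part, and 1/S_d likewise.
    η = ε * ½ * ½
    z : ℝ
    z = x ∨ fromℕ 0
    x≈z : x ≈ z
    x≈z = positivePart≈ {x} 0≤x
    near : Eventually λ n →
      Eventually (λ i → ∣ s (n ℕ.+ n) (seq z i) * s (n ℕ.+ n) (- seq z i) - 1ℚ ∣ ≤ η) ×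
      Eventually (λ i → ∣ s n (- seq x i) - seq (exp (⊖ x)) i ∣ ≤ η)
    near = both (square-gap-small z (λ i → ℚP.p≤q⊔p (seq x i) 0ℚ) η (half (half hε)))
                (exp-approx (⊖ x) η (half (half hε)))
    N m n : ℕ
    N = proj₁ near
    -- With m ≥ d, S_d is an initial part of S_n; n = 2m is the even index of the square gap.
    m = N ℕ.⊔ d
    n = m ℕ.+ m
    m≥N : N ℕ.≤ m
    m≥N = ℕP.m≤m⊔n N d
    n≥N : N ℕ.≤ n
    n≥N = ℕP.≤-trans m≥N (ℕP.m≤m+n m m)
    n≡ : n ℕ.∸ d ℕ.+ d ≡ n
    n≡ = ℕP.m∸n+n≡m (ℕP.≤-trans (ℕP.m≤n⊔m N d) (ℕP.m≤m+n m m))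
    ½≤S : Eventually λ i → ½ ≤ s d (seq x i)
    ½≤S = eventually-map
      (λ i h → ≤-by (diff-nonNeg h) (trans (cong (λ t → t + ½ - 1ℚ) (seq-S d x i))
        (solve 1 (λ t → t :+ con ½ :- con 1ℚ := t :- con ½) refl (s d (seq x i)))))
      (Defs.1≤S d x 0≤x ½ 0<½)
    η+η+η+η : (η + η) + (η + η) ≡ ε
    η+η+η+η = trans (cong₂ _+_ (half+half (ε * ½)) (half+half (ε * ½))) (half+half ε)
    estimate : ∀ q q⁺ e → 0ℚ ≤ q⁺ → ∣ s n q⁺ * s n (- q⁺) - 1ℚ ∣ ≤ η → ∣ s n (- q) - e ∣ ≤ η →
      ∣ s n (- q) - s n (- q⁺) ∣ ≤ η → ∣ s d q - s d q⁺ ∣ ≤ η * ½ → ½ ≤ s d q →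
      (recip (s d q) ≤ e + ½ ^ d + ε) × (e ≤ recip (s d q) + ε)
    estimate q q⁺ e 0≤q⁺ gap expNear sNear dNear ½≤ =
      (begin
        r               ≤⟨ dist⇒≤ {r} {r⁺} rNear ⟩
        r⁺ + η          ≤⟨ ℚP.+-monoˡ-≤ η (inverse-lower {B = b⁺} 1≤sd sd≤sn gap
                             (^-nonNeg (ℚP.<⇒≤ 0<½) d) (½^*2^ d) tail) ⟩
        b⁺ + h + η + η  ≤⟨ ℚP.+-monoˡ-≤ η (ℚP.+-monoˡ-≤ η (ℚP.+-monoˡ-≤ h
                             (ℚP.≤-trans (dist⇒≥ {b} {b⁺} sNear) (ℚP.+-monoˡ-≤ η (dist⇒≤ {b} {e} expNear))))) ⟩
        e + η + η + h + η + η
                        ≡⟨ solve 3 (λ e t h → e :+ t :+ t :+ h :+ t :+ t := e :+ h :+ ((t :+ t) :+ (t :+ t)))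
                             refl e η h ⟩
        e + h + ((η + η) + (η + η)) ≡⟨ cong (e + h +_) η+η+η+η ⟩
        e + h + ε       ∎) ,
      (begin
        e               ≤⟨ dist⇒≥ {b} {e} expNear ⟩
        b + η           ≤⟨ ℚP.+-monoˡ-≤ η (dist⇒≤ {b} {b⁺} sNear) ⟩
        b⁺ + η + η      ≤⟨ ℚP.+-monoˡ-≤ η (ℚP.+-monoˡ-≤ η (ℚP.≤-trans (inverse-upper {B = b⁺} 1≤sd sd≤sn gap)
                             (ℚP.+-monoˡ-≤ η (dist⇒≥ {r} {r⁺} rNear)))) ⟩
        r + η + η + η + η
                        ≡⟨ solve 2 (λ r t → r :+ t :+ t :+ t :+ t := r :+ ((t :+ t) :+ (t :+ t))) refl r η ⟩
        r + ((η + η) + (η + η)) ≡⟨ cong (r +_) η+η+η+η ⟩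
        r + ε           ∎)
      where
      r r⁺ b b⁺ h : ℚ
      r  = recip (s d q)
      r⁺ = recip (s d q⁺)
      b  = s n (- q)
      b⁺ = s n (- q⁺)
      h  = ½ ^ d
      1≤sd : 1ℚ ≤ s d q⁺
      1≤sd = 1≤s d 0≤q⁺
      sd≤sn : s d q⁺ ≤ s n q⁺
      sd≤sn = subst (λ k → s d q⁺ ≤ s k q⁺) n≡ (sum-extend (n ℕ.∸ d) d (P-nonNeg 0≤q⁺))
      tail : 2ℚ ^ d * (s n q⁺ - s d q⁺) ≤ s d q⁺ * s n q⁺
      tail = subst (λ k → 2ℚ ^ d * (s k q⁺ - s d q⁺) ≤ s d q⁺ * s k q⁺) n≡ (2^*tail≤s*s 0≤q⁺ (n ℕ.∸ d) d)
      rNear : ∣ r - r⁺ ∣ ≤ η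
      rNear = subst (∣ r - r⁺ ∣ ≤_) (solve 1 (λ t → t :* con ½ :* (con 1ℚ :+ con 1ℚ) := t) refl η)
        (recip-lipschitz ½≤ 1≤sd dNear)

  -- The real y is kept apart from t, with equality only entrywise, because the exponent arises as
  -- (-a) * log 2 and not as -(a * log 2).
  ½^≤exp : ∀ d t y → (∀ i → seq y i ≡ - seq t i) → (∀ i → 0ℚ ≤ seq t i) → (∀ i → seq t i ≤ ι d * ½) →
    fromℚ (½ ^ d) ≤ᴿ exp y
  ½^≤exp d t y y≡ 0≤t t≤ ε hε = eventually-map
    (λ i (gap , expNear) → estimate (seq t i) (seq y i) (seq (exp y) i) (y≡ i) (0≤t i) (t≤ i) gap expNear)
    (both (proj₁ (proj₂ near N ℕP.≤-refl)) (proj₂ (proj₂ near n (ℕP.m≤m+n N N))))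
    where
    near : Eventually λ n →
      Eventually (λ i → ∣ s (n ℕ.+ n) (seq t i) * s (n ℕ.+ n) (- seq t i) - 1ℚ ∣ ≤ ε * ½) ×
      Eventually (λ i → ∣ s n (seq y i) - seq (exp y) i ∣ ≤ ε * ½)
    near = both (square-gap-small t 0≤t (ε * ½) (half hε)) (exp-approx y (ε * ½) (half hε))
    N n : ℕ
    N = proj₁ near
    n = N ℕ.+ N
    estimate : ∀ q p e → p ≡ - q → 0ℚ ≤ q → q ≤ ι d * ½ →
      ∣ s n q * s n (- q) - 1ℚ ∣ ≤ ε * ½ → ∣ s n p - e ∣ ≤ ε * ½ → ½ ^ d ≤ e + ε
    estimate q p e refl 0≤q q≤ gap expNear = begin
      ½ ^ d
        ≤⟨ ½^≤ d (1≤s n 0≤q) (ℚP.≤-trans (s-mono n 0≤q q≤) (s-halves n d)) gap ⟩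
      s n (- q) + ε * ½
        ≤⟨ ℚP.+-monoˡ-≤ (ε * ½) (dist⇒≤ {s n (- q)} {e} expNear) ⟩
      e + ε * ½ + ε * ½
        ≡⟨ trans (ℚP.+-assoc e (ε * ½) (ε * ½)) (cong (e +_) (half+half ε)) ⟩
      e + ε ∎

  -- Bounds for the logarithm

  seq-logPartial : ∀ n {z q i} → seq z i ≡ q → seq (Σ≤ n (logTerm z)) i ≡ ℓ n q
  seq-logPartial n {z} {i = i} refl =
    seq-Σ n λ k → cong (_* oddRecip k) (seq-^ z (suc (2 ℕ.* k)) i)

  -- The i-th entry of a limit is an entry of the i-th partial sum. The sequence of `fromℕ 2` is
  -- constant, so this entry is `ℓ i ⅓`, and the bounds hold at every index without an ε.
  log2-bounds : ∀ i → 0ℚ ≤ seq (log (fromℕ 2) 0<2) i × seq (log (fromℕ 2) 0<2) i ≤ 1ℚ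
  log2-bounds i = bounds (seq-logPartial i {logArg (fromℕ 2) 0<2} refl)
    where
    bounds : ∀ {p} → p ≡ ℓ i ⅓ → 0ℚ ≤ p × p ≤ 1ℚ
    bounds refl = sum-nonNeg i (logTermℚ-nonNeg 0≤⅓) ,
      ℚP.≤-trans (≤+nonNeg (^-nonNeg 0≤⅓ (suc i))) (ℓ⅓-upper i)

  ½^≤2^ : ∀ d → fromℚ (½ ^ d) ≤ᴿ (2^ (⊖ (fromℚ ½ ⊗ fromℕ d)))
  ½^≤2^ d = ½^≤exp d (fromℚ ½ ⊗ fromℕ d ⊗ L) (⊖ (fromℚ ½ ⊗ fromℕ d) ⊗ L)
    (λ i → solve 2 (λ a l → (:- a) :* l := :- (a :* l)) refl (½ * ι d) (seq L i))
    (λ i → *-nonNeg 0≤d/2 (proj₁ (log2-bounds i)))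
    (λ i → ℚP.≤-trans (*-monoˡ (½ * ι d) 0≤d/2 (proj₂ (log2-bounds i)))
      (ℚP.≤-reflexive (trans (ℚP.*-identityʳ (½ * ι d)) (ℚP.*-comm ½ (ι d)))))
    where
    L : ℝ
    L = log (fromℕ 2) 0<2
    0≤d/2 : 0ℚ ≤ ½ * ι d
    0≤d/2 = *-nonNeg (ℚP.<⇒≤ 0<½) (ι-nonNeg d)

  log-lower : ∀ y (y>0 : fromℕ 0 <ᴿ y) c N →
    (Eventually λ i → ∀ n → N ℕ.≤ n → c ≤ ℓ n (seq (logArg y y>0) i)) → fromℚ c ≤ᴿ log y y>0
  log-lower y y>0 c N h ε hε = eventually-map
    (λ i (near , low) → ℚP.≤-trans (low n (ℕP.m≤n⊔m (proj₁ approx) N))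
      (dist⇒≤ {ℓ n (seq (logArg y y>0) i)} {seq (log y y>0) i}
        (subst (λ t → ∣ t - seq (log y y>0) i ∣ ≤ ε) (seq-logPartial n {logArg y y>0} refl) near)))
    (both (proj₂ approx n (ℕP.m≤m⊔n (proj₁ approx) N)) h)
    where
    approx : Eventually λ n → Eventually λ i → ∣ seq (Σ≤ n (logTerm (logArg y y>0))) i - seq (log y y>0) i ∣ ≤ ε
    approx = lim-approx (λ n → Σ≤ n (logTerm (logArg y y>0))) (Defs.log-cauchy y y>0) ε hε
    n : ℕ
    n = proj₁ approx ℕ.⊔ N

  log-const : ∀ y (y>0 : fromℕ 0 <ᴿ y) → (Eventually λ i → ℤ.+ 4 / 3 ≤ seq y i) →
    fromℚ (ℤ.+ 2 / 7) ≤ᴿ log y y>0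
  log-const y y>0 h = log-lower y y>0 (ℤ.+ 2 / 7) 0 (eventually-map
    (λ i 4/3≤ n _ → ℓ-const (ℚP.≤-trans (ℚP.≤ᵇ⇒≤ _) 4/3≤) 4/3≤ n) h)

  log-large : ∀ y (y>0 : fromℕ 0 <ᴿ y) j → (Eventually λ i → 2ℚ ^ (3 ℕ.+ j) ≤ seq y i) →
    fromℚ (ι j * ½ * ½) ≤ᴿ log y y>0
  log-large y y>0 j h = log-lower y y>0 (ι j * ½ * ½) (2^j-1 j) (eventually-map
    (λ i large → ℓ-large (ℚP.≤-trans (1≤2^ (3 ℕ.+ j)) large) j large) h)

  -- Choice of the degree

  record SmallScale (δ : ℝ) : Set where
    field
      exponent : ℕ
      -- Keeps log(1/δ) away from 0, so that it can absorb an additive constant in the degree.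
      ≤¾       : Eventually λ i → seq δ i ≤ ℤ.+ 3 / 4
      lower    : Eventually λ i → ½ ^ exponent ≤ seq δ i
      upper    : Eventually λ i → seq δ i * 2ℚ ^ exponent ≤ 2ℚ ^ 3

  -- The degree bound C log(1/δ) tends to 0 as δ → 1, so the constant ½ must serve all δ near 1; the two
  -- cases overlap on [½, ¾], which makes the choice between them constructive.
  scale : ∀ δ → fromℕ 0 <ᴿ δ → (Eventually λ i → ½ ≤ seq δ i) ⊎ SmallScale δ
  scale δ (ε , 0<ε , N , ε≤) = [ inj₂ ∘ small , inj₁ ∘ large ]′ (ℚP.≤-total q (ℤ.+ 5 / 8))
    where
    t : ℚ
    -- The decision is made on a rational q within t of all later entries, with threshold 5/8; an
    -- error of 1/8 stays within [½, ¾], and ε/2 ≤ q/2 keeps the entries comparable to q.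
    t = (ε * ½) ℚ.⊓ (ℤ.+ 1 / 8)
    0<t : 0ℚ < t
    0<t = [ (λ eq → subst (0ℚ <_) (sym eq) (half 0<ε)) , (λ eq → subst (0ℚ <_) (sym eq) (ℚP.positive⁻¹ (ℤ.+ 1 / 8))) ]′
      (ℚP.⊓-sel (ε * ½) (ℤ.+ 1 / 8))
    modulus : ∃ λ M → ∀ m n → M ℕ.≤ m → M ℕ.≤ n → ∣ seq δ m - seq δ n ∣ ≤ t
    modulus = cauchy δ t 0<t
    M : ℕ
    M = proj₁ modulus ℕ.⊔ N
    q : ℚ
    q = seq δ M
    near : ∀ i → M ℕ.≤ i → ∣ seq δ i - q ∣ ≤ t
    near i hi = proj₂ modulus i M (ℕP.≤-trans (ℕP.m≤m⊔n (proj₁ modulus) N) hi) (ℕP.m≤m⊔n (proj₁ modulus) N)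
    ε≤q : ε ≤ q
    ε≤q = subst (_≤ q) (ℚP.+-identityˡ ε) (ε≤ M (ℕP.m≤n⊔m (proj₁ modulus) N))
    t≤q/2 : t ≤ q * ½
    t≤q/2 = ℚP.≤-trans (ℚP.p⊓q≤p (ε * ½) (ℤ.+ 1 / 8)) (*-monoʳ ½ (ℚP.<⇒≤ 0<½) ε≤q)
    t≤1/8 : t ≤ ℤ.+ 1 / 8
    t≤1/8 = ℚP.p⊓q≤q (ε * ½) (ℤ.+ 1 / 8)
    above : ∀ {e} → t ≤ e → ∀ i → M ℕ.≤ i → seq δ i ≤ q + e
    above t≤e i hi = dist⇒≤ {seq δ i} {q} (ℚP.≤-trans (near i hi) t≤e)
    below : ∀ {e} → t ≤ e → ∀ i → M ℕ.≤ i → q ≤ seq δ i + e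
    below t≤e i hi = dist⇒≥ {seq δ i} {q} (ℚP.≤-trans (near i hi) t≤e)
    large : ℤ.+ 5 / 8 ≤ q → Eventually λ i → ½ ≤ seq δ i
    large h = M , λ i hi → ≤-by (diff-nonNeg (ℚP.≤-trans h (below t≤1/8 i hi)))
      (solve 1 (λ d → d :+ con (ℤ.+ 1 / 8) :- con (ℤ.+ 5 / 8) := d :- con ½) refl (seq δ i))
    small : q ≤ ℤ.+ 5 / 8 → SmallScale δ
    small h = record
      { exponent = d
      ; ≤¾       = M , λ i hi → ℚP.≤-trans (above t≤1/8 i hi) (ℚP.+-monoˡ-≤ (ℤ.+ 1 / 8) h)
      ; lower    = M , λ i hi → ℚP.≤-trans ½^d≤ (≤-by (diff-nonNeg (below t≤q/2 i hi))
          (solve 2 (λ x q → x :+ q :* con ½ :- q := x :- q :* con ½) refl (seq δ i) q))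
      -- Here δ ≤ 3q/2 ≤ 4 · (q/2), and (q/2) · 2^d ≤ 2 by the choice of d, which gives 8.
      ; upper    = M , λ i hi → begin
          seq δ i * D
            ≤⟨ *-monoʳ D 0≤D (ℚP.≤-trans (above t≤q/2 i hi)
                 (≤+nonNeg {q + q * ½} {q * ½} (ℚP.<⇒≤ 0<q/2))) ⟩
          (q + q * ½ + q * ½) * D
            ≡⟨ solve 2 (λ q D → (q :+ q :* con ½ :+ q :* con ½) :* D := con (2ℚ ^ 2) :* (q :* con ½ :* D)) refl q D ⟩
          2ℚ ^ 2 * (q * ½ * D)
            ≤⟨ *-monoˡ (2ℚ ^ 2) (ℚP.≤ᵇ⇒≤ _) (proj₂ (proj₂ dy)) ⟩
          2ℚ ^ 3 ∎
      }
      where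
      0<q/2 : 0ℚ < q * ½
      0<q/2 = half (ℚP.<-≤-trans 0<ε ε≤q)
      dy : ∃ λ d → 1ℚ ≤ q * ½ * 2ℚ ^ d × q * ½ * 2ℚ ^ d ≤ 2ℚ
      dy = dyadic 0<q/2 (ℚP.≤-trans (*-monoʳ ½ (ℚP.<⇒≤ 0<½) h) (ℚP.≤ᵇ⇒≤ _))
      d : ℕ
      d = proj₁ dy
      D : ℚ
      D = 2ℚ ^ d
      0≤D : 0ℚ ≤ D
      0≤D = ^-nonNeg {2ℚ} (+-nonNeg 0≤1 0≤1) d
      ½^d≤ : ½ ^ d ≤ q * ½
      ½^d≤ = begin
        ½ ^ d               ≡⟨ sym (ℚP.*-identityʳ (½ ^ d)) ⟩
        ½ ^ d * 1ℚ          ≤⟨ *-monoˡ (½ ^ d) (^-nonNeg (ℚP.<⇒≤ 0<½) d) (proj₁ (proj₂ dy)) ⟩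
        ½ ^ d * (q * ½ * D) ≡⟨ solve 3 (λ h q D → h :* (q :* con ½ :* D) := q :* con ½ :* (h :* D)) refl (½ ^ d) q D ⟩
        q * ½ * (½ ^ d * D) ≡⟨ trans (cong (q * ½ *_) (½^*2^ d)) (ℚP.*-identityʳ (q * ½)) ⟩
        q * ½               ∎

  module _ (δ : ℝ) (δ>0 : fromℕ 0 <ᴿ δ) where

    log1/ : ℝ
    log1/ = log (Defs.1/ δ [ δ>0 ]) (Defs.1/-pos δ δ>0)

    positive : Eventually λ i → 0ℚ < seq δ i
    positive = proj₁ (proj₂ (proj₂ δ>0)) , λ i hi →
      ℚP.<-≤-trans (proj₁ (proj₂ δ>0))
        (subst (_≤ seq δ i) (ℚP.+-identityˡ (proj₁ δ>0)) (proj₂ (proj₂ (proj₂ δ>0)) i hi))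

    -- Here d ≤ 6 + j. The bound log(1/δ) ≥ 2/7 pays for 6 = 21 · 2/7 and log(1/δ) ≥ j/4 pays for j,
    -- so 25 = 21 + 4; accordingly each bound is used with error η/25.
    exponent-bound : (σ : SmallScale δ) →
      fromℕ (SmallScale.exponent σ) ≤ᴿ fromℕ 25 ⊗ (log1/ ∨ fromℕ 0)
    exponent-bound σ η 0<η = eventually-map
      (λ i (const , linear) → combine (seq log1/ i) (seq log1/ i ⊔ 0ℚ) (ℚP.p≤p⊔q (seq log1/ i) 0ℚ) const linear)
      (both (log-const y y>0 4/3≤y ε 0<ε) (log-j ε 0<ε))
      where
      open SmallScale σ renaming (exponent to d)
      y : ℝ
      y = Defs.1/ δ [ δ>0 ]
      y>0 : fromℕ 0 <ᴿ y
      y>0 = Defs.1/-pos δ δ>0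
      ε : ℚ
      ε = η * (ℤ.+ 1 / 25)
      0<ε : 0ℚ < ε
      0<ε = *-pos 0<η (ℚP.positive⁻¹ (ℤ.+ 1 / 25))
      j : ℕ
      -- From δ · 2^d ≤ 2^3 one gets 1/δ ≥ 2^(d-3), and `log-large` asks for 2^(3+j). For d ≤ 6 the
      -- subtraction yields j = 0, and the constant bound takes over.
      j = d ℕ.∸ 6
      4/3≤y : Eventually λ i → ℤ.+ 4 / 3 ≤ seq y i
      4/3≤y = eventually-map (λ i (0<δ , δ≤) → inverse-of-bound 0<δ δ≤) (both positive ≤¾)
      below-recip : ∀ p q → 0ℚ < q → q * p ≤ 1ℚ → p ≤ recip q
      below-recip p q 0<q h = *-cancel q 0<q (subst (q * p ≤_) (sym (recip-inverse q (pos≢0 0<q))) h)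
      log-j : fromℚ (ι j * ½ * ½) ≤ᴿ log1/
      log-j = [
        (λ d≤6 → subst (λ k → fromℚ (ι k * ½ * ½) ≤ᴿ log1/) (sym (ℕP.m≤n⇒m∸n≡0 d≤6))
          λ ε hε → eventually-map (λ i → ℚP.≤-trans (ℚP.≤ᵇ⇒≤ _)) (log-const y y>0 4/3≤y ε hε)) ,
        (λ 6≤d → log-large y y>0 j (eventually-map
          (λ i (0<δ , δ≤) → below-recip (2ℚ ^ (3 ℕ.+ j)) (seq δ i) 0<δ
            (scaled (seq δ i) (subst (λ k → seq δ i * 2ℚ ^ k ≤ 2ℚ ^ 3) (sym (ℕP.m+[n∸m]≡n 6≤d)) δ≤)))
          (both positive upper))) ]′
        (ℕP.≤-total d 6)
        where
        scaled : ∀ q → q * 2ℚ ^ (6 ℕ.+ j) ≤ 2ℚ ^ 3 → q * 2ℚ ^ (3 ℕ.+ j) ≤ 1ℚ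
        scaled q h = *-cancel (2ℚ ^ 3) (ℚP.positive⁻¹ (2ℚ ^ 3)) (subst₂ _≤_
          (solve 2 (λ q t → q :* (two :* (two :* (two :* (two :* (two :* (two :* t)))))) :=
            con (2ℚ ^ 3) :* (q :* (two :* (two :* (two :* t))))) refl q (2ℚ ^ j))
          (sym (ℚP.*-identityʳ (2ℚ ^ 3))) h)
          where
          two = con 1ℚ :+ con 1ℚ
      combine : ∀ l l⁺ → l ≤ l⁺ → ℤ.+ 2 / 7 ≤ l + ε → ι j * ½ * ½ ≤ l + ε → ι d ≤ ι 25 * l⁺ + η
      combine l l⁺ l≤ const linear = begin
        ι d
          ≤⟨ fromℕ-mono {d} {6 ℕ.+ j} (ℕP.m≤n+m∸n d 6) ⟩
        ι (6 ℕ.+ j)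
          ≡⟨ sym (ι-+ 6 j) ⟩
        ι 6 + ι j
          ≡⟨ solve 1 (λ j → con (ι 6) :+ j := con (ι 21) :* con (ℤ.+ 2 / 7) :+ con (ι 4) :* (j :* con ½ :* con ½))
               refl (ι j) ⟩
        ι 21 * (ℤ.+ 2 / 7) + ι 4 * (ι j * ½ * ½)
          ≤⟨ ℚP.+-mono-≤ (*-monoˡ (ι 21) (ι-nonNeg 21) const) (*-monoˡ (ι 4) (ι-nonNeg 4) linear) ⟩
        ι 21 * (l + ε) + ι 4 * (l + ε)
          ≡⟨ solve 2 (λ l e → con (ι 21) :* (l :+ e :* con (ℤ.+ 1 / 25)) :+ con (ι 4) :* (l :+ e :* con (ℤ.+ 1 / 25)) :=
               con (ι 25) :* l :+ e) refl l η ⟩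
        ι 25 * l + η
          ≤⟨ ℚP.+-monoˡ-≤ η (*-monoˡ (ι 25) (ι-nonNeg 25) l≤) ⟩
        ι 25 * l⁺ + η ∎

  1/s-dist : ∀ d x → [0,∞[ x → ∀ D → fromℚ (½ ^ d) ≤ᴿ D → ∀ ε → 0ℚ < ε →
    Eventually λ i → ∣ recip (s d (seq x i)) - seq (exp (⊖ x)) i ∣ ≤ seq D i + ε
  1/s-dist d x 0≤x D h ε hε = eventually-map
    (λ i (h≤ , lo , hi) → estimate (recip (s d (seq x i))) (seq (exp (⊖ x)) i) (seq D i) h≤ lo hi)
    (both (h (ε * ½) (half hε)) (1/s-approximates-exp d x 0≤x (ε * ½) (half hε)))
    where
    estimate : ∀ r e D → ½ ^ d ≤ D + ε * ½ → r ≤ e + ½ ^ d + ε * ½ → e ≤ r + ε * ½ → ∣ r - e ∣ ≤ D + ε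
    estimate r e D h≤ lo hi = ≤⇒dist
      (begin
        r                            ≤⟨ lo ⟩
        e + ½ ^ d + ε * ½            ≤⟨ ℚP.+-monoˡ-≤ (ε * ½) (ℚP.+-monoʳ-≤ e h≤) ⟩
        e + (D + ε * ½) + ε * ½      ≡⟨ solve 3 (λ e D t → e :+ (D :+ t) :+ t := e :+ (D :+ (t :+ t)))
                                          refl e D (ε * ½) ⟩
        e + (D + (ε * ½ + ε * ½))    ≡⟨ cong (λ t → e + (D + t)) (half+half ε) ⟩
        e + (D + ε)                  ∎)
      (begin
        e                            ≤⟨ hi ⟩
        r + ε * ½                    ≡⟨ solve 2 (λ r t → r :+ t := r :+ (con 0ℚ :+ t)) refl r (ε * ½) ⟩
        r + (0ℚ + ε * ½)             ≤⟨ ℚP.+-monoʳ-≤ r (ℚP.+-monoˡ-≤ (ε * ½)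
                                          (ℚP.≤-trans (^-nonNeg (ℚP.<⇒≤ 0<½) d) h≤)) ⟩
        r + (D + ε * ½ + ε * ½)      ≡⟨ cong (r +_) (ℚP.+-assoc D (ε * ½) (ε * ½)) ⟩
        r + (D + (ε * ½ + ε * ½))    ≡⟨ cong (λ t → r + (D + t)) (half+half ε) ⟩
        r + (D + ε)                  ∎)

  ½-dist : ∀ x → [0,∞[ x → ∀ D → (Eventually λ i → ½ ≤ seq D i) →
    ∀ ε → 0ℚ < ε → Eventually λ i → ∣ seq (exp (⊖ x)) i - ½ ∣ ≤ seq D i + ε
  ½-dist x 0≤x D h ε hε = eventually-map
    (λ i (½≤ , lo , hi) → estimate (seq (exp (⊖ x)) i) (seq D i) ½≤ lo hi)
    (both h (1/s-approximates-exp 0 x 0≤x ε hε))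
    where
    estimate : ∀ e D → ½ ≤ D → 1ℚ ≤ e + 1ℚ + ε → e ≤ 1ℚ + ε → ∣ e - ½ ∣ ≤ D + ε
    estimate e D ½≤ lo hi = ≤⇒dist
      (begin
        e               ≤⟨ hi ⟩
        1ℚ + ε          ≡⟨ ℚP.+-assoc ½ ½ ε ⟩
        ½ + (½ + ε)     ≤⟨ ℚP.+-monoʳ-≤ ½ (ℚP.+-monoˡ-≤ ε ½≤) ⟩
        ½ + (D + ε)     ∎)
      (begin
        ½               ≤⟨ ≤-by (diff-nonNeg lo)
                             (solve 2 (λ e t → e :+ con 1ℚ :+ t :- con 1ℚ := e :+ (con ½ :+ t) :- con ½) refl e ε) ⟩
        e + (½ + ε)     ≤⟨ ℚP.+-monoʳ-≤ e (ℚP.+-monoˡ-≤ ε ½≤) ⟩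
        e + (D + ε)     ∎)

  -- The approximating rational functions

  constant : ℚ → Defs.Polynomial
  constant c = record { degree = 0 ; coeff = λ _ → fromℚ c ; leading = inj₁ refl }

  taylor : ℕ → Defs.Polynomial
  taylor d = record
    { degree  = d
    ; coeff   = λ k → fromℚ (1/ k !)
    ; leading = inj₂ (inj₂ (1/ d ! , Defs.1/!-pos d , 0 , λ _ _ → ℚP.≤-reflexive (ℚP.+-identityˡ (1/ d !))))
    }

  seq-taylor : ∀ d x i → seq (Defs.Polynomial.eval (taylor d) x) i ≡ s d (seq x i)
  seq-taylor d x i = seq-Σ d λ k →
    trans (ℚP.*-comm (1/ k !) (seq (x ⊙ k) i)) (cong (_* (1/ k !)) (seq-^ x k i))

  constantFunction : ℚ → Defs.RationalFunction [0,∞[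
  constantFunction c = record
    { num = constant c ; den = constant 1ℚ ; den#0 = λ _ _ → inj₂ (1ℚ , 0<1 , 0 , λ _ _ → ℚP.≤-refl) }

  1/taylor : ℕ → Defs.RationalFunction [0,∞[
  1/taylor d = record
    { num   = constant 1ℚ
    ; den   = taylor d
    ; den#0 = λ x 0≤x → inj₂ (positive-taylor x (Defs.0<S d x 0≤x))
    }
    where
    positive-taylor : ∀ x → fromℕ 0 <ᴿ S d x → fromℕ 0 <ᴿ Defs.Polynomial.eval (taylor d) x
    positive-taylor x (ε , 0<ε , N , h) = ε , 0<ε , N , λ i hi →
      subst (0ℚ + ε ≤_) (trans (seq-S d x i) (sym (seq-taylor d x i))) (h i hi)

  constantFunction-approximates : ∀ δ → (Eventually λ i → ½ ≤ seq δ i) →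
    Defs.IsApproximation δ [0,∞[ (λ x _ → exp (⊖ x)) (Defs.RationalFunction.eval (constantFunction ½))
  constantFunction-approximates δ h x 0≤x = ½-dist x 0≤x δ h

  1/taylor-approximates : ∀ δ d → (Eventually λ i → ½ ^ d ≤ seq δ i) →
    Defs.IsApproximation δ [0,∞[ (λ x _ → exp (⊖ x)) (Defs.RationalFunction.eval (1/taylor d))
  1/taylor-approximates δ d h x 0≤x ε hε = eventually-map
    (λ i → subst (_≤ seq δ i + ε) (trans (∣-∣-swap (recip (s d (seq x i))) (seq (exp (⊖ x)) i))
      (cong (λ t → ∣ seq (exp (⊖ x)) i - t ∣)
        (trans (cong recip (sym (seq-taylor d x i))) (sym (ℚP.*-identityˡ _))))))
    (1/s-dist d x 0≤x δ (λ η 0<η → eventually-map (λ i h≤ → ℚP.≤-trans h≤ (≤+nonNeg (ℚP.<⇒≤ 0<η))) h) ε hε)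

  1/S-approximates : ∀ d → Defs.sup≤ [0,∞[
    (λ x x≥0 → Defs.∣ Defs.1/ S d x [ Defs.0<S d x x≥0 ] Defs.- exp (⊖ x) ∣) (2^ (⊖ (fromℚ ½ ⊗ fromℕ d)))
  1/S-approximates d x 0≤x ε hε = eventually-map
    (λ i → subst (λ t → ∣ recip t - seq (exp (⊖ x)) i ∣ ≤ seq (2^ (⊖ (fromℚ ½ ⊗ fromℕ d))) i + ε) (sym (seq-S d x i)))
    (1/s-dist d x 0≤x (2^ (⊖ (fromℚ ½ ⊗ fromℕ d))) (½^≤2^ d) ε hε)

  approximation : ∀ δ (δ>0 : fromℕ 0 <ᴿ δ) → Σ (Defs.RationalFunction [0,∞[) λ r →
    (fromℕ (Defs.RationalFunction.degree r) ≤ᴿ fromℕ 25 ⊗ (log1/ δ δ>0 ∨ fromℕ 0)) ×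
    Defs.IsApproximation δ [0,∞[ (λ x _ → exp (⊖ x)) (Defs.RationalFunction.eval r)
  approximation δ δ>0 = [
    (λ ½≤ → constantFunction ½ ,
      -- The degree is 0, and the maximum with 0 keeps the bound nonnegative even when δ > 1 makes
      -- log(1/δ) negative.
      (λ ε hε → 0 , λ i _ → ℚP.≤-trans
        (*-nonNeg (ι-nonNeg 25) (ℚP.p≤q⊔p (seq (log1/ δ δ>0) i) 0ℚ)) (≤+nonNeg (ℚP.<⇒≤ hε))) ,
      constantFunction-approximates δ ½≤) ,
    (λ σ → 1/taylor (SmallScale.exponent σ) , exponent-bound δ δ>0 σ ,
      1/taylor-approximates δ (SmallScale.exponent σ) (SmallScale.lower σ)) ]′
    (scale δ δ>0)

open RealEstimates using (1/S-approximates; approximation)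
open import Defs

theorem4p1 : (∃ λ (c : ℝ) → fromℕ 0 < c ×
    ((d : ℕ) →
    sup≤ [0,∞[ (λ x x≥0 → ∣ 1/ S d x [ 0<S d x x≥0 ] - exp (- x) ∣)
    (2^ (- (c * fromℕ d)))))
    ×
    (∃ λ (C : ℝ) → fromℕ 0 < C ×
    ((δ : ℝ) (δ>0 : fromℕ 0 < δ) →
    Σ (RationalFunction [0,∞[) λ r →
    (fromℕ (RationalFunction.degree r)
    ≤ C * (log (1/ δ [ δ>0 ]) (1/-pos δ δ>0) ⊔ fromℕ 0))
    ×
    IsApproximation δ [0,∞[ (λ x _ → exp (- x)) (RationalFunction.eval r)))
theorem4p1 =
  (fromℚ ½ , (½ , Sequences.0<½ , 0 , λ _ _ → ℚP.≤-refl) , 1/S-approximates) ,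
  (fromℕ 25 , (1ℚ , Sequences.0<1 , 0 , λ _ _ → ℚP.≤ᵇ⇒≤ _) , approximation)
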